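{- Let $p$ be an odd prime and $D_{2p}=\langle \tau,\sigma\mid \tau^p=\sigma^2=e,\ \sigma\tau\sigma=\tau^{ -1}\rangle$. The number of connected Cayley digraphs on $D_{2p}$ up to isomorphism is $\mathcal{N}_1=\mathcal{N}-\mathcal{N}_c-1$, where $$\mathcal{N}=\frac{1}{p}2^{p}(1-2^{p-1})+\frac{2}{p-1}\sum_{d\mid(p-1)}\Phi(d)\,2^{\frac{2(p-1)}{d}},\qquad \mathcal{N}_c=\frac{1}{p-1}\sum_{d\mid(p-1)}\Phi(d)\,2^{\frac{p-1}{d}},$$ and $\Phi$ is Euler's totient function.
   Context: For a finite group $G$ and $S\subseteq G$ with $e\notin S$, the Cayley digraph $\mathrm{Cay}(G,S)$ has vertex set $G$ and an arc from $g$ to $h$ whenever $hg^{ -1}\in S$; it is connected if and only if $\langle S\rangle=G$. Counting is of isomorphism classes of such digraphs with $G=D_{2p}$. -}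

module Defs where

open import Data.Nat using (ℕ; zero; suc; _+_; _*_; _∸_; _^_; NonZero)
open import Data.Nat.DivMod using (_mod_; _/_)
open import Data.Nat.Divisibility using (_∣?_)
open import Data.Nat.GCD using (gcd)
open import Data.Fin using (Fin; toℕ)
open import Data.Bool using (Bool; true; false)
open import Data.Product using (Σ; _×_; _,_)
open import Data.List using (List; length; map; filter; upTo)
open import Data.Nat.ListAction using (sum)
open import Data.List.Relation.Unary.All using (All)
open import Data.List.Relation.Unary.Any using (Any)
open import Data.List.Relation.Unary.AllPairs using (AllPairs)
open import Data.Integer as ℤ using (ℤ; +_)
open import Data.Rational as ℚ using (ℚ)
open import Function.Bundles using (Bijection; _⤖_; _⇔_)
open import Relation.Binary.PropositionalEquality using (_≡_)
open import Relation.Nullary using (¬_)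
import Data.Nat as ℕ

-- The dihedral group D_{2p}: the element (i , j) stands for τ^i σ^j,
-- with τ^p = σ^2 = e and σ τ σ = τ⁻¹, so that
--   (τ^i σ^j)(τ^k σ^l) = τ^(i + (-1)^j k) σ^(j + l).

D : (p : ℕ) → Set
D p = Fin p × Fin 2

module _ (p : ℕ) .{{_ : NonZero p}} where

  negp : Fin p → Fin p
  negp k = (p ∸ toℕ k) mod p

  addp : Fin p → Fin p → Fin p
  addp i k = (toℕ i + toℕ k) mod p

  add2 : Fin 2 → Fin 2 → Fin 2
  add2 j l = (toℕ j + toℕ l) mod 2

  twist : Fin 2 → Fin p → Fin p
  twist Fin.zero    k = k
  twist (Fin.suc _) k = negp k

  _·_ : D p → D p → D p
  (i , j) · (k , l) = addp i (twist j k) , add2 j l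

  e : D p
  e = (0 mod p) , Fin.zero

  inv : D p → D p
  inv (i , Fin.zero)  = negp i , Fin.zero
  inv (i , Fin.suc z) = i , Fin.suc z

  CayleySet : (D p → Bool) → Set
  CayleySet S = S e ≡ false

  Arc : (D p → Bool) → D p → D p → Set
  Arc S g h = S (h · inv g) ≡ true

  data Gen (S : D p → Bool) : D p → Set where
    gen-e   : Gen S e
    gen-s   : ∀ {s} → S s ≡ true → Gen S s
    gen-mul : ∀ {a b} → Gen S a → Gen S b → Gen S (a · b)
    gen-inv : ∀ {a} → Gen S a → Gen S (inv a)

  -- Cay(G,S) is connected iff ⟨S⟩ = G
  Connected : (D p → Bool) → Set
  Connected S = ∀ g → Gen S g

  IsoCay : (D p → Bool) → (D p → Bool) → Set
  IsoCay S T = Σ (D p ⤖ D p) λ f →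
    ∀ g h → Arc S g h ⇔ Arc T (Bijection.to f g) (Bijection.to f h)

  ConnCay : (D p → Bool) → Set
  ConnCay S = CayleySet S × Connected S

  NumConnIsoClasses : ℕ → Set
  NumConnIsoClasses N = Σ (List (D p → Bool)) λ L →
    length L ≡ N
    × All ConnCay L
    × AllPairs (λ S T → ¬ IsoCay S T) L
    × (∀ S → ConnCay S → Any (IsoCay S) L)

totient : ℕ → ℕ
totient d = length (filter (λ k → gcd k d ℕ.≟ 1) (map suc (upTo d)))

divSum : ℕ → ℕ → ℕ
divSum c n = sum (map (λ k → totient (suc k) * 2 ^ ((c * n) / suc k))
                      (filter (λ k → suc k ∣? n) (upTo n)))

-- a / d as a rational (d = 0 never occurs below since p ≥ 3)
frac : ℤ → ℕ → ℚ
frac a zero    = ℚ.0ℚ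
frac a (suc d) = a ℚ./ suc d

𝒩 : ℕ → ℚ
𝒩 p = frac ((+ (2 ^ p)) ℤ.* (ℤ.1ℤ ℤ.- + (2 ^ (p ∸ 1)))) p
      ℚ.+ frac (+ (2 * divSum 2 (p ∸ 1))) (p ∸ 1)

𝒩c : ℕ → ℚ
𝒩c p = frac (+ divSum 1 (p ∸ 1)) (p ∸ 1)

𝒩₁ : ℕ → ℚ
𝒩₁ p = 𝒩 p ℚ.- 𝒩c p ℚ.- ℚ.1ℚ

{-# OPTIONS --safe #-}
module Submission where

-- Idea. The automorphisms of D_2p are the maps τ^i ↦ τ^(ci), τ^iσ ↦ τ^(ci+d)σ with c ≠ 0, and two connected
-- Cayley digraphs are isomorphic only if such a map carries one connection set to the other. To see this, let the
-- rotations act on the isomorphisms f : Cay(S) → Cay(T) with f(e) = e by (k·f)(x) = f(xτ^k) f(τ^k)⁻¹. The fixed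
-- points are the automorphisms of D_2p carrying S to T, and modulo p their number equals the number of all such f,
-- which does not change when T is replaced by S. If the set of reflections in S is neither empty nor full, there
-- are between 1 and p − 1 of them for T = S, hence at least one for T. If it is full for both S and T, an
-- isomorphism induces one between the circulant digraphs on the rotations, which extends to digraphs with a single
-- reflection.
--
-- The classes are then counted by Burnside's lemma. An automorphism with c ≠ 1 has (p−1)/ord c orbits on the
-- non-trivial rotations and one more on the reflections, and φ(d) of the units have order d. The connection sets
-- that do not generate D_2p either contain no reflection or consist of one reflection.

-- Why full sets of reflections are treated apart: if `S` contains every reflection, each unit `c`
-- that preserves its rotations may be combined with every offset `d`, so the fixed points for T = S
-- come in multiples of p and the congruence carries no information. Trading the full set for a
-- single reflection restores a count below p.
--
-- Where the formula comes from: put n = p - 1 and let the p·n automorphisms act on pairs of a set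
-- of non-trivial rotations and a set of reflections. A unit c ≠ 1 of order d fixes 2·4^(n/d) pairs
-- for each of the p offsets. Summing this expression over all units, c = 1 included, and dividing
-- by p·n gives the second term of `𝒩`. For c = 1 the true total is 2^n (2n + 2^p) instead of
-- 2p·4^n; the difference divided by p·n is 2^p (1 - 2^n) / p, the first term. The sets without
-- reflections average to `𝒩c`, and the sets consisting of one reflection form a single orbit,
-- whence the final 1.

open import Defs hiding (_·_)
open import Algebra.Bundles using (CommutativeRing; Group)
import Algebra.Properties.Group as GroupProperties
import Algebra.Properties.Ring as RingProperties
import Algebra.Properties.Semiring.Sum as Sum
import Algebra.Solver.Ring.NaturalCoefficients.Default as SemiringSolver
open import Algebra.Structures using (IsGroup)
open import Data.Bool using (Bool; true; false)
open import Data.Bool.Properties using (T-irrelevant; ¬-not; ⇔→≡)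
open import Data.Fin as Fin using (Fin; zero; suc; toℕ; fromℕ<; _↑ˡ_; _↑ʳ_; splitAt; join)
open import Data.Fin.Permutation using (↔⇒≡)
import Data.Fin.Properties as Fin
import Data.Integer as ℤ
import Data.Integer.Properties as ℤ
import Data.Integer.Solver as ℤ-Solver
open import Data.List as List using (length; map; filter; applyUpTo)
import Data.List.Properties as List
import Data.List.Relation.Unary.All.Properties as All
import Data.List.Relation.Unary.AllPairs.Properties as AllPairs
import Data.List.Relation.Unary.Any.Properties as Any
open import Data.Nat as ℕ using (ℕ; zero; suc; _+_; _*_; _∸_; _^_; _≤_; _<_; NonZero; _%_; s≤s; z≤n)
open import Data.Nat.Coprimality using (prime⇒coprime; coprime-Bézout; coprime-divisor; gcd≡1⇒coprime) renaming (sym to coprime-sym)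
open import Data.Nat.Divisibility using (_∣_; divides; _∣?_; ∣-antisym; ∣⇒≤; m∣m*n; ∣m+n∣m⇒∣n)
open import Data.Nat.DivMod using (_mod_; m%n<n; %-distribˡ-+; %-distribˡ-*; m<n⇒m%n≡m; n%n≡0; m*n%n≡0; m≡m%n+[m/n]*n; m*n/n≡m; m/n*n≡m)
open import Data.Nat.GCD using (gcd; gcd[m,n]∣m; gcd[m,n]∣n; module Bézout)
import Data.Nat.ListAction as ListAction
open import Data.Nat.Primality using (Prime; prime⇒nonTrivial; ¬prime[0]; ¬prime[1])
import Data.Nat.Properties as ℕ
import Data.Nat.Solver as ℕ-Solver
open import Data.Product using (Σ; ∃; _×_; _,_; proj₁; proj₂)
import Data.Rational as ℚ
import Data.Rational.Properties as ℚ
import Data.Rational.Unnormalised as ℚᵘ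
import Data.Rational.Unnormalised.Properties as ℚᵘ
open import Data.Sum using (_⊎_; inj₁; inj₂)
open import Data.Unit using (tt)
open import Data.Vec using (Vec; []; _∷_; lookup; tabulate; replicate)
open import Data.Vec.Properties using (lookup∘tabulate; tabulate∘lookup; tabulate-cong)
open import Function using (_∘_; id; _∋_)
open import Function.Bundles using (_↔_; mk↔ₛ′; Inverse; Bijection; mk⇔; mk⤖)
open import Relation.Binary.Definitions using (tri<; tri≈; tri>)
open import Relation.Binary.PropositionalEquality using (_≡_; _≢_; refl; sym; trans; cong; cong₂; subst; isEquivalence; module ≡-Reasoning)
open import Relation.Nullary using (¬_; Dec; yes; no; contradiction; does)
open import Relation.Nullary.Decidable using (True; toWitness; fromWitness; map′; ¬?; _×-dec_; _⊎-dec_; _→-dec_; dec-true; dec-false; does-⇔; decidable-stable)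

open Sum ℕ.+-*-semiring using (sum; sum-cong-≗; ∑-distrib-+; *-distribʳ-sum; *-distribˡ-sum; ∑-comm)

-- Finite types, their sizes and sums over them

record Finite (A : Set) : Set where
  field
    size     : ℕ
    index    : A → Fin size
    at       : Fin size → A
    at-index : ∀ a → at (index a) ≡ a
    index-at : ∀ i → index (at i) ≡ i

  index-injective : ∀ {a b} → index a ≡ index b → a ≡ b
  index-injective {a} {b} eq = trans (sym (at-index a)) (trans (cong at eq) (at-index b))

  ∑ : (A → ℕ) → ℕ
  ∑ f = sum (f ∘ at)

open Finite

opaque
  dec≡ : ∀ {A} → Finite A → (a b : A) → Dec (a ≡ b)
  dec≡ F a b = map′ (index-injective F) (cong (index F)) (index F a Fin.≟ index F b)

  all? : ∀ {A} → Finite A → {P : A → Set} → (∀ a → Dec (P a)) → Dec (∀ a → P a)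
  all? F {P} P? = map′ (λ h a → subst P (at-index F a) (h (index F a))) (λ h i → h (at F i)) (Fin.all? (P? ∘ at F))

  any? : ∀ {A} → Finite A → {P : A → Set} → (∀ a → Dec (P a)) → Dec (∃ P)
  any? F {P} P? = map′ (λ { (i , q) → at F i , q }) (λ { (a , q) → index F a , subst P (sym (at-index F a)) q })
                       (Fin.any? (P? ∘ at F))

∑-cong : ∀ {A} (F : Finite A) {f g : A → ℕ} → (∀ a → f a ≡ g a) → ∑ F f ≡ ∑ F g
∑-cong F eq = sum-cong-≗ (λ i → eq (at F i))

∑-+ : ∀ {A} (F : Finite A) (f g : A → ℕ) → ∑ F (λ a → f a + g a) ≡ ∑ F f + ∑ F g
∑-+ F f g = ∑-distrib-+ (f ∘ at F) (g ∘ at F)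

∑-*ʳ : ∀ {A} (F : Finite A) (f : A → ℕ) c → ∑ F (λ a → f a * c) ≡ ∑ F f * c
∑-*ʳ F f c = sym (*-distribʳ-sum c (f ∘ at F))

∑-*ˡ : ∀ {A} (F : Finite A) (f : A → ℕ) c → ∑ F (λ a → c * f a) ≡ c * ∑ F f
∑-*ˡ F f c = sym (*-distribˡ-sum c (f ∘ at F))

sum-const : ∀ n c → sum {n} (λ _ → c) ≡ n * c
sum-const zero    c = refl
sum-const (suc n) c = cong (c +_) (sum-const n c)

∑-const : ∀ {A} (F : Finite A) c → ∑ F (λ _ → c) ≡ size F * c
∑-const F c = sum-const (size F) c

∑-swap : ∀ {A B} (F : Finite A) (H : Finite B) (f : A → B → ℕ) →
         ∑ F (λ a → ∑ H (f a)) ≡ ∑ H (λ b → ∑ F (λ a → f a b))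
∑-swap F H f = ∑-comm (λ i j → f (at F i) (at H j))

sum-mono : ∀ {n} (f g : Fin n → ℕ) → (∀ i → f i ≤ g i) → sum f ≤ sum g
sum-mono {zero}  f g le = ℕ.z≤n
sum-mono {suc n} f g le = ℕ.+-mono-≤ (le zero) (sum-mono (f ∘ suc) (g ∘ suc) (le ∘ suc))

-- Equal totals leave no slack in any term. This later turns upper bounds for the number of units of
-- each order into exact values.
sum-mono-≡ : ∀ {n} (f g : Fin n → ℕ) → (∀ i → f i ≤ g i) → sum f ≡ sum g → ∀ i → f i ≡ g i
sum-mono-≡ {suc n} f g le eq i = go i
  where
  tail-le : sum (f ∘ suc) ≤ sum (g ∘ suc)
  tail-le = sum-mono (f ∘ suc) (g ∘ suc) (le ∘ suc)
  head-≡ : f zero ≡ g zero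
  head-≡ = ℕ.≤-antisym (le zero) (ℕ.+-cancelʳ-≤ (sum (f ∘ suc)) (g zero) (f zero)
             (ℕ.≤-trans (ℕ.+-monoʳ-≤ (g zero) tail-le) (ℕ.≤-reflexive (sym eq))))
  tail-≡ : sum (f ∘ suc) ≡ sum (g ∘ suc)
  tail-≡ = ℕ.+-cancelˡ-≡ (f zero) _ _ (trans eq (cong (_+ sum (g ∘ suc)) (sym head-≡)))
  go : ∀ i → f i ≡ g i
  go zero    = head-≡
  go (suc i) = sum-mono-≡ (f ∘ suc) (g ∘ suc) (le ∘ suc) tail-≡ i

sum-replace : ∀ {n} (f g : Fin n → ℕ) c → (∀ i → i ≢ c → f i ≡ g i) → sum f + g c ≡ sum g + f c
sum-replace {suc n} f g zero eq = trans (ℕ.+-comm _ (g zero)) (trans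
  (cong (λ s → g zero + (f zero + s)) (sum-cong-≗ (λ i → eq (suc i) (λ ()))))
  (trans (cong (g zero +_) (ℕ.+-comm (f zero) _)) (sym (ℕ.+-assoc (g zero) _ _))))
sum-replace {suc n} f g (suc c) eq = trans (ℕ.+-assoc (f zero) _ _) (trans
  (cong₂ _+_ (eq zero (λ ())) (sum-replace (f ∘ suc) (g ∘ suc) c (λ i i≢c → eq (suc i) (i≢c ∘ Fin.suc-injective))))
  (sym (ℕ.+-assoc (g zero) _ _)))

-- Stated additively: replacing the value at one point changes the sum by the difference of the two values.
∑-replace : ∀ {A} (F : Finite A) (f g : A → ℕ) c → (∀ a → a ≢ c → f a ≡ g a) → ∑ F f + g c ≡ ∑ F g + f c
∑-replace F f g c eq = subst (λ z → ∑ F f + g z ≡ ∑ F g + f z) (at-index F c)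
  (sum-replace (f ∘ at F) (g ∘ at F) (index F c)
    (λ i i≢c → eq (at F i) (λ ati≡c → i≢c (trans (sym (index-at F i)) (cong (index F) ati≡c)))))

size-↔ : ∀ {A B} (F : Finite A) (H : Finite B) (to : A → B) (from : B → A) →
         (∀ b → to (from b) ≡ b) → (∀ a → from (to a) ≡ a) → size F ≡ size H
size-↔ F H to from to-from from-to = ↔⇒≡ (mk↔ₛ′ (λ i → index H (to (at F i))) (λ j → index F (from (at H j)))
  (λ j → trans (cong (index H) (trans (cong to (at-index F _)) (to-from _))) (index-at H j))
  (λ i → trans (cong (index F) (trans (cong from (at-index H _)) (from-to _))) (index-at F i)))

size-injective : ∀ {A B} (F : Finite A) (H : Finite B) (f : A → B) →
                 (∀ {a b} → f a ≡ f b → a ≡ b) → size F ≤ size H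
size-injective F H f inj = Fin.injective⇒≤ {f = λ i → index H (f (at F i))}
  (λ {i} {j} eq → trans (sym (index-at F i)) (trans (cong (index F) (inj (index-injective H eq))) (index-at F j)))

inhabited⇒size : ∀ {A} (F : Finite A) → A → 0 < size F
inhabited⇒size F a with size F | index F a
... | suc n | _ = ℕ.s≤s ℕ.z≤n

size⇒inhabited : ∀ {A} (F : Finite A) → size F ≢ 0 → A
size⇒inhabited F ≢0 with size F | at F
... | zero  | _ = contradiction refl ≢0
... | suc n | f = f zero

empty⇒size : ∀ {A} (F : Finite A) → ¬ A → size F ≡ 0
empty⇒size F ¬A with size F | at F
... | zero  | _ = refl
... | suc n | f = contradiction (f zero) ¬A

Fin-finite : ∀ n → Finite (Fin n)
Fin-finite n = record { size = n ; index = id ; at = id ; at-index = λ _ → refl ; index-at = λ _ → refl }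

Bool-finite : Finite Bool
Bool-finite = record
  { size = 2 ; index = λ { true → zero ; false → suc zero } ; at = λ { zero → true ; (suc zero) → false }
  ; at-index = λ { true → refl ; false → refl } ; index-at = λ { zero → refl ; (suc zero) → refl } }

↔-finite : ∀ {A B} → Finite A → A ↔ B → Finite B
↔-finite F A↔B = record
  { size = size F ; index = index F ∘ from ; at = to ∘ at F
  ; at-index = λ b → trans (cong to (at-index F (from b))) (strictlyInverseˡ b)
  ; index-at = λ i → trans (cong (index F) (strictlyInverseʳ (at F i))) (index-at F i) }
  where open Inverse A↔B

flatten : ∀ {n} (f : Fin n → ℕ) → Σ (Fin n) (Fin ∘ f) → Fin (sum f)
flatten {suc n} f (zero  , k) = k ↑ˡ _
flatten {suc n} f (suc i , k) = f zero ↑ʳ flatten (f ∘ suc) (i , k)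

unflatten : ∀ {n} (f : Fin n → ℕ) → Fin (sum f) → Σ (Fin n) (Fin ∘ f)
-- A function of its own, so that `cong` can rewrite the result of `splitAt` inside it.
unflatten-split : ∀ {n} (f : Fin (suc n) → ℕ) → Fin (f zero) ⊎ Fin (sum (f ∘ suc)) → Σ (Fin (suc n)) (Fin ∘ f)
unflatten {suc n} f k = unflatten-split f (splitAt (f zero) k)
unflatten-split f (inj₁ k) = zero , k
unflatten-split f (inj₂ k) = let (i , l) = unflatten (f ∘ suc) k in suc i , l

unflatten-flatten : ∀ {n} (f : Fin n → ℕ) x → unflatten f (flatten f x) ≡ x
unflatten-flatten {suc n} f (zero  , k) = cong (unflatten-split f) (Fin.splitAt-↑ˡ (f zero) k _)
unflatten-flatten {suc n} f (suc i , k) =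
  trans (cong (unflatten-split f) (Fin.splitAt-↑ʳ (f zero) _ (flatten (f ∘ suc) (i , k))))
        (cong (λ { (j , l) → suc j , l }) (unflatten-flatten (f ∘ suc) (i , k)))

flatten-unflatten : ∀ {n} (f : Fin n → ℕ) k → flatten f (unflatten f k) ≡ k
flatten-split : ∀ {n} (f : Fin (suc n) → ℕ) s → flatten f (unflatten-split f s) ≡ join (f zero) _ s
flatten-unflatten {suc n} f k = trans (flatten-split f (splitAt (f zero) k)) (Fin.join-splitAt (f zero) _ k)
flatten-split f (inj₁ k) = refl
flatten-split f (inj₂ k) = cong (f zero ↑ʳ_) (flatten-unflatten (f ∘ suc) k)

opaque
  Σ-finite : ∀ {A} {B : A → Set} → Finite A → (∀ a → Finite (B a)) → Finite (Σ A B)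
  Σ-finite {A} {B} F H = record
    { size     = ∑ F (size ∘ H)
    ; index    = λ { (a , b) → flatten sizes (index F a , index (H _) (subst B (sym (at-index F a)) b)) }
    ; at       = λ k → let (i , l) = unflatten sizes k in at F i , at (H _) l
    ; at-index = λ { (a , b) → trans (cong fibre (unflatten-flatten sizes _))
                   (Σ-≡ (at-index F a) (trans (cong (subst B (at-index F a)) (at-index (H _) _)) (subst-subst-sym (at-index F a)))) }
    ; index-at = λ k → trans (cong (flatten sizes) (refibre (unflatten sizes k))) (flatten-unflatten sizes k)
    }
    where
    sizes : Fin (size F) → ℕ
    sizes i = size (H (at F i))
    fibre : Σ (Fin (size F)) (Fin ∘ sizes) → Σ A B
    fibre (i , l) = at F i , at (H _) l
    Σ-≡ : ∀ {a a′ b b′} (eq : a ≡ a′) → subst B eq b ≡ b′ → (Σ A B ∋ (a , b)) ≡ (a′ , b′)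
    Σ-≡ refl refl = refl
    subst-subst-sym : ∀ {a a′ b} (eq : a ≡ a′) → subst B eq (subst B (sym eq) b) ≡ b
    subst-subst-sym refl = refl
    refibre : (x : Σ (Fin (size F)) (Fin ∘ sizes)) → let (i , l) = x in
              (Σ (Fin (size F)) (Fin ∘ sizes) ∋ (index F (at F i) , index (H _) (subst B (sym (at-index F (at F i))) (at (H _) l)))) ≡ (i , l)
    refibre (i , l) = lemma (index-at F i) (at-index F (at F i))
      where
      -- With `index F (at F i)` replaced by a variable `j`, both equations can be matched with
      -- `refl`, which removes the transport.
      lemma : ∀ {j} (eq : j ≡ i) (eq′ : at F j ≡ at F i) →
              (Σ (Fin (size F)) (Fin ∘ sizes) ∋ (j , index (H _) (subst B (sym eq′) (at (H _) l)))) ≡ (i , l)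
      lemma refl refl = cong (i ,_) (index-at (H _) l)

  size-Σ : ∀ {A} {B : A → Set} (F : Finite A) (H : ∀ a → Finite (B a)) → size (Σ-finite F H) ≡ ∑ F (size ∘ H)
  size-Σ F H = refl

×-finite : ∀ {A B} → Finite A → Finite B → Finite (A × B)
×-finite F H = Σ-finite F (λ _ → H)

size-× : ∀ {A B} (F : Finite A) (H : Finite B) → size (×-finite F H) ≡ size F * size H
size-× F H = trans (size-Σ F (λ _ → H)) (∑-const F (size H))

True-finite : ∀ {P : Set} (P? : Dec P) → Finite (True P?)
True-finite (yes _) = record { size = 1 ; index = λ _ → zero ; at = λ _ → tt ; at-index = λ _ → refl ; index-at = λ { zero → refl } }
True-finite (no _)  = record { size = 0 ; index = λ () ; at = λ () ; at-index = λ () ; index-at = λ () }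

-- `True (P? a)` has at most one element whatever `P a` is. Members of a subtype are therefore equal
-- as soon as their first components are, and its size counts elements rather than proofs.
Sub : ∀ {A : Set} {P : A → Set} → (∀ a → Dec (P a)) → Set
Sub {A} P? = Σ A (λ a → True (P? a))

Sub-finite : ∀ {A} {P : A → Set} → Finite A → (P? : ∀ a → Dec (P a)) → Finite (Sub P?)
Sub-finite F P? = Σ-finite F (λ a → True-finite (P? a))

Sub-≡ : ∀ {A} {P : A → Set} (P? : ∀ a → Dec (P a)) {x y : Sub P?} → proj₁ x ≡ proj₁ y → x ≡ y
Sub-≡ P? {a , s} {.a , t} refl = cong (a ,_) (T-irrelevant s t)

opaque
  ⊎-finite : ∀ {A B} → Finite A → Finite B → Finite (A ⊎ B)
  ⊎-finite {A} {B} F H = record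
    { size     = size F + size H
    ; index    = to
    ; at       = λ k → from (splitAt (size F) k)
    ; at-index = λ { (inj₁ a) → trans (cong from (Fin.splitAt-↑ˡ (size F) (index F a) _)) (cong inj₁ (at-index F a))
                   ; (inj₂ b) → trans (cong from (Fin.splitAt-↑ʳ (size F) _ (index H b))) (cong inj₂ (at-index H b)) }
    ; index-at = λ k → trans (to-from (splitAt (size F) k)) (Fin.join-splitAt (size F) _ k) }
    where
    to : A ⊎ B → Fin (size F + size H)
    to (inj₁ a) = index F a ↑ˡ size H
    to (inj₂ b) = size F ↑ʳ index H b
    from : Fin (size F) ⊎ Fin (size H) → A ⊎ B
    from (inj₁ i) = inj₁ (at F i)
    from (inj₂ j) = inj₂ (at H j)
    to-from : ∀ s → to (from s) ≡ join (size F) (size H) s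
    to-from (inj₁ i) = cong (_↑ˡ size H) (index-at F i)
    to-from (inj₂ j) = cong (size F ↑ʳ_) (index-at H j)

  size-⊎ : ∀ {A B} (F : Finite A) (H : Finite B) → size (⊎-finite F H) ≡ size F + size H
  size-⊎ F H = refl

opaque
  Vec-finite : ∀ {A} → Finite A → ∀ n → Finite (Vec A n)
  Vec-finite F zero    = record { size = 1 ; index = λ _ → zero ; at = λ _ → [] ; at-index = λ { [] → refl } ; index-at = λ { zero → refl } }
  Vec-finite F (suc n) = ↔-finite (×-finite F (Vec-finite F n)) (mk↔ₛ′ (λ { (a , as) → a ∷ as }) (λ { (a ∷ as) → a , as }) (λ { (a ∷ as) → refl }) (λ { (a , as) → refl }))

  size-Vec : ∀ {A} (F : Finite A) n → size (Vec-finite F n) ≡ size F ^ n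
  size-Vec F zero    = refl
  size-Vec F (suc n) = trans (size-× F (Vec-finite F n)) (cong (size F *_) (size-Vec F n))

-- Functions from a finite type are stored as vectors, so that pointwise equality is propositional equality.
module Tables {A : Set} (F : Finite A) where

  Table : Set → Set
  Table B = Vec B (size F)

  infixl 9 _!_
  opaque
    _!_ : ∀ {B} → Table B → A → B
    t ! a = lookup t (index F a)

    table : ∀ {B} → (A → B) → Table B
    table f = tabulate (f ∘ at F)

    table-! : ∀ {B} (f : A → B) a → table f ! a ≡ f a
    table-! f a = trans (lookup∘tabulate (f ∘ at F) (index F a)) (cong f (at-index F a))

    !-injective : ∀ {B} {s t : Table B} → (∀ a → s ! a ≡ t ! a) → s ≡ t
    !-injective {s = s} {t} eq = trans (sym (tabulate∘lookup s)) (trans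
      (tabulate-cong (λ i → trans (cong (lookup s) (sym (index-at F i))) (trans (eq (at F i)) (cong (lookup t) (index-at F i)))))
      (tabulate∘lookup t))

  Table-finite : ∀ {B} → Finite B → Finite (Table B)
  Table-finite H = Vec-finite H (size F)

  size-Table : ∀ {B} (H : Finite B) → size (Table-finite H) ≡ size H ^ size F
  size-Table H = size-Vec H (size F)

first : ∀ {n} → (Fin n → Bool) → Fin n → Fin n
first b zero    = zero
first b (suc d) with b zero
... | true  = zero
... | false = suc (first (b ∘ suc) d)

first-true : ∀ {n} (b : Fin n → Bool) d → b d ≡ true → b (first b d) ≡ true
first-true b zero    bd = bd
first-true b (suc d) bd with b zero in eq
... | true  = eq
... | false = first-true (b ∘ suc) d bd

first-unique : ∀ {n} (b : Fin n → Bool) d d′ → b d ≡ true → b d′ ≡ true → first b d ≡ first b d′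
first-unique b zero    zero     bd bd′ = refl
first-unique b zero    (suc d′) bd bd′ with b zero
... | true  = refl
... | false = contradiction bd λ ()
first-unique b (suc d) zero     bd bd′ with b zero
... | true  = refl
... | false = contradiction bd′ λ ()
first-unique b (suc d) (suc d′) bd bd′ with b zero
... | true  = refl
... | false = cong suc (first-unique (b ∘ suc) d d′ bd bd′)

first-cong : ∀ {n} {b b′ : Fin n → Bool} → (∀ i → b i ≡ b′ i) → ∀ d → first b d ≡ first b′ d
first-cong eq zero = refl
first-cong {b = b} {b′} eq (suc d) with b zero | b′ zero | eq zero
... | true  | true  | _ = refl
... | false | false | _ = cong suc (first-cong (eq ∘ suc) d)

-- Group actions, orbit representatives and Burnside's lemma

record Action (G X : Set) : Set where
  infixr 7 _∙_
  infixr 6 _▷_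
  infix  8 _⁻¹
  field
    _∙_     : G → G → G
    ε       : G
    _⁻¹     : G → G
    isGroup : IsGroup _≡_ _∙_ ε _⁻¹
    _▷_     : G → X → X
    ▷-ε     : ∀ x → ε ▷ x ≡ x
    ▷-∙     : ∀ g h x → (g ∙ h) ▷ x ≡ g ▷ h ▷ x

  open IsGroup isGroup public using (assoc; identityʳ; inverseˡ; inverseʳ)

  ▷-⁻¹ : ∀ g {x y} → g ▷ x ≡ y → g ⁻¹ ▷ y ≡ x
  ▷-⁻¹ g {x} refl = trans (sym (▷-∙ (g ⁻¹) g x)) (trans (cong (_▷ x) (inverseˡ g)) (▷-ε x))

module Orbits {G X : Set} (FG : Finite G) (FX : Finite X) (𝒜 : Action G X) where
  open Action 𝒜

  infix 4 _~_ _~?_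
  _~_ : X → X → Set
  x ~ y = ∃ λ g → g ▷ y ≡ x

  _~?_ : ∀ x y → Dec (x ~ y)
  x ~? y = any? FG (λ g → dec≡ FX (g ▷ y) x)

  ~-refl : ∀ {x} → x ~ x
  ~-refl {x} = ε , ▷-ε x

  ~-sym : ∀ {x y} → x ~ y → y ~ x
  ~-sym (g , eq) = g ⁻¹ , ▷-⁻¹ g eq

  ~-trans : ∀ {x y z} → x ~ y → y ~ z → x ~ z
  ~-trans {z = z} (g , eq) (h , eq′) = g ∙ h , trans (▷-∙ g h z) (trans (cong (g ▷_) eq′) eq)

  opaque
   -- The element of least index in the orbit of `x`. The choice looks only at which indices belong
   -- to the orbit, so it is constant on orbits.
   rep : X → X
   rep x = at FX (first (λ i → does (x ~? at FX i)) (index FX x))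

   self : ∀ {x y} → x ~ y → does (x ~? at FX (index FX y)) ≡ true
   self {x} {y} x~y = dec-true (x ~? _) (subst (x ~_) (sym (at-index FX y)) x~y)

   ~-rep : ∀ x → x ~ rep x
   ~-rep x with x ~? rep x | first-true (λ i → does (x ~? at FX i)) (index FX x) (self ~-refl)
   ... | yes x~r | _  = x~r
   ... | no _    | ()

   rep-cong : ∀ {x y} → x ~ y → rep x ≡ rep y
   rep-cong {x} {y} x~y = cong (at FX) (trans
     (first-unique _ (index FX x) (index FX y) (self ~-refl) (self x~y))
     (first-cong (λ i → does-⇔ (mk⇔ (~-trans (~-sym x~y)) (~-trans x~y)) (x ~? at FX i) (y ~? at FX i)) (index FX y)))

  rep-idem : ∀ x → rep (rep x) ≡ rep x
  rep-idem x = sym (rep-cong (~-rep x))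

  isRep? : ∀ x → Dec (rep x ≡ x)
  isRep? x = dec≡ FX (rep x) x

  Reps : Set
  Reps = Sub isRep?

  Reps-finite : Finite Reps
  Reps-finite = Sub-finite FX isRep?

  toRep : X → Reps
  toRep x = rep x , fromWitness (rep-idem x)

  toRep-rep : (r : Reps) → toRep (proj₁ r) ≡ r
  toRep-rep (r , isRep) = Sub-≡ isRep? (toWitness isRep)

  Fix-finite : (g : G) → Finite (Sub (λ x → dec≡ FX (g ▷ x) x))
  Fix-finite g = Sub-finite FX (λ x → dec≡ FX (g ▷ x) x)

  -- With t x chosen such that t x ▷ rep x ≡ x, the bijection sends a pair g ▷ x ≡ x to (g ∙ t x , rep x).
  burnside : ∑ FG (λ g → size (Fix-finite g)) ≡ size FG * size Reps-finite
  burnside = trans (sym (size-Σ FG Fix-finite)) (trans (size-↔ (Σ-finite FG Fix-finite) (×-finite FG Reps-finite) to from to-from from-to) (size-× FG Reps-finite))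
    where
    t : X → G
    t x = proj₁ (~-rep x)

    Fixed : Set
    Fixed = Σ G (λ g → Sub (λ x → dec≡ FX (g ▷ x) x))

    to : Fixed → G × Reps
    to (g , x , _) = g ∙ t x , toRep x

    fixes : ∀ h x → (h ∙ t x ⁻¹) ▷ x ≡ h ▷ rep x
    fixes h x = trans (▷-∙ h (t x ⁻¹) x) (cong (h ▷_) (▷-⁻¹ (t x) (proj₂ (~-rep x))))

    rep-▷ : ∀ h (r : Reps) → rep (h ▷ proj₁ r) ≡ proj₁ r
    rep-▷ h (r , isRep) = trans (rep-cong (h , refl)) (toWitness isRep)

    from : G × Reps → Fixed
    from (h , r) = h ∙ t x ⁻¹ , x , fromWitness (trans (fixes h x) (cong (h ▷_) (rep-▷ h r)))
      where x = h ▷ proj₁ r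

    cancel : ∀ h k → (h ∙ k ⁻¹) ∙ k ≡ h
    cancel h k = trans (assoc h (k ⁻¹) k) (trans (cong (h ∙_) (inverseˡ k)) (identityʳ h))

    cancel′ : ∀ h k → (h ∙ k) ∙ k ⁻¹ ≡ h
    cancel′ h k = trans (assoc h k (k ⁻¹)) (trans (cong (h ∙_) (inverseʳ k)) (identityʳ h))

    to-from : ∀ y → to (from y) ≡ y
    to-from (h , r) = cong₂ _,_ (cancel h _) (Sub-≡ isRep? (rep-▷ h r))

    Fixed-≡ : ∀ {u v : Fixed} → proj₁ u ≡ proj₁ v → proj₁ (proj₂ u) ≡ proj₁ (proj₂ v) → u ≡ v
    Fixed-≡ {g , _} refl eq = cong (g ,_) (Sub-≡ _ eq)

    from-to : ∀ y → from (to y) ≡ y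
    from-to (g , x , gx≡x) = Fixed-≡ (trans (cong (λ y → (g ∙ t x) ∙ t y ⁻¹) x≡) (cancel′ g (t x))) x≡
      where
      x≡ : (g ∙ t x) ▷ rep x ≡ x
      x≡ = trans (▷-∙ g (t x) (rep x)) (trans (cong (g ▷_) (proj₂ (~-rep x))) (toWitness gx≡x))

-- Subsets invariant under a map

module _ {X : Set} (FX : Finite X) where
  open Tables FX

  Invariant : (X → X) → Table Bool → Set
  Invariant φ t = ∀ x → t ! φ x ≡ t ! x

  invariant? : ∀ φ t → Dec (Invariant φ t)
  invariant? φ t = all? FX (λ x → dec≡ Bool-finite (t ! φ x) (t ! x))

  Inv-finite : ∀ φ → Finite (Sub (invariant? φ))
  Inv-finite φ = Sub-finite (Table-finite Bool-finite) (invariant? φ)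

  -- An invariant subset is a union of orbits, that is, one free bit for each orbit representative.
  -- The two hypotheses say that `φ` comes from a group element and that invariance under `φ` passes
  -- to the whole group.
  size-Inv : ∀ {G} (FG : Finite G) (𝒜 : Action G X) (φ : X → X) →
             (∃ λ g → ∀ x → Action._▷_ 𝒜 g x ≡ φ x) →
             (∀ t → Invariant φ t → ∀ g → Invariant (Action._▷_ 𝒜 g) t) →
             size (Inv-finite φ) ≡ 2 ^ size (Orbits.Reps-finite FG FX 𝒜)
  size-Inv FG 𝒜 φ (g₀ , g₀≡φ) generates =
    trans (size-↔ (Inv-finite φ) (Tables.Table-finite Reps-finite Bool-finite) to from to-from from-to)
          (R.size-Table Bool-finite)
    where
    open Orbits FG FX 𝒜
    open Action 𝒜
    module R = Tables Reps-finite

    to : Sub (invariant? φ) → R.Table Bool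
    to (t , _) = R.table (λ r → t ! proj₁ r)

    from : R.Table Bool → Sub (invariant? φ)
    from s = table f , fromWitness (λ x → trans (table-! f (φ x)) (trans
      (cong (s R.!_) (Sub-≡ isRep? {toRep (φ x)} {toRep x} (rep-cong (g₀ , g₀≡φ x)))) (sym (table-! f x))))
      where
      f : X → Bool
      f x = s R.! toRep x

    to-from : ∀ s → to (from s) ≡ s
    to-from s = R.!-injective (λ r → trans (R.table-! (λ r′ → table (λ x → s R.! toRep x) ! proj₁ r′) r) (trans (table-! (λ x → s R.! toRep x) (proj₁ r)) (cong (s R.!_) (toRep-rep r))))

    from-to : ∀ t → from (to t) ≡ t
    from-to (t , inv) = Sub-≡ (invariant? φ) (!-injective (λ x → trans (table-! (λ y → to (t , inv) R.! toRep y) x) (trans (R.table-! (λ r → t ! proj₁ r) (toRep x))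
      (trans (sym (generates t (toWitness inv) (proj₁ (~-rep x)) (rep x))) (cong (t !_) (proj₂ (~-rep x)))))))

-- Arithmetic modulo n

module Modular (n : ℕ) .{{_ : NonZero n}} where

  infixl 6 _⊕_
  infixl 7 _⊗_
  infix  8 ⊖_

  _⊕_ : Fin n → Fin n → Fin n
  _⊕_ = addp n

  ⊖_ : Fin n → Fin n
  ⊖_ = negp n

  [_] : ℕ → Fin n
  [ a ] = a mod n

  𝟘 𝟙 : Fin n
  𝟘 = [ 0 ]
  𝟙 = [ 1 ]

  toℕ-[] : ∀ a → toℕ [ a ] ≡ a % n
  toℕ-[] a = Fin.toℕ-fromℕ< (m%n<n a n)

  []-cong : ∀ {a b} → a % n ≡ b % n → [ a ] ≡ [ b ]
  []-cong {a} {b} eq = Fin.toℕ-injective (trans (toℕ-[] a) (trans eq (sym (toℕ-[] b))))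

  []-≡⇒%≡ : ∀ {a b} → [ a ] ≡ [ b ] → a % n ≡ b % n
  []-≡⇒%≡ {a} {b} eq = trans (sym (toℕ-[] a)) (trans (cong toℕ eq) (toℕ-[] b))

  []-toℕ : ∀ x → [ toℕ x ] ≡ x
  []-toℕ x = Fin.toℕ-injective (trans (toℕ-[] (toℕ x)) (m<n⇒m%n≡m (Fin.toℕ<n x)))

  []-⊕ : ∀ a b → [ a ] ⊕ [ b ] ≡ [ a + b ]
  []-⊕ a b = []-cong (trans (cong₂ (λ u v → (u + v) % n) (toℕ-[] a) (toℕ-[] b)) (sym (%-distribˡ-+ a b n)))

  opaque
    _⊗_ : Fin n → Fin n → Fin n
    x ⊗ y = [ toℕ x * toℕ y ]

    []-⊗ : ∀ a b → [ a ] ⊗ [ b ] ≡ [ a * b ]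
    []-⊗ a b = []-cong (trans (cong₂ (λ u v → (u * v) % n) (toℕ-[] a) (toℕ-[] b)) (sym (%-distribˡ-* a b n)))

  private
    -- Every residue is the class of its own `toℕ`, so a law may be checked on classes, where it is
    -- inherited from the natural numbers.
    from₁ : (P : Fin n → Set) → (∀ a → P [ a ]) → ∀ x → P x
    from₁ P h x = subst P ([]-toℕ x) (h (toℕ x))

  ⊕-assoc : ∀ x y z → (x ⊕ y) ⊕ z ≡ x ⊕ (y ⊕ z)
  ⊕-assoc = from₁ _ λ a → from₁ _ λ b → from₁ _ λ c →
    trans (cong (_⊕ [ c ]) ([]-⊕ a b)) (trans ([]-⊕ (a + b) c) (trans (cong [_] (ℕ.+-assoc a b c))
      (sym (trans (cong ([ a ] ⊕_) ([]-⊕ b c)) ([]-⊕ a (b + c))))))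

  ⊕-comm : ∀ x y → x ⊕ y ≡ y ⊕ x
  ⊕-comm x y = cong [_] (ℕ.+-comm (toℕ x) (toℕ y))

  ⊕-identityˡ : ∀ x → 𝟘 ⊕ x ≡ x
  ⊕-identityˡ = from₁ _ λ a → []-⊕ 0 a

  ⊕-identityʳ : ∀ x → x ⊕ 𝟘 ≡ x
  ⊕-identityʳ x = trans (⊕-comm x 𝟘) (⊕-identityˡ x)

  ⊕-inverseʳ : ∀ x → x ⊕ ⊖ x ≡ 𝟘
  ⊕-inverseʳ x = trans (cong (_⊕ ⊖ x) (sym ([]-toℕ x))) (trans ([]-⊕ (toℕ x) (n ∸ toℕ x))
    (trans (cong [_] (ℕ.m+[n∸m]≡n (ℕ.<⇒≤ (Fin.toℕ<n x)))) ([]-cong (trans (n%n≡0 n) (sym (m<n⇒m%n≡m (ℕ.>-nonZero⁻¹ n)))))))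

  ⊕-inverseˡ : ∀ x → ⊖ x ⊕ x ≡ 𝟘
  ⊕-inverseˡ x = trans (⊕-comm (⊖ x) x) (⊕-inverseʳ x)

  ⊗-assoc : ∀ x y z → (x ⊗ y) ⊗ z ≡ x ⊗ (y ⊗ z)
  ⊗-assoc = from₁ _ λ a → from₁ _ λ b → from₁ _ λ c →
    trans (cong (_⊗ [ c ]) ([]-⊗ a b)) (trans ([]-⊗ (a * b) c) (trans (cong [_] (ℕ.*-assoc a b c))
      (sym (trans (cong ([ a ] ⊗_) ([]-⊗ b c)) ([]-⊗ a (b * c))))))

  opaque
    unfolding _⊗_
    ⊗-comm : ∀ x y → x ⊗ y ≡ y ⊗ x
    ⊗-comm x y = cong [_] (ℕ.*-comm (toℕ x) (toℕ y))

  ⊗-identityˡ : ∀ x → 𝟙 ⊗ x ≡ x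
  ⊗-identityˡ = from₁ _ λ a → trans ([]-⊗ 1 a) (cong [_] (ℕ.*-identityˡ a))

  ⊗-identityʳ : ∀ x → x ⊗ 𝟙 ≡ x
  ⊗-identityʳ x = trans (⊗-comm x 𝟙) (⊗-identityˡ x)

  ⊗-distribˡ-⊕ : ∀ x y z → x ⊗ (y ⊕ z) ≡ x ⊗ y ⊕ x ⊗ z
  ⊗-distribˡ-⊕ = from₁ _ λ a → from₁ _ λ b → from₁ _ λ c →
    trans (cong ([ a ] ⊗_) ([]-⊕ b c)) (trans ([]-⊗ a (b + c)) (trans (cong [_] (ℕ.*-distribˡ-+ a b c))
      (sym (trans (cong₂ _⊕_ ([]-⊗ a b) ([]-⊗ a c)) ([]-⊕ (a * b) (a * c))))))

  ⊗-distribʳ-⊕ : ∀ x y z → (y ⊕ z) ⊗ x ≡ y ⊗ x ⊕ z ⊗ x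
  ⊗-distribʳ-⊕ x y z = trans (⊗-comm (y ⊕ z) x) (trans (⊗-distribˡ-⊕ x y z) (cong₂ _⊕_ (⊗-comm x y) (⊗-comm x z)))

  ⊕-isGroup : IsGroup _≡_ _⊕_ 𝟘 ⊖_
  ⊕-isGroup = record
    { isMonoid = record
      { isSemigroup = record
        { isMagma = record { isEquivalence = isEquivalence ; ∙-cong = cong₂ _⊕_ }
        ; assoc = ⊕-assoc }
      ; identity = ⊕-identityˡ , ⊕-identityʳ }
    ; inverse = ⊕-inverseˡ , ⊕-inverseʳ
    ; ⁻¹-cong = cong ⊖_ }

  ring : CommutativeRing _ _
  ring = record
    { Carrier = Fin n ; _≈_ = _≡_ ; _+_ = _⊕_ ; _*_ = _⊗_ ; -_ = ⊖_ ; 0# = 𝟘 ; 1# = 𝟙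
    ; isCommutativeRing = record
      { isRing = record
        { +-isAbelianGroup = record { isGroup = ⊕-isGroup ; comm = ⊕-comm }
        ; *-cong = cong₂ _⊗_
        ; *-assoc = ⊗-assoc
        ; *-identity = ⊗-identityˡ , ⊗-identityʳ
        ; distrib = ⊗-distribˡ-⊕ , ⊗-distribʳ-⊕ }
      ; *-comm = ⊗-comm } }

  open CommutativeRing ring public using (zeroˡ; zeroʳ; commutativeSemiring)
  open RingProperties (CommutativeRing.ring ring) public
    using (-‿distribˡ-*; -‿distribʳ-*)
    renaming (-‿involutive to ⊖-involutive; -‿+-comm to ⊖-⊕-comm; +-cancelˡ to ⊕-cancelˡ; +-cancelʳ to ⊕-cancelʳ; -0#≈0# to ⊖𝟘)

  toℕ-𝟘 : toℕ 𝟘 ≡ 0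
  toℕ-𝟘 = trans (toℕ-[] 0) (m<n⇒m%n≡m (ℕ.>-nonZero⁻¹ n))

  cancel-⊖ : ∀ x y → (x ⊕ ⊖ y) ⊕ y ≡ x
  cancel-⊖ x y = trans (⊕-assoc x (⊖ y) y) (trans (cong (x ⊕_) (⊕-inverseˡ y)) (⊕-identityʳ x))

  cancel-⊖′ : ∀ x y → (x ⊕ y) ⊕ ⊖ y ≡ x
  cancel-⊖′ x y = trans (⊕-assoc x y (⊖ y)) (trans (cong (x ⊕_) (⊕-inverseʳ y)) (⊕-identityʳ x))

-- Cyclic actions

iter : {X : Set} → (X → X) → ℕ → X → X
iter φ zero    x = x
iter φ (suc k) x = φ (iter φ k x)

iter-+ : ∀ {X : Set} (φ : X → X) k l x → iter φ (k + l) x ≡ iter φ k (iter φ l x)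
iter-+ φ zero    l x = refl
iter-+ φ (suc k) l x = cong φ (iter-+ φ k l x)

module _ {X : Set} (φ : X → X) (d : ℕ) .{{_ : NonZero d}} (period : ∀ x → iter φ d x ≡ x) where
  open Modular d

  iter-* : ∀ q x → iter φ (q * d) x ≡ x
  iter-* zero    x = refl
  iter-* (suc q) x = trans (iter-+ φ d (q * d) x) (trans (period _) (iter-* q x))

  iter-% : ∀ k x → iter φ (k % d) x ≡ iter φ k x
  iter-% k x = sym (trans (cong (λ m → iter φ m x) (m≡m%n+[m/n]*n k d))
    (trans (iter-+ φ (k % d) (k ℕ./ d * d) x) (cong (iter φ (k % d)) (iter-* (k ℕ./ d) x))))

  iter-[] : ∀ k x → iter φ (toℕ [ k ]) x ≡ iter φ k x
  iter-[] k x = trans (cong (λ m → iter φ m x) (toℕ-[] k)) (iter-% k x)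

  -- The iterates of `φ` depend only on the exponent modulo `d`, so they form an action of the
  -- cyclic group of order `d`. Burnside's lemma then counts the cycles of `φ`.
  cyclic : Action (Fin d) X
  cyclic = record
    { _∙_ = _⊕_ ; ε = 𝟘 ; _⁻¹ = ⊖_ ; isGroup = ⊕-isGroup
    ; _▷_ = λ k → iter φ (toℕ k)
    ; ▷-ε = iter-[] 0
    ; ▷-∙ = λ k l x → trans (iter-[] (toℕ k + toℕ l) x) (iter-+ φ (toℕ k) (toℕ l) x) }

  module _ (FX : Finite X) where
    open Orbits (Fin-finite d) FX cyclic
    open Tables FX

    opaque
      orbitCount : ℕ
      orbitCount = size Reps-finite

      orbitCount-burnside : ∑ (Fin-finite d) (λ k → size (Fix-finite k)) ≡ d * orbitCount
      orbitCount-burnside = burnside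

      size-Inv-cyclic : size (Inv-finite FX φ) ≡ 2 ^ orbitCount
      -- The class of 1 acts as `φ`, also for `d` = 1: there it is `𝟘`, and the period makes `φ` the
      -- identity.
      size-Inv-cyclic = size-Inv FX (Fin-finite d) cyclic φ ([ 1 ] , iter-[] 1)
        (λ t inv k → go t inv (toℕ k))
        where
        go : ∀ t → Invariant FX φ t → ∀ k x → t ! iter φ k x ≡ t ! x
        go t inv zero    x = refl
        go t inv (suc k) x = trans (inv _) (go t inv k x)

-- The dihedral group

module Dihedral (p : ℕ) .{{_ : NonZero p}} where
  open Modular p

  infixl 7 _·_
  _·_ : D p → D p → D p
  _·_ = Defs._·_ p

  twist-⊕ : ∀ j x y → twist p j (x ⊕ y) ≡ twist p j x ⊕ twist p j y
  twist-⊕ zero    x y = refl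
  twist-⊕ (suc _) x y = sym (⊖-⊕-comm x y)

  twist-twist : ∀ j l x → twist p j (twist p l x) ≡ twist p (add2 p j l) x
  twist-twist zero       zero       x = refl
  twist-twist zero       (suc zero) x = refl
  twist-twist (suc zero) zero       x = refl
  twist-twist (suc zero) (suc zero) x = ⊖-involutive x

  add2-assoc : ∀ j l m → add2 p (add2 p j l) m ≡ add2 p j (add2 p l m)
  add2-assoc zero       zero       zero       = refl
  add2-assoc zero       zero       (suc zero) = refl
  add2-assoc zero       (suc zero) zero       = refl
  add2-assoc zero       (suc zero) (suc zero) = refl
  add2-assoc (suc zero) zero       zero       = refl
  add2-assoc (suc zero) zero       (suc zero) = refl
  add2-assoc (suc zero) (suc zero) zero       = refl
  add2-assoc (suc zero) (suc zero) (suc zero) = refl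

  ·-assoc : ∀ x y z → (x · y) · z ≡ x · (y · z)
  ·-assoc (i , j) (k , l) (m , q) = cong₂ _,_
    (trans (⊕-assoc i (twist p j k) (twist p (add2 p j l) m))
      (cong (i ⊕_) (trans (cong (twist p j k ⊕_) (sym (twist-twist j l m))) (sym (twist-⊕ j k (twist p l m))))))
    (add2-assoc j l q)

  ·-identityˡ : ∀ x → e p · x ≡ x
  ·-identityˡ (i , zero)     = cong (_, zero) (⊕-identityˡ i)
  ·-identityˡ (i , suc zero) = cong (_, suc zero) (⊕-identityˡ i)

  ·-identityʳ : ∀ x → x · e p ≡ x
  ·-identityʳ (i , zero)     = cong (_, zero) (⊕-identityʳ i)
  ·-identityʳ (i , suc zero) = cong (_, suc zero) (trans (cong (i ⊕_) ⊖𝟘) (⊕-identityʳ i))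

  ·-inverseˡ : ∀ x → inv p x · x ≡ e p
  ·-inverseˡ (i , zero)     = cong (_, zero) (⊕-inverseˡ i)
  ·-inverseˡ (i , suc zero) = cong (_, zero) (⊕-inverseʳ i)

  ·-inverseʳ : ∀ x → x · inv p x ≡ e p
  ·-inverseʳ (i , zero)     = cong (_, zero) (⊕-inverseʳ i)
  ·-inverseʳ (i , suc zero) = cong (_, zero) (⊕-inverseʳ i)

  ·-isGroup : IsGroup _≡_ _·_ (e p) (inv p)
  ·-isGroup = record
    { isMonoid = record
      { isSemigroup = record
        { isMagma = record { isEquivalence = isEquivalence ; ∙-cong = cong₂ _·_ }
        ; assoc = ·-assoc }
      ; identity = ·-identityˡ , ·-identityʳ }
    ; inverse = ·-inverseˡ , ·-inverseʳ
    ; ⁻¹-cong = cong (inv p) }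

  D-finite : Finite (D p)
  D-finite = ×-finite (Fin-finite p) (Fin-finite 2)

-- The field with p elements

module Field (p : ℕ) .{{nz : NonZero p}} (p-prime : Prime p) where
  open Modular p

  1<p : 1 < p
  1<p = ℕ.nonTrivial⇒n>1 p {{prime⇒nonTrivial p-prime}}

  toℕ-𝟙 : toℕ 𝟙 ≡ 1
  toℕ-𝟙 = trans (toℕ-[] 1) (m<n⇒m%n≡m 1<p)

  𝟙≢𝟘 : 𝟙 ≢ 𝟘
  𝟙≢𝟘 eq with trans (sym toℕ-𝟙) (trans (cong toℕ eq) toℕ-𝟘)
  ... | ()

  recip′ : ∀ a → a ≢ 𝟘 → ∃ λ b → b ⊗ a ≡ 𝟙
  recip′ a a≢𝟘 = go (coprime-Bézout (prime⇒coprime p-prime {{ℕ.≢-nonZero toℕa≢0}} (Fin.toℕ<n a)))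
    where
    toℕa≢0 : toℕ a ≢ 0
    toℕa≢0 eq = a≢𝟘 (Fin.toℕ-injective (trans eq (sym toℕ-𝟘)))
    [*p] : ∀ x → [ x * p ] ≡ 𝟘
    [*p] x = []-cong (trans (m*n%n≡0 x p) (sym (m<n⇒m%n≡m (ℕ.>-nonZero⁻¹ p))))
    [*a] : ∀ y → [ y * toℕ a ] ≡ [ y ] ⊗ a
    [*a] y = trans (sym ([]-⊗ y (toℕ a))) (cong ([ y ] ⊗_) ([]-toℕ a))
    go : Bézout.Identity 1 p (toℕ a) → ∃ λ b → b ⊗ a ≡ 𝟙
    go (Bézout.-+ x y eq) = [ y ] , trans (sym ([*a] y)) (trans (cong [_] (sym eq)) (trans (sym ([]-⊕ 1 (x * p)))
      (trans (cong (𝟙 ⊕_) ([*p] x)) (⊕-identityʳ 𝟙))))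
    -- In this case 1 + y·a = x·p, so the inverse of `a` is -y.
    go (Bézout.+- x y eq) = ⊖ [ y ] , trans (sym (-‿distribˡ-* [ y ] a)) (⊕-cancelˡ ([ y ] ⊗ a) _ _
      (trans (⊕-inverseʳ ([ y ] ⊗ a)) (sym (trans (⊕-comm _ 𝟙) (trans (cong (𝟙 ⊕_) (sym ([*a] y)))
        (trans ([]-⊕ 1 (y * toℕ a)) (trans (cong [_] eq) ([*p] x))))))))

  U? : (a : Fin p) → Dec (a ≢ 𝟘)
  U? a = ¬? (a Fin.≟ 𝟘)

  U : Set
  U = Sub U?

  U-finite : Finite U
  U-finite = Sub-finite (Fin-finite p) U?

  unit : (a : Fin p) → a ≢ 𝟘 → U
  unit a a≢𝟘 = a , fromWitness a≢𝟘

  U-≢𝟘 : (a : U) → proj₁ a ≢ 𝟘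
  U-≢𝟘 a = toWitness (proj₂ a)

  U-≡ : {a b : U} → proj₁ a ≡ proj₁ b → a ≡ b
  U-≡ = Sub-≡ U?

  ⊗-cancelˡ : ∀ {a} → a ≢ 𝟘 → ∀ {x y} → a ⊗ x ≡ a ⊗ y → x ≡ y
  ⊗-cancelˡ {a} a≢𝟘 {x} {y} eq = trans (sym (cancel x)) (trans (cong (b ⊗_) eq) (cancel y))
    where
    b = proj₁ (recip′ a a≢𝟘)
    cancel : ∀ z → b ⊗ (a ⊗ z) ≡ z
    cancel z = trans (sym (⊗-assoc b a z)) (trans (cong (_⊗ z) (proj₂ (recip′ a a≢𝟘))) (⊗-identityˡ z))

  ⊗-≢𝟘 : ∀ {a b} → a ≢ 𝟘 → b ≢ 𝟘 → a ⊗ b ≢ 𝟘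
  ⊗-≢𝟘 {a} {b} a≢𝟘 b≢𝟘 eq = b≢𝟘 (⊗-cancelˡ a≢𝟘 (trans eq (sym (zeroʳ a))))

  𝟙ᵘ : U
  𝟙ᵘ = unit 𝟙 𝟙≢𝟘

  infixl 7 _⊗ᵘ_
  _⊗ᵘ_ : U → U → U
  a ⊗ᵘ b = unit (proj₁ a ⊗ proj₁ b) (⊗-≢𝟘 (U-≢𝟘 a) (U-≢𝟘 b))

  recip : U → U
  recip a = let (b , ba≡𝟙) = recip′ (proj₁ a) (U-≢𝟘 a) in
    unit b (λ b≡𝟘 → 𝟙≢𝟘 (trans (sym ba≡𝟙) (trans (cong (_⊗ proj₁ a) b≡𝟘) (zeroˡ (proj₁ a)))))

  recip-inverseˡ : ∀ a → recip a ⊗ᵘ a ≡ 𝟙ᵘ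
  recip-inverseˡ a = U-≡ (proj₂ (recip′ (proj₁ a) (U-≢𝟘 a)))

  ⊗ᵘ-comm : ∀ a b → a ⊗ᵘ b ≡ b ⊗ᵘ a
  ⊗ᵘ-comm a b = U-≡ (⊗-comm _ _)

  recip-inverseʳ : ∀ a → a ⊗ᵘ recip a ≡ 𝟙ᵘ
  recip-inverseʳ a = trans (⊗ᵘ-comm a (recip a)) (recip-inverseˡ a)

  size-U : size U-finite ≡ p ∸ 1
  size-U = ℕ.+-cancelˡ-≡ 1 _ _ (trans (sym (size-⊎ (Fin-finite 1) U-finite))
    (trans (size-↔ (⊎-finite (Fin-finite 1) U-finite) (Fin-finite p) to from to-from from-to) (sym (ℕ.m+[n∸m]≡n (ℕ.<⇒≤ 1<p)))))
    where
    to : Fin 1 ⊎ U → Fin p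
    to (inj₁ _) = 𝟘
    to (inj₂ a) = proj₁ a
    from : Fin p → Fin 1 ⊎ U
    from a with a Fin.≟ 𝟘
    ... | yes _   = inj₁ zero
    ... | no a≢𝟘 = inj₂ (unit a a≢𝟘)
    to-from : ∀ a → to (from a) ≡ a
    to-from a with a Fin.≟ 𝟘
    ... | yes a≡𝟘 = sym a≡𝟘
    ... | no _     = refl
    from-to : ∀ x → from (to x) ≡ x
    from-to (inj₁ zero) with 𝟘 Fin.≟ 𝟘
    ... | yes _  = refl
    ... | no 𝟘≢𝟘 = contradiction refl 𝟘≢𝟘
    from-to (inj₂ a) with proj₁ a Fin.≟ 𝟘
    ... | yes a≡𝟘 = contradiction a≡𝟘 (U-≢𝟘 a)
    ... | no _     = cong inj₂ (U-≡ refl)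

-- Actions of a group of prime order

module PrimeAction (p : ℕ) .{{nz : NonZero p}} (p-prime : Prime p) {X : Set} (FX : Finite X)
  (act : Fin p → X → X) (act-𝟘 : ∀ x → act (Modular.𝟘 p) x ≡ x)
  (act-⊕ : ∀ k l x → act (addp p k l) x ≡ act k (act l x)) where
  open Modular p
  open Field p p-prime

  action : Action (Fin p) X
  action = record { _∙_ = _⊕_ ; ε = 𝟘 ; _⁻¹ = ⊖_ ; isGroup = ⊕-isGroup ; _▷_ = act ; ▷-ε = act-𝟘 ; ▷-∙ = act-⊕ }

  open Orbits (Fin-finite p) FX action

  fixed? : ∀ x → Dec (∀ k → act k x ≡ x)
  fixed? x = all? (Fin-finite p) (λ k → dec≡ FX (act k x) x)

  Fixed-finite : Finite (Sub fixed?)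
  Fixed-finite = Sub-finite FX fixed?

  fixed-⊗ : ∀ {k x} → act k x ≡ x → ∀ m → act ([ m ] ⊗ k) x ≡ x
  fixed-⊗ {k} {x} kx≡x zero    = trans (cong (λ l → act l x) (zeroˡ k)) (act-𝟘 x)
  fixed-⊗ {k} {x} kx≡x (suc m) = trans (cong (λ l → act l x) [1+m]⊗k) (trans (act-⊕ k _ x) (trans (cong (act k) (fixed-⊗ kx≡x m)) kx≡x))
    where
    [1+m]⊗k : [ suc m ] ⊗ k ≡ k ⊕ [ m ] ⊗ k
    [1+m]⊗k = trans (cong (_⊗ k) (sym ([]-⊕ 1 m))) (trans (⊗-distribʳ-⊕ k 𝟙 [ m ]) (cong (_⊕ [ m ] ⊗ k) (⊗-identityˡ k)))

  -- Every `l` is a multiple of `k`, namely (l k⁻¹)·k, so a stabiliser with a non-zero element is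
  -- the whole group.
  fixed-by-one : ∀ {k x} → k ≢ 𝟘 → act k x ≡ x → ∀ l → act l x ≡ x
  fixed-by-one {k} {x} k≢𝟘 kx≡x l = subst (λ l → act l x ≡ x) l≡ (fixed-⊗ kx≡x (toℕ m))
    where
    k⁻¹ = recip′ k k≢𝟘
    m = l ⊗ proj₁ k⁻¹
    l≡ : [ toℕ m ] ⊗ k ≡ l
    l≡ = trans (cong (_⊗ k) ([]-toℕ m)) (trans (⊗-assoc l _ k) (trans (cong (l ⊗_) (proj₂ k⁻¹)) (⊗-identityʳ l)))

  -- In Burnside's sum each k ≠ 𝟘 contributes exactly the common fixed points and 𝟘 contributes all
  -- of `X`. Written without subtraction, this says that the size of `X` and the number of fixed
  -- points agree modulo p.
  size-mod-p : p * size Reps-finite + size Fixed-finite ≡ p * size Fixed-finite + size FX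
  size-mod-p = trans (cong (_+ size Fixed-finite) (sym burnside))
    (trans (∑-replace (Fin-finite p) (λ k → size (Fix-finite k)) (λ _ → size Fixed-finite) 𝟘 same)
           (cong₂ _+_ (∑-const (Fin-finite p) (size Fixed-finite)) all-fixed))
    where
    same : ∀ k → k ≢ 𝟘 → size (Fix-finite k) ≡ size Fixed-finite
    same k k≢𝟘 = size-↔ (Fix-finite k) Fixed-finite
      (λ { (x , kx) → x , fromWitness (fixed-by-one k≢𝟘 (toWitness kx)) })
      (λ { (x , fx) → x , fromWitness (toWitness fx k) })
      (λ _ → Sub-≡ _ refl) (λ _ → Sub-≡ _ refl)
    all-fixed : size (Fix-finite 𝟘) ≡ size FX
    all-fixed = size-↔ (Fix-finite 𝟘) FX proj₁ (λ x → x , fromWitness (act-𝟘 x)) (λ _ → refl) (λ _ → Sub-≡ _ refl)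

-- Based isomorphisms and the conjugation action of the rotations

module CayleyIsomorphism (p : ℕ) .{{nz : NonZero p}} (p-prime : Prime p) (p-odd : p % 2 ≡ 1) where
  open Modular p
  open Field p p-prime
  open Dihedral p
  open Tables D-finite

  D-group : Group _ _
  D-group = record { isGroup = ·-isGroup }

  open GroupProperties D-group using (ε⁻¹≈ε; ⁻¹-anti-homo-∙; ∙-cancelʳ)

  𝟙⊕𝟙≢𝟘 : 𝟙 ⊕ 𝟙 ≢ 𝟘
  𝟙⊕𝟙≢𝟘 eq with trans (sym (m<n⇒m%n≡m 2<p)) ([]-≡⇒%≡ (trans (sym ([]-⊕ 1 1)) eq))
    where
    2<p : 2 < p
    2<p = ℕ.≤∧≢⇒< 1<p (λ { refl → contradiction p-odd λ () })
  ... | eq′ = contradiction (trans eq′ (m<n⇒m%n≡m (ℕ.<⇒≤ 1<p))) λ ()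

  ρ : Fin p → D p
  ρ k = k , zero

  infixl 7 _÷_
  _÷_ : D p → D p → D p
  y ÷ x = y · inv p x

  ÷-cancel : ∀ x y g → (y · g) ÷ (x · g) ≡ y ÷ x
  ÷-cancel x y g = begin
    (y · g) · inv p (x · g)         ≡⟨ cong ((y · g) ·_) (⁻¹-anti-homo-∙ x g) ⟩
    (y · g) · (inv p g · inv p x)   ≡⟨ ·-assoc y g _ ⟩
    y · (g · (inv p g · inv p x))   ≡⟨ cong (y ·_) (·-assoc g _ _) ⟨
    y · ((g · inv p g) · inv p x)   ≡⟨ cong (λ u → y · (u · inv p x)) (·-inverseʳ g) ⟩
    y · (e p · inv p x)             ≡⟨ cong (y ·_) (·-identityˡ _) ⟩
    y · inv p x                     ∎
    where open ≡-Reasoning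

  ÷-e : ∀ x → x ÷ e p ≡ x
  ÷-e x = trans (cong (x ·_) ε⁻¹≈ε) (·-identityʳ x)

  ·-÷ : ∀ x g → (x · g) ÷ g ≡ x
  ·-÷ x g = trans (·-assoc x g _) (trans (cong (x ·_) (·-inverseʳ g)) (·-identityʳ x))

  ÷-· : ∀ x g → (x ÷ g) · g ≡ x
  ÷-· x g = trans (·-assoc x _ g) (trans (cong (x ·_) (·-inverseˡ g)) (·-identityʳ x))

  record Iso (S T : D p → Bool) : Set where
    field
      to      : D p → D p
      from    : D p → D p
      to-from : ∀ y → to (from y) ≡ y
      from-to : ∀ x → from (to x) ≡ x
      arcs    : ∀ x y → S (y ÷ x) ≡ T (to y ÷ to x)

    to-injective : ∀ {x y} → to x ≡ to y → x ≡ y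
    to-injective {x} {y} eq = trans (sym (from-to x)) (trans (cong from eq) (from-to y))

    arcs′ : ∀ x y → T (y ÷ x) ≡ S (from y ÷ from x)
    arcs′ x y = trans (cong₂ (λ u v → T (v ÷ u)) (sym (to-from x)) (sym (to-from y))) (sym (arcs (from x) (from y)))

  Iso-sym : ∀ {S T} → Iso S T → Iso T S
  Iso-sym i = record { to = from ; from = to ; to-from = from-to ; from-to = to-from ; arcs = arcs′ }
    where open Iso i

  -- On a finite set injectivity can replace the inverse, which keeps the predicate a property of f alone.
  record IsIso (S T : D p → Bool) (f : D p → D p) : Set where
    constructor isIso
    field
      arcs      : ∀ x y → S (y ÷ x) ≡ T (f y ÷ f x)
      injective : ∀ x y → f x ≡ f y → x ≡ y

  IsIso-cong : ∀ {S T f g} → (∀ x → f x ≡ g x) → IsIso S T f → IsIso S T g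
  IsIso-cong {T = T} f≗g (isIso arcs inj) = isIso
    (λ x y → trans (arcs x y) (cong₂ (λ u v → T (v ÷ u)) (f≗g x) (f≗g y)))
    (λ x y eq → inj x y (trans (f≗g x) (trans eq (sym (f≗g y)))))

  IsIso-·ʳ : ∀ {S T f} g → IsIso S T f → IsIso S T (λ x → f x · g)
  IsIso-·ʳ {T = T} {f} g (isIso arcs inj) = isIso
    (λ x y → trans (arcs x y) (cong T (sym (÷-cancel (f x) (f y) g))))
    (λ x y eq → inj x y (∙-cancelʳ g _ _ eq))

  IsIso-∘· : ∀ {S T f} g → IsIso S T f → IsIso S T (λ x → f (x · g))
  IsIso-∘· {S} g (isIso arcs inj) = isIso
    (λ x y → trans (cong S (sym (÷-cancel x y g))) (arcs (x · g) (y · g)))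
    (λ x y eq → ∙-cancelʳ g _ _ (inj _ _ eq))

  IsIso-∘ : ∀ {S T R f g} → IsIso S T f → IsIso T R g → IsIso S R (g ∘ f)
  IsIso-∘ {f = f} (isIso arcs inj) (isIso arcs′ inj′) = isIso
    (λ x y → trans (arcs x y) (arcs′ (f x) (f y))) (λ x y eq → inj x y (inj′ _ _ eq))

  Iso⇒IsIso : ∀ {S T} (i : Iso S T) → IsIso S T (Iso.to i)
  Iso⇒IsIso i = isIso (Iso.arcs i) λ x y → Iso.to-injective i

  Map : Set
  Map = Table (D p)

  Map-finite : Finite Map
  Map-finite = Table-finite D-finite

  opaque
    isIso? : ∀ S T (t : Map) → Dec (IsIso S T (t !_))
    isIso? S T t = map′ (λ { (arcs , inj) → isIso arcs inj }) (λ { (isIso arcs inj) → arcs , inj }) (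
      all? D-finite (λ x → all? D-finite (λ y → dec≡ Bool-finite (S (y ÷ x)) (T (t ! y ÷ t ! x)))) ×-dec
      all? D-finite (λ x → all? D-finite (λ y → dec≡ D-finite (t ! x) (t ! y) →-dec dec≡ D-finite x y)))

  isBased? : ∀ S T (t : Map) → Dec (IsIso S T (t !_) × t ! e p ≡ e p)
  isBased? S T t = isIso? S T t ×-dec dec≡ D-finite (t ! e p) (e p)

  Isos-finite : ∀ S T → Finite (Sub (isIso? S T))
  Isos-finite S T = Sub-finite Map-finite (isIso? S T)

  Based : (S T : D p → Bool) → Set
  Based S T = Sub (isBased? S T)

  Based-finite : ∀ S T → Finite (Based S T)
  Based-finite S T = Sub-finite Map-finite (isBased? S T)

  Based-≡ : ∀ {S T} {s t : Based S T} → (∀ x → proj₁ s ! x ≡ proj₁ t ! x) → s ≡ t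
  Based-≡ eq = Sub-≡ (isBased? _ _) (!-injective eq)

  based : ∀ {S T} (f : D p → D p) → IsIso S T f → f (e p) ≡ e p → Based S T
  based f f-iso fe≡e = table f , fromWitness (IsIso-cong (λ x → sym (table-! f x)) f-iso , trans (table-! f (e p)) fe≡e)

  -- An isomorphism may be followed by a right translation of Cay(T), and exactly one translation
  -- brings the image of `e p` back to `e p`. An isomorphism is thus that image together with a
  -- based isomorphism.
  size-Isos : ∀ S T → size (Isos-finite S T) ≡ size D-finite * size (Based-finite S T)
  size-Isos S T = trans (size-↔ (Isos-finite S T) (×-finite D-finite (Based-finite S T)) to from to-from from-to)
                        (size-× D-finite (Based-finite S T))
    where
    normalise : Map → D p → D p
    normalise t x = t ! x ÷ t ! e p
    to : Sub (isIso? S T) → D p × Based S T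
    to (t , iso) = t ! e p , based (normalise t) (IsIso-·ʳ (inv p (t ! e p)) (toWitness iso)) (·-inverseʳ (t ! e p))
    translate : D p → Map → D p → D p
    translate g t x = t ! x · g
    from : D p × Based S T → Sub (isIso? S T)
    from (g , t , b) = table (translate g t) ,
      fromWitness (IsIso-cong (λ x → sym (table-! (translate g t) x)) (IsIso-·ʳ g (proj₁ (toWitness b))))
    base : ∀ g t → True (isBased? S T t) → table (translate g t) ! e p ≡ g
    base g t b = trans (table-! (translate g t) (e p)) (trans (cong (_· g) (proj₂ (toWitness b))) (·-identityˡ g))
    to-from : ∀ y → to (from y) ≡ y
    to-from (g , t , b) = cong₂ _,_ (base g t b) (Based-≡ λ x → trans (table-! (normalise (table (translate g t))) x)
      (trans (cong₂ _÷_ (table-! (translate g t) x) (base g t b)) (·-÷ (t ! x) g)))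
    from-to : ∀ t → from (to t) ≡ t
    from-to (t , iso) = Sub-≡ (isIso? S T) (!-injective λ x →
      trans (table-! (translate (t ! e p) (table (normalise t))) x)
        (trans (cong (_· t ! e p) (table-! (normalise t) x)) (÷-· (t ! x) (t ! e p))))

  size-Isos-invariant : ∀ {S T} → Iso S T → size (Isos-finite S T) ≡ size (Isos-finite S S)
  size-Isos-invariant {S} {T} i = size-↔ (Isos-finite S T) (Isos-finite S S)
    (λ { (t , iso) → compose t I.from (toWitness iso) (Iso⇒IsIso (Iso-sym i)) })
    (λ { (t , iso) → compose t I.to (toWitness iso) (Iso⇒IsIso i) })
    (λ { (t , _) → Sub-≡ (isIso? S S) (undo t I.to I.from I.from-to) })
    (λ { (t , _) → Sub-≡ (isIso? S T) (undo t I.from I.to I.to-from) })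
    where
    module I = Iso i
    compose : ∀ {T R} (t : Map) (g : D p → D p) → IsIso S T (t !_) → IsIso T R g → Sub (isIso? S R)
    compose t g t-iso g-iso = table (λ x → g (t ! x)) , fromWitness (IsIso-cong (λ x → sym (table-! (λ x → g (t ! x)) x)) (IsIso-∘ t-iso g-iso))
    undo : ∀ t (g h : D p → D p) → (∀ x → h (g x) ≡ x) → table (λ x → h (table (λ x → g (t ! x)) ! x)) ≡ t
    undo t g h hg = !-injective λ x → trans (table-! (λ x → h (table (λ x → g (t ! x)) ! x)) x)
      (trans (cong h (table-! (λ x → g (t ! x)) x)) (hg (t ! x)))

  -- The given isomorphism may move `e p`, so composition with it does not preserve based maps. The
  -- comparison is made for all isomorphisms, and the common factor, the order of the group, is
  -- cancelled.
  size-Based-invariant : ∀ {S T} → Iso S T → size (Based-finite S T) ≡ size (Based-finite S S)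
  size-Based-invariant {S} {T} i = ℕ.*-cancelˡ-≡ _ _ (size D-finite) {{ℕ.>-nonZero (inhabited⇒size D-finite (e p))}}
    (trans (sym (size-Isos S T)) (trans (size-Isos-invariant i) (size-Isos S S)))

  -- Right translations are automorphisms of every Cayley digraph, so the rotations act by conjugation.
  module Rotations (S T : D p → Bool) where

    conj : Fin p → Map → D p → D p
    conj k t x = t ! (x · ρ k) ÷ t ! ρ k

    act : Fin p → Based S T → Based S T
    act k (t , b) = based (conj k t) (IsIso-·ʳ (inv p (t ! ρ k)) (IsIso-∘· (ρ k) (proj₁ (toWitness b))))
      (trans (cong (λ u → t ! u ÷ t ! ρ k) (·-identityˡ (ρ k))) (·-inverseʳ (t ! ρ k)))

    act-! : ∀ k t x → proj₁ (act k t) ! x ≡ proj₁ t ! (x · ρ k) ÷ proj₁ t ! ρ k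
    act-! k (t , _) x = table-! (conj k t) x

    act-𝟘 : ∀ t → act 𝟘 t ≡ t
    act-𝟘 t@(f , b) = Based-≡ λ x → trans (act-! 𝟘 t x)
      (trans (cong₂ (λ u v → f ! u ÷ v) (·-identityʳ x) (proj₂ (toWitness b))) (÷-e (f ! x)))

    act-⊕ : ∀ k l t → act (k ⊕ l) t ≡ act k (act l t)
    act-⊕ k l t@(f , b) = Based-≡ λ x → trans (act-! (k ⊕ l) t x) (sym (begin
      proj₁ (act k (act l t)) ! x                                          ≡⟨ act-! k (act l t) x ⟩
      proj₁ (act l t) ! (x · ρ k) ÷ proj₁ (act l t) ! ρ k                   ≡⟨ cong₂ _÷_ (act-! l t (x · ρ k)) (act-! l t (ρ k)) ⟩
      (f ! (x · ρ k · ρ l) ÷ f ! ρ l) ÷ (f ! (ρ k · ρ l) ÷ f ! ρ l)         ≡⟨ ÷-cancel (f ! (ρ k · ρ l)) (f ! (x · ρ k · ρ l)) (inv p (f ! ρ l)) ⟩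
      f ! (x · ρ k · ρ l) ÷ f ! (ρ k · ρ l)                                 ≡⟨ cong (λ u → f ! u ÷ f ! (ρ k · ρ l)) (·-assoc x (ρ k) (ρ l)) ⟩
      f ! (x · ρ (k ⊕ l)) ÷ f ! ρ (k ⊕ l)                                   ∎))
      where open ≡-Reasoning

    open PrimeAction p p-prime (Based-finite S T) act act-𝟘 act-⊕ public

    fixed-multiplicative : ∀ t → (∀ k → act k t ≡ t) → ∀ x k → proj₁ t ! (x · ρ k) ≡ proj₁ t ! x · proj₁ t ! ρ k
    fixed-multiplicative t fixed x k = trans (sym (÷-· (proj₁ t ! (x · ρ k)) (proj₁ t ! ρ k)))
      (cong (_· proj₁ t ! ρ k) (trans (sym (act-! k t x)) (cong (λ s → proj₁ s ! x) (fixed k))))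

  α : Fin p → Fin p → D p → D p
  α c d (i , zero)  = c ⊗ i , zero
  α c d (i , suc j) = c ⊗ i ⊕ d , suc j

  -- Only products with a rotation on the right are known to be respected. This is enough, as every
  -- element is τ^i or σ τ^(-i): the images of τ and σ determine `f`, and it remains to see that the
  -- first is a rotation and the second a reflection.
  multiplicative⇒α : ∀ (f : D p → D p) → f (e p) ≡ e p → (∀ x y → f x ≡ f y → x ≡ y) →
                     (∀ x k → f (x · ρ k) ≡ f x · f (ρ k)) →
                     Σ U λ c → Σ (Fin p) λ d → ∀ x → f x ≡ α (proj₁ c) d x
  multiplicative⇒α f fe≡e inj mult = unit c c≢𝟘 , d , f≗α
    where
    rotation : ∃ λ c → f (ρ 𝟙) ≡ ρ c
    rotation with f (ρ 𝟙) in eq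
    ... | c , zero     = c , refl
    -- If τ went to a reflection, τ² would go to its square `e p`, the image of `e p`. Injectivity
    -- would give τ² = e, impossible for odd p.
    ... | c , suc zero = contradiction (cong proj₁ (inj (ρ (𝟙 ⊕ 𝟙)) (e p)
            (trans (mult (ρ 𝟙) 𝟙) (trans (cong₂ _·_ eq eq) (trans (cong (_, zero) (⊕-inverseʳ c)) (sym fe≡e)))))) 𝟙⊕𝟙≢𝟘
    c = proj₁ rotation

    f-[] : ∀ m → f (ρ [ m ]) ≡ ρ ([ m ] ⊗ c)
    f-[] zero    = trans fe≡e (cong ρ (sym (zeroˡ c)))
    f-[] (suc m) = begin
      f (ρ [ suc m ])        ≡⟨ cong (f ∘ ρ) (trans (cong [_] (ℕ.+-comm 1 m)) (sym ([]-⊕ m 1))) ⟩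
      f (ρ [ m ] · ρ 𝟙)      ≡⟨ mult (ρ [ m ]) 𝟙 ⟩
      f (ρ [ m ]) · f (ρ 𝟙)  ≡⟨ cong₂ _·_ (f-[] m) (proj₂ rotation) ⟩
      ρ ([ m ] ⊗ c ⊕ c)      ≡⟨ cong ρ (trans (cong ([ m ] ⊗ c ⊕_) (sym (⊗-identityˡ c))) (sym (⊗-distribʳ-⊕ c [ m ] 𝟙))) ⟩
      ρ (([ m ] ⊕ 𝟙) ⊗ c)    ≡⟨ cong (λ u → ρ (u ⊗ c)) (trans ([]-⊕ m 1) (cong [_] (ℕ.+-comm m 1))) ⟩
      ρ ([ suc m ] ⊗ c)      ∎
      where open ≡-Reasoning

    f-ρ : ∀ i → f (ρ i) ≡ ρ (c ⊗ i)
    f-ρ i = trans (cong (f ∘ ρ) (sym ([]-toℕ i))) (trans (f-[] (toℕ i)) (cong ρ (trans (cong (_⊗ c) ([]-toℕ i)) (⊗-comm i c))))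

    c≢𝟘 : c ≢ 𝟘
    c≢𝟘 c≡𝟘 = 𝟙≢𝟘 (cong proj₁ (inj (ρ 𝟙) (e p) (trans (proj₂ rotation) (trans (cong ρ c≡𝟘) (sym fe≡e)))))

    reflection : ∃ λ d → f (𝟘 , suc zero) ≡ (d , suc zero)
    reflection with f (𝟘 , suc zero) in eq
    ... | d , suc zero = d , refl
    -- The rotation τ^d is already the image of the rotation with exponent c⁻¹d, so σ cannot be sent
    -- there.
    ... | d , zero     = contradiction (cong proj₂ (inj (𝟘 , suc zero) (ρ (c⁻¹ ⊗ d)) (trans eq (sym (trans (f-ρ _) (cong ρ cc⁻¹d)))))) λ ()
      where
      c⁻¹ = proj₁ (recip′ c c≢𝟘)
      cc⁻¹d : c ⊗ (c⁻¹ ⊗ d) ≡ d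
      cc⁻¹d = trans (sym (⊗-assoc c c⁻¹ d)) (trans (cong (_⊗ d) (trans (⊗-comm c c⁻¹) (proj₂ (recip′ c c≢𝟘)))) (⊗-identityˡ d))
    d = proj₁ reflection

    f≗α : ∀ x → f x ≡ α c d x
    f≗α (i , zero)     = f-ρ i
    f≗α (i , suc zero) = begin
      f (i , suc zero)                   ≡⟨ cong (λ u → f (u , suc zero)) (sym (trans (⊕-identityˡ _) (⊖-involutive i))) ⟩
      f ((𝟘 , suc zero) · ρ (⊖ i))       ≡⟨ mult (𝟘 , suc zero) (⊖ i) ⟩
      f (𝟘 , suc zero) · f (ρ (⊖ i))     ≡⟨ cong₂ _·_ (proj₂ reflection) (f-ρ (⊖ i)) ⟩
      (d ⊕ ⊖ (c ⊗ ⊖ i) , suc zero)       ≡⟨ cong (λ u → d ⊕ u , suc zero) (trans (-‿distribʳ-* c (⊖ i)) (cong (c ⊗_) (⊖-involutive i))) ⟩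
      (d ⊕ c ⊗ i , suc zero)             ≡⟨ cong (_, suc zero) (⊕-comm d (c ⊗ i)) ⟩
      (c ⊗ i ⊕ d , suc zero)             ∎
      where open ≡-Reasoning

  based-preserves : ∀ {S T f} → IsIso S T f → f (e p) ≡ e p → ∀ x → S x ≡ T (f x)
  based-preserves {S} {T} {f} (isIso arcs _) fe≡e x = trans (cong S (sym (÷-e x)))
    (trans (arcs (e p) x) (cong T (trans (cong (f x ÷_) fe≡e) (÷-e (f x)))))

  Equiv : (S T : D p → Bool) → Set
  Equiv S T = Σ U λ c → Σ (Fin p) λ d → ∀ x → S x ≡ T (α (proj₁ c) d x)

  NonConstant : (D p → Bool) → Set
  NonConstant S = ∃ λ b → ∃ λ b′ → S (b , suc zero) ≡ true × S (b′ , suc zero) ≡ false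

  -- A non-zero δ generates the additive group: (y - x)/δ translations lead from `x` to `y`.
  translation-invariant : ∀ (B : Fin p → Bool) δ → δ ≢ 𝟘 → (∀ x → B x ≡ B (x ⊕ δ)) → ∀ x y → B x ≡ B y
  translation-invariant B δ δ≢𝟘 inv x y = trans (steps (toℕ m)) (cong B (trans (cong (λ u → x ⊕ u ⊗ δ) ([]-toℕ m)) x⊕mδ))
    where
    δ⁻¹ = proj₁ (recip′ δ δ≢𝟘)
    m = (y ⊕ ⊖ x) ⊗ δ⁻¹
    x⊕mδ : x ⊕ m ⊗ δ ≡ y
    x⊕mδ = trans (cong (x ⊕_) (trans (⊗-assoc _ δ⁻¹ δ) (trans (cong ((y ⊕ ⊖ x) ⊗_) (proj₂ (recip′ δ δ≢𝟘))) (⊗-identityʳ _))))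
                 (trans (⊕-comm x _) (cancel-⊖ y x))
    steps : ∀ m → B x ≡ B (x ⊕ [ m ] ⊗ δ)
    steps zero    = cong B (sym (trans (cong (x ⊕_) (zeroˡ δ)) (⊕-identityʳ x)))
    steps (suc m) = trans (steps m) (trans (inv _) (cong B (trans (⊕-assoc x _ δ) (cong (x ⊕_)
      (trans (cong ([ m ] ⊗ δ ⊕_) (sym (⊗-identityˡ δ))) (trans (sym (⊗-distribʳ-⊕ δ [ m ] 𝟙))
        (cong (_⊗ δ) (trans ([]-⊕ m 1) (cong [_] (ℕ.+-comm m 1))))))))))

  -- Modulo p the number of fixed points is the number of based isomorphisms, which depends only on the
  -- isomorphism class; for S = T it lies strictly between 0 and p.
  iso⇒equiv-nonConstant : ∀ {S T} → NonConstant S → Iso S T → Equiv S T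
  iso⇒equiv-nonConstant {S} {T} (b , b′ , Sb , Sb′) i = let c , d , _ , S≡ = shape fixedST in c , d , S≡
    where
    module ST = Rotations S T
    module SS = Rotations S S

    shape : ∀ {T} (t : Sub (Rotations.fixed? S T)) → Σ U λ c → Σ (Fin p) λ d →
            (∀ x → proj₁ (proj₁ t) ! x ≡ α (proj₁ c) d x) × (∀ x → S x ≡ T (α (proj₁ c) d x))
    shape {T} ((t , t-based) , fixed) =
      let t-iso , te≡e = toWitness t-based
          c , d , t≗α = multiplicative⇒α (t !_) te≡e (IsIso.injective t-iso)
                          (Rotations.fixed-multiplicative S T (t , t-based) (toWitness fixed))
      in c , d , t≗α , λ x → trans (based-preserves t-iso te≡e x) (cong T (t≗α x))

    -- If c⊗_⊕d and c⊗_⊕d′ both preserve the reflections of S, so does the translation by d′ ⊖ d.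
    offset-unique : ∀ (c : U) {d d′} → (∀ x → S x ≡ S (α (proj₁ c) d x)) → (∀ x → S x ≡ S (α (proj₁ c) d′ x)) → d ≡ d′
    offset-unique c {d} {d′} Sd Sd′ with d Fin.≟ d′
    ... | yes d≡d′ = d≡d′
    ... | no d≢d′  = contradiction (trans (sym Sb) (trans (translation-invariant (λ x → S (x , suc zero)) (d′ ⊕ ⊖ d) δ≢𝟘 invariant b b′) Sb′)) λ ()
      where
      δ≢𝟘 : d′ ⊕ ⊖ d ≢ 𝟘
      δ≢𝟘 eq = d≢d′ (sym (trans (sym (cancel-⊖ d′ d)) (trans (cong (_⊕ d) eq) (⊕-identityˡ d))))
      preimage : Fin p → Fin p
      preimage x = proj₁ (recip c) ⊗ (x ⊕ ⊖ d)
      c⊗preimage : ∀ x → proj₁ c ⊗ preimage x ≡ x ⊕ ⊖ d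
      c⊗preimage x = trans (sym (⊗-assoc _ _ _)) (trans (cong (_⊗ (x ⊕ ⊖ d)) (cong proj₁ (recip-inverseʳ c))) (⊗-identityˡ _))
      invariant : ∀ x → S (x , suc zero) ≡ S (x ⊕ (d′ ⊕ ⊖ d) , suc zero)
      invariant x = begin
        S (x , suc zero)                            ≡⟨ cong (λ u → S (u , suc zero)) (trans (cong (_⊕ d) (c⊗preimage x)) (cancel-⊖ x d)) ⟨
        S (proj₁ c ⊗ preimage x ⊕ d , suc zero)     ≡⟨ Sd (preimage x , suc zero) ⟨
        S (preimage x , suc zero)                   ≡⟨ Sd′ (preimage x , suc zero) ⟩
        S (proj₁ c ⊗ preimage x ⊕ d′ , suc zero)    ≡⟨ cong (λ u → S (u ⊕ d′ , suc zero)) (c⊗preimage x) ⟩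
        S (x ⊕ ⊖ d ⊕ d′ , suc zero)                 ≡⟨ cong (λ u → S (u , suc zero)) (trans (⊕-assoc x (⊖ d) d′) (cong (x ⊕_) (⊕-comm (⊖ d) d′))) ⟩
        S (x ⊕ (d′ ⊕ ⊖ d) , suc zero)               ∎
        where open ≡-Reasoning

    scale : Sub SS.fixed? → U
    scale t = proj₁ (shape t)

    -- Since the unit determines the offset, the fixed points embed into the units, and there are at
    -- most p - 1 of them.
    scale-injective : ∀ {s t : Sub SS.fixed?} → scale s ≡ scale t → s ≡ t
    scale-injective {s} {t} = go (shape s) (shape t)
      where
      Shape : Sub SS.fixed? → Set
      Shape t = Σ U λ c → Σ (Fin p) λ d → (∀ x → proj₁ (proj₁ t) ! x ≡ α (proj₁ c) d x) × (∀ x → S x ≡ S (α (proj₁ c) d x))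
      go : (u : Shape s) (v : Shape t) → proj₁ u ≡ proj₁ v → s ≡ t
      go (c , d , s≗α , Sd) (.c , d′ , t≗α , Sd′) refl = Sub-≡ SS.fixed? (Based-≡ λ x →
        trans (s≗α x) (trans (cong (λ u → α (proj₁ c) u x) (offset-unique c Sd Sd′)) (sym (t≗α x))))

    identity : Sub SS.fixed?
    identity = id-based , fromWitness λ k → Based-≡ λ x → trans (SS.act-! k id-based x)
      (trans (cong₂ _÷_ (table-! id (x · ρ k)) (table-! id (ρ k))) (trans (·-÷ x (ρ k)) (sym (table-! id x))))
      where
      id-based : Based S S
      id-based = based id (isIso (λ _ _ → refl) (λ _ _ → id)) refl

    fixedSS<p : size SS.Fixed-finite < p
    fixedSS<p = ℕ.≤-<-trans (size-injective SS.Fixed-finite U-finite scale scale-injective)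
                            (subst (_< p) (sym size-U) (ℕ.∸-monoʳ-< (s≤s z≤n) (ℕ.<⇒≤ 1<p)))

    fixedST-≢0 : size ST.Fixed-finite ≢ 0
    fixedST-≢0 eq = ℕ.<⇒≱ fixedSS<p (∣⇒≤ {{ℕ.>-nonZero (inhabited⇒size SS.Fixed-finite identity)}} (∣m+n∣m⇒∣n p∣sum (m∣m*n _)))
      where
      module O = Orbits (Fin-finite p) (Based-finite S T) ST.action
      module O′ = Orbits (Fin-finite p) (Based-finite S S) SS.action
      p∣BasedSS : size (Based-finite S S) ≡ p * size O.Reps-finite
      p∣BasedSS = trans (sym (size-Based-invariant i)) (sym (trans (sym (ℕ.+-identityʳ _)) (trans
        (cong (p * size O.Reps-finite +_) (sym eq)) (trans ST.size-mod-p
          (trans (cong (λ z → p * z + size (Based-finite S T)) eq) (cong (_+ size (Based-finite S T)) (ℕ.*-zeroʳ p)))))))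
      p∣sum : p ∣ p * size O′.Reps-finite + size SS.Fixed-finite
      p∣sum = divides (size SS.Fixed-finite + size O.Reps-finite) (trans SS.size-mod-p (trans
        (cong (p * size SS.Fixed-finite +_) p∣BasedSS) (trans (sym (ℕ.*-distribˡ-+ p _ _)) (ℕ.*-comm p _))))

    fixedST : Sub ST.fixed?
    fixedST = size⇒inhabited ST.Fixed-finite fixedST-≢0

-- Isomorphic digraphs have connection sets related by an automorphism

module Classification (p : ℕ) .{{nz : NonZero p}} (p-prime : Prime p) (p-odd : p % 2 ≡ 1) where
  open Modular p
  open Field p p-prime
  open Dihedral p
  open CayleyIsomorphism p p-prime p-odd

  ⊗-cancel-recip : ∀ (c : U) x → proj₁ c ⊗ (proj₁ (recip c) ⊗ x) ≡ x
  ⊗-cancel-recip c x = trans (sym (⊗-assoc _ _ x)) (trans (cong (_⊗ x) (cong proj₁ (recip-inverseʳ c))) (⊗-identityˡ x))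

  α-identity : ∀ x → α 𝟙 𝟘 x ≡ x
  α-identity (i , zero)     = cong (_, zero) (⊗-identityˡ i)
  α-identity (i , suc zero) = cong (_, suc zero) (trans (⊕-identityʳ _) (⊗-identityˡ i))

  α-∘ : ∀ c d c′ d′ x → α c d (α c′ d′ x) ≡ α (c ⊗ c′) (c ⊗ d′ ⊕ d) x
  α-∘ c d c′ d′ (i , zero)     = cong (_, zero) (sym (⊗-assoc c c′ i))
  α-∘ c d c′ d′ (i , suc zero) = cong (_, suc zero) (trans
    (cong (_⊕ d) (trans (⊗-distribˡ-⊕ c (c′ ⊗ i) d′) (cong (_⊕ c ⊗ d′) (sym (⊗-assoc c c′ i))))) (⊕-assoc _ _ d))

  inverse-offset : U → Fin p → Fin p
  inverse-offset c d = ⊖ (proj₁ (recip c) ⊗ d)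

  α-inverseˡ : ∀ c d x → α (proj₁ (recip c)) (inverse-offset c d) (α (proj₁ c) d x) ≡ x
  α-inverseˡ c d x = trans (α-∘ (proj₁ (recip c)) (inverse-offset c d) (proj₁ c) d x)
    (trans (cong₂ (λ a b → α a b x) (cong proj₁ (recip-inverseˡ c)) (⊕-inverseʳ _)) (α-identity x))

  α-inverseʳ : ∀ c d x → α (proj₁ c) d (α (proj₁ (recip c)) (inverse-offset c d) x) ≡ x
  α-inverseʳ c d x = trans (α-∘ (proj₁ c) d (proj₁ (recip c)) (inverse-offset c d) x)
    (trans (cong₂ (λ a b → α a b x) (cong proj₁ (recip-inverseʳ c)) offset) (α-identity x))
    where
    offset : proj₁ c ⊗ inverse-offset c d ⊕ d ≡ 𝟘
    offset = trans (cong (_⊕ d) (trans (sym (-‿distribʳ-* _ _)) (cong ⊖_ (⊗-cancel-recip c d)))) (⊕-inverseˡ d)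

  Equiv-sym : ∀ {S T} → Equiv S T → Equiv T S
  Equiv-sym {S} {T} (c , d , S≡) = recip c , inverse-offset c d , λ x → trans (cong T (sym (α-inverseʳ c d x))) (sym (S≡ _))

  α-·-inv : ∀ c d x y → α c d (y ÷ x) ≡ α c d y ÷ α c d x
  α-·-inv c d (i , zero) (j , zero) = cong (_, zero) (trans (⊗-distribˡ-⊕ c j (⊖ i)) (cong (c ⊗ j ⊕_) (sym (-‿distribʳ-* c i))))
  α-·-inv c d (i , zero) (j , suc zero) = cong (_, suc zero) (begin
    c ⊗ (j ⊕ ⊖ ⊖ i) ⊕ d        ≡⟨ cong (λ u → c ⊗ (j ⊕ u) ⊕ d) (⊖-involutive i) ⟩
    c ⊗ (j ⊕ i) ⊕ d            ≡⟨ cong (_⊕ d) (⊗-distribˡ-⊕ c j i) ⟩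
    c ⊗ j ⊕ c ⊗ i ⊕ d          ≡⟨ trans (⊕-assoc _ _ d) (trans (cong (c ⊗ j ⊕_) (⊕-comm _ d)) (sym (⊕-assoc _ d _))) ⟩
    c ⊗ j ⊕ d ⊕ c ⊗ i          ≡⟨ cong (c ⊗ j ⊕ d ⊕_) (⊖-involutive (c ⊗ i)) ⟨
    c ⊗ j ⊕ d ⊕ ⊖ ⊖ (c ⊗ i)    ∎)
    where open ≡-Reasoning
  α-·-inv c d (i , suc zero) (j , zero) = cong (_, suc zero) (trans (cong (_⊕ d) (⊗-distribˡ-⊕ c j i)) (⊕-assoc _ _ d))
  α-·-inv c d (i , suc zero) (j , suc zero) = cong (_, zero) (begin
    c ⊗ (j ⊕ ⊖ i)                       ≡⟨ ⊗-distribˡ-⊕ c j (⊖ i) ⟩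
    c ⊗ j ⊕ c ⊗ ⊖ i                     ≡⟨ cong₂ _⊕_ (cancel-⊖′ (c ⊗ j) d) (-‿distribʳ-* c i) ⟨
    c ⊗ j ⊕ d ⊕ ⊖ d ⊕ ⊖ (c ⊗ i)         ≡⟨ ⊕-assoc _ (⊖ d) _ ⟩
    c ⊗ j ⊕ d ⊕ (⊖ d ⊕ ⊖ (c ⊗ i))       ≡⟨ cong (c ⊗ j ⊕ d ⊕_) (trans (⊕-comm (⊖ d) _) (⊖-⊕-comm (c ⊗ i) d)) ⟩
    c ⊗ j ⊕ d ⊕ ⊖ (c ⊗ i ⊕ d)           ∎)
    where open ≡-Reasoning

  Equiv⇒IsoCay : ∀ {S T} → Equiv S T → IsoCay p S T
  Equiv⇒IsoCay {S} {T} (c , d , S≡) =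
    mk⤖ {to = α (proj₁ c) d} (
      (λ {x} {y} eq → trans (sym (α-inverseˡ c d x)) (trans (cong (α _ _) eq) (α-inverseˡ c d y))) ,
      (λ y → α (proj₁ (recip c)) (inverse-offset c d) y , λ { refl → α-inverseʳ c d y })) ,
    λ x y → let eq = trans (S≡ (y ÷ x)) (cong T (α-·-inv (proj₁ c) d x y)) in mk⇔ (trans (sym eq)) (trans eq)

  IsoCay⇒Iso : ∀ {S T} → IsoCay p S T → Iso S T
  IsoCay⇒Iso (f , arcs) = record
    { to = to ; from = proj₁ ∘ strictlySurjective ; to-from = proj₂ ∘ strictlySurjective
    ; from-to = λ x → injective (proj₂ (strictlySurjective (to x)))
    ; arcs = λ x y → ⇔→≡ (arcs x y) }
    where open Bijection f

  -- An isomorphism preserving the rotations extends to the digraphs in which σ is the only reflection; there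
  -- iso⇒equiv-nonConstant applies.
  onlyRotations : (D p → Bool) → D p → Bool
  onlyRotations S (i , zero)  = S (i , zero)
  onlyRotations S (i , suc _) = does (i Fin.≟ 𝟘)

  ⊕≡𝟘⇒≡⊖ : ∀ {i j} → j ⊕ i ≡ 𝟘 → i ≡ ⊖ j
  ⊕≡𝟘⇒≡⊖ {i} {j} eq = ⊕-cancelˡ j _ _ (trans eq (sym (⊕-inverseʳ j)))

  module _ {S T : D p → Bool} (i : Iso S T) (h k : Fin p → Fin p)
    (to-ρ : ∀ x → Iso.to i (ρ x) ≡ ρ (h x)) (from-ρ : ∀ x → Iso.from i (ρ x) ≡ ρ (k x)) where
    open Iso i

    h-k : ∀ x → h (k x) ≡ x
    h-k x = cong proj₁ (trans (sym (to-ρ (k x))) (trans (cong to (sym (from-ρ x))) (to-from (ρ x))))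

    k-h : ∀ x → k (h x) ≡ x
    k-h x = cong proj₁ (trans (sym (from-ρ (h x))) (trans (cong from (sym (to-ρ x))) (from-to (ρ x))))

    -- When σ is the only reflection in the connection set, τ^x is joined to τ^(-x)σ and to no other
    -- reflection. This forces the image of τ^(-x)σ to be τ^(-f(x))σ.
    extend : (Fin p → Fin p) → D p → D p
    extend f (x , zero)  = f x , zero
    extend f (x , suc j) = ⊖ f (⊖ x) , suc j

    extend-inverse : ∀ f g → (∀ x → f (g x) ≡ x) → ∀ x → extend f (extend g x) ≡ x
    extend-inverse f g fg (x , zero)  = cong (_, zero) (fg x)
    extend-inverse f g fg (x , suc j) = cong (_, suc j)
      (trans (cong (λ u → ⊖ f u) (⊖-involutive _)) (trans (cong ⊖_ (fg (⊖ x))) (⊖-involutive x)))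

    rotation-arcs : ∀ x y → S (ρ (y ⊕ ⊖ x)) ≡ T (ρ (h y ⊕ ⊖ h x))
    rotation-arcs x y = trans (arcs (ρ x) (ρ y)) (cong₂ (λ u v → T (v ÷ u)) (to-ρ x) (to-ρ y))

    reflection-arcs : ∀ x y → does ((y ⊕ x) Fin.≟ 𝟘) ≡ does ((⊖ h (⊖ y) ⊕ h x) Fin.≟ 𝟘)
    reflection-arcs x y = does-⇔ (mk⇔
      (λ eq → trans (cong (λ u → ⊖ h (⊖ y) ⊕ h u) (⊕≡𝟘⇒≡⊖ eq)) (⊕-inverseˡ _))
      (λ eq → trans (cong (y ⊕_) (h-injective (trans (⊕≡𝟘⇒≡⊖ eq) (⊖-involutive _)))) (⊕-inverseʳ y)))
      ((y ⊕ x) Fin.≟ 𝟘) ((⊖ h (⊖ y) ⊕ h x) Fin.≟ 𝟘)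
      where
      h-injective : ∀ {x y} → h x ≡ h y → x ≡ y
      h-injective {x} {y} eq = trans (sym (k-h x)) (trans (cong k eq) (k-h y))

    onlyRotations-iso : Iso (onlyRotations S) (onlyRotations T)
    onlyRotations-iso = record
      { to = extend h ; from = extend k ; to-from = extend-inverse h k h-k ; from-to = extend-inverse k h k-h ; arcs = extended-arcs }
      where
      extended-arcs : ∀ x y → onlyRotations S (y ÷ x) ≡ onlyRotations T (extend h y ÷ extend h x)
      extended-arcs (x , zero)     (y , zero)     = rotation-arcs x y
      extended-arcs (x , zero)     (y , suc zero) = trans (cong (λ u → does ((y ⊕ u) Fin.≟ 𝟘)) (⊖-involutive x))
        (trans (reflection-arcs x y) (cong (λ u → does ((⊖ h (⊖ y) ⊕ u) Fin.≟ 𝟘)) (sym (⊖-involutive (h x)))))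
      extended-arcs (x , suc zero) (y , zero)     = trans (cong (λ u → does (u Fin.≟ 𝟘)) (⊕-comm y x))
        (trans (reflection-arcs y x) (cong (λ u → does (u Fin.≟ 𝟘)) (⊕-comm (⊖ h (⊖ x)) (h y))))
      -- Since y - x = (-x) - (-y), an arc between two reflections is an arc between the rotations
      -- with negated exponents, ends exchanged; `h` is applied to these.
      extended-arcs (x , suc zero) (y , suc zero) = begin
        S (ρ (y ⊕ ⊖ x))                             ≡⟨ cong (S ∘ ρ) (trans (⊕-comm y _) (cong (⊖ x ⊕_) (sym (⊖-involutive y)))) ⟩
        S (ρ (⊖ x ⊕ ⊖ ⊖ y))                         ≡⟨ rotation-arcs (⊖ y) (⊖ x) ⟩
        T (ρ (h (⊖ x) ⊕ ⊖ h (⊖ y)))                 ≡⟨ cong (T ∘ ρ) (trans (⊕-comm (h (⊖ x)) (⊖ h (⊖ y))) (cong (⊖ h (⊖ y) ⊕_) (sym (⊖-involutive (h (⊖ x)))))) ⟩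
        T (ρ (⊖ h (⊖ y) ⊕ ⊖ ⊖ h (⊖ x)))             ∎
        where open ≡-Reasoning

  basedIso : ∀ {S T} → Iso S T → Σ (Iso S T) λ i → Iso.to i (e p) ≡ e p
  basedIso {T = T} i = record
    { to = λ x → to x ÷ to (e p) ; from = λ y → from (y · to (e p))
    ; to-from = λ y → trans (cong (_÷ to (e p)) (to-from _)) (·-÷ y _)
    ; from-to = λ x → trans (cong from (÷-· (to x) _)) (from-to x)
    ; arcs = λ x y → trans (arcs x y) (cong T (sym (÷-cancel (to x) (to y) (inv p (to (e p)))))) } , ·-inverseʳ (to (e p))
    where open Iso i

  -- A non-arc between rotations cannot be mapped across the two cosets, where T has all arcs.
  preserves-rotations : ∀ {S T} (i : Iso S T) → Iso.to i (e p) ≡ e p → (∀ b → T (b , suc zero) ≡ true) →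
                        ∀ a → a ≢ 𝟘 → S (ρ a) ≡ false → ∀ x → ∃ λ y → Iso.to i (ρ x) ≡ ρ y
  preserves-rotations {S} {T} i base full a a≢𝟘 Sa x =
    subst (λ x → ∃ λ y → to (ρ x) ≡ ρ y) (trans (cong (_⊗ a) ([]-toℕ m)) ma≡x) (go (toℕ m))
    where
    open Iso i
    m = x ⊗ proj₁ (recip′ a a≢𝟘)
    ma≡x : m ⊗ a ≡ x
    ma≡x = trans (⊗-assoc x _ a) (trans (cong (x ⊗_) (proj₂ (recip′ a a≢𝟘))) (⊗-identityʳ x))
    step : ∀ u → (∃ λ y → to (ρ u) ≡ ρ y) → ∃ λ y → to (ρ (a ⊕ u)) ≡ ρ y
    step u (y , eq) with to (ρ (a ⊕ u)) in eq′
    ... | z , zero     = z , refl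
    ... | z , suc zero = contradiction (trans (sym (full _)) (trans (cong₂ (λ v w → T (w ÷ v)) (sym eq) (sym eq′))
            (trans (sym (arcs (ρ u) (ρ (a ⊕ u)))) (trans (cong (S ∘ ρ) (cancel-⊖′ a u)) Sa)))) λ ()
    go : ∀ m → ∃ λ y → to (ρ ([ m ] ⊗ a)) ≡ ρ y
    go zero    = 𝟘 , trans (cong (to ∘ ρ) (zeroˡ a)) base
    go (suc m) = subst (λ u → ∃ λ y → to (ρ u) ≡ ρ y)
      (sym (trans (cong (_⊗ a) (sym ([]-⊕ 1 m))) (trans (⊗-distribʳ-⊕ a 𝟙 [ m ]) (cong (_⊕ [ m ] ⊗ a) (⊗-identityˡ a)))))
      (step _ (go m))

  iso⇒equiv-full : ∀ {S T} → CayleySet p S → CayleySet p T → (∀ b → S (b , suc zero) ≡ true) → (∀ b → T (b , suc zero) ≡ true) →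
                   Iso S T → Equiv S T
  iso⇒equiv-full {S} {T} Se Te fullS fullT i with any? (Fin-finite p) (λ a → ¬? (a Fin.≟ 𝟘) ×-dec dec≡ Bool-finite (S (ρ a)) false)
  -- No non-trivial rotation is missing, so `S` is everything except `e p`. Its digraph is complete,
  -- hence so is that of `T`, and the two sets coincide.
  ... | no ∄ = 𝟙ᵘ , 𝟘 , λ x → trans (S≗T x) (cong T (sym (α-identity x)))
    where
    open Iso i
    S-full : ∀ x → x ≢ e p → S x ≡ true
    S-full (a , zero)     ≢e = ¬-not (λ Sa → ∄ (a , (λ a≡𝟘 → ≢e (cong ρ a≡𝟘)) , Sa))
    S-full (b , suc zero) _  = fullS b
    e-quotient : ∀ {x y} → x ÷ y ≡ e p → x ≡ y
    e-quotient {x} {y} eq = trans (sym (÷-· x y)) (trans (cong (_· y) eq) (·-identityˡ y))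
    T-full : ∀ x → x ≢ e p → T x ≡ true
    T-full x x≢e = trans (cong T (sym (÷-e x))) (trans (arcs′ (e p) x)
      (S-full _ (λ eq → x≢e (trans (sym (to-from x)) (trans (cong to (e-quotient eq)) (to-from (e p)))))))
    S≗T : ∀ x → S x ≡ T x
    S≗T x with dec≡ D-finite x (e p)
    ... | yes refl = trans Se (sym Te)
    ... | no x≢e   = trans (S-full x x≢e) (sym (T-full x x≢e))
  -- Only the unit found for `onlyRotations` is kept: on rotations `α` does not depend on the
  -- offset, and a full set of reflections is preserved by any offset.
  ... | yes (a , a≢𝟘 , Sa) = c , 𝟘 , S≗
    where
    j = proj₁ (basedIso i)
    open Iso j
    base : to (e p) ≡ e p
    base = proj₂ (basedIso i)
    base′ : from (e p) ≡ e p
    base′ = trans (cong from (sym base)) (from-to (e p))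
    to-ρ : ∀ x → ∃ λ y → to (ρ x) ≡ ρ y
    to-ρ = preserves-rotations j base fullT a a≢𝟘 Sa
    a′ = proj₁ (to-ρ a)
    a′≢𝟘 : a′ ≢ 𝟘
    a′≢𝟘 eq = a≢𝟘 (cong proj₁ (to-injective (trans (proj₂ (to-ρ a)) (trans (cong ρ eq) (sym base)))))
    -- The missing rotation of `S` is carried to a missing rotation of `T`, so the inverse
    -- isomorphism preserves the rotations by the same argument.
    Ta′ : T (ρ a′) ≡ false
    Ta′ = trans (cong T (sym (proj₂ (to-ρ a)))) (trans (sym (based-preserves (Iso⇒IsIso j) base (ρ a))) Sa)
    from-ρ : ∀ x → ∃ λ y → from (ρ x) ≡ ρ y
    from-ρ = preserves-rotations (Iso-sym j) base′ fullS a′ a′≢𝟘 Ta′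
    equiv : Equiv (onlyRotations S) (onlyRotations T)
    equiv = iso⇒equiv-nonConstant (𝟘 , 𝟙 , dec-true (𝟘 Fin.≟ 𝟘) refl , dec-false (𝟙 Fin.≟ 𝟘) 𝟙≢𝟘)
      (onlyRotations-iso j (proj₁ ∘ to-ρ) (proj₁ ∘ from-ρ) (proj₂ ∘ to-ρ) (proj₂ ∘ from-ρ))
    c = proj₁ equiv
    S≗ : ∀ x → S x ≡ T (α (proj₁ c) 𝟘 x)
    S≗ (x , zero)     = proj₂ (proj₂ equiv) (x , zero)
    S≗ (x , suc zero) = trans (fullS x) (sym (fullT _))

  HasReflection : (D p → Bool) → Set
  HasReflection S = ∃ λ b → S (b , suc zero) ≡ true

  reflections : ∀ {S} → HasReflection S → NonConstant S ⊎ (∀ b → S (b , suc zero) ≡ true)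
  reflections {S} (b , Sb) with any? (Fin-finite p) (λ b → dec≡ Bool-finite (S (b , suc zero)) false)
  ... | yes (b′ , Sb′) = inj₁ (b , b′ , Sb , Sb′)
  ... | no ∄           = inj₂ (λ b → ¬-not (λ Sb → ∄ (b , Sb)))

  iso⇒equiv : ∀ {S T} → CayleySet p S → CayleySet p T → HasReflection S → HasReflection T → Iso S T → Equiv S T
  iso⇒equiv {S} {T} Se Te rS rT i with reflections {S} rS | reflections {T} rT
  ... | inj₁ nonConstant | _                = iso⇒equiv-nonConstant nonConstant i
  ... | inj₂ _           | inj₁ nonConstant = Equiv-sym (iso⇒equiv-nonConstant nonConstant (Iso-sym i))
  ... | inj₂ fullS       | inj₂ fullT       = iso⇒equiv-full Se Te fullS fullT i

  -- Connectedness read off from the connection set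

  HasSecondGenerator : (D p → Bool) → Set
  HasSecondGenerator S = (∃ λ a → a ≢ 𝟘 × S (ρ a) ≡ true) ⊎
                         (∃ λ b → ∃ λ b′ → b ≢ b′ × S (b , suc zero) ≡ true × S (b′ , suc zero) ≡ true)

  -- A decidable form of connectedness, which the inductively defined `Gen` does not offer directly.
  Generating : (D p → Bool) → Set
  Generating S = HasReflection S × HasSecondGenerator S

  -- The product of two distinct reflections is a non-trivial rotation, so one is generated in
  -- either case. As p is prime its powers are all the rotations, and a single reflection then gives
  -- the other coset.
  generating⇒connected : ∀ {S} → Generating S → Connected p S
  generating⇒connected {S} ((b , Sb) , second) = λ { (x , zero) → rotations x ; (x , suc zero) → subst (Gen p S) (cong (_, suc zero) (cancel-⊖ x b)) (gen-mul (rotations (x ⊕ ⊖ b)) (gen-s Sb)) }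
    where
    generatedRotation : HasSecondGenerator S → ∃ λ a → a ≢ 𝟘 × Gen p S (ρ a)
    generatedRotation (inj₁ (a , a≢𝟘 , Sa)) = a , a≢𝟘 , gen-s Sa
    generatedRotation (inj₂ (b , b′ , b≢b′ , Sb , Sb′)) = b ⊕ ⊖ b′ ,
      (λ eq → b≢b′ (trans (sym (cancel-⊖ b b′)) (trans (cong (_⊕ b′) eq) (⊕-identityˡ b′)))) , gen-mul (gen-s Sb) (gen-s Sb′)
    rotation = generatedRotation second
    a = proj₁ rotation
    a≢𝟘 : a ≢ 𝟘
    a≢𝟘 = proj₁ (proj₂ rotation)
    multiples : ∀ m → Gen p S (ρ ([ m ] ⊗ a))
    multiples zero    = subst (Gen p S) (cong ρ (sym (zeroˡ a))) gen-e
    multiples (suc m) = subst (Gen p S) (cong ρ (sym (trans (cong (_⊗ a) (sym ([]-⊕ 1 m)))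
      (trans (⊗-distribʳ-⊕ a 𝟙 [ m ]) (cong (_⊕ [ m ] ⊗ a) (⊗-identityˡ a)))))) (gen-mul (proj₂ (proj₂ rotation)) (multiples m))
    rotations : ∀ x → Gen p S (ρ x)
    rotations x = subst (Gen p S) (cong ρ (trans (cong (_⊗ a) ([]-toℕ m)) (trans (⊗-assoc x _ a)
      (trans (cong (x ⊗_) (proj₂ (recip′ a a≢𝟘))) (⊗-identityʳ x))))) (multiples (toℕ m))
      where m = x ⊗ proj₁ (recip′ a a≢𝟘)

  Gen⊆ : ∀ {S} (P : D p → Set) → P (e p) → (∀ {s} → S s ≡ true → P s) → (∀ {a b} → P a → P b → P (a · b)) →
         (∀ {a} → P a → P (inv p a)) → ∀ {g} → Gen p S g → P g
  Gen⊆ P Pe Ps P· Pinv gen-e         = Pe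
  Gen⊆ P Pe Ps P· Pinv (gen-s s)     = Ps s
  Gen⊆ P Pe Ps P· Pinv (gen-mul g h) = P· (Gen⊆ P Pe Ps P· Pinv g) (Gen⊆ P Pe Ps P· Pinv h)
  Gen⊆ P Pe Ps P· Pinv (gen-inv g)   = Pinv (Gen⊆ P Pe Ps P· Pinv g)

  connected⇒reflection : ∀ {S} → Connected p S → HasReflection S
  connected⇒reflection {S} conn with any? (Fin-finite p) (λ b → dec≡ Bool-finite (S (b , suc zero)) true)
  ... | yes r = r
  ... | no ∄ = contradiction (Gen⊆ (λ g → proj₂ g ≡ zero) refl rotation (λ { {_ , zero} {_ , zero} refl refl → refl })
                 (λ { {_ , zero} refl → refl }) (conn (𝟘 , suc zero))) λ ()
    where
    rotation : ∀ {s} → S s ≡ true → proj₂ s ≡ zero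
    rotation {x , zero}     _  = refl
    rotation {x , suc zero} Ss = contradiction (x , Ss) ∄

  connected⇒generating : ∀ {S} → CayleySet p S → Connected p S → Generating S
  connected⇒generating {S} Se conn with connected⇒reflection {S} conn
  ... | b , Sb with any? (Fin-finite p) (λ a → ¬? (a Fin.≟ 𝟘) ×-dec dec≡ Bool-finite (S (ρ a)) true)
                  | any? (Fin-finite p) (λ b′ → ¬? (b Fin.≟ b′) ×-dec dec≡ Bool-finite (S (b′ , suc zero)) true)
  ... | yes r | _     = (b , Sb) , inj₁ r
  ... | no _  | yes (b′ , b≢b′ , Sb′) = (b , Sb) , inj₂ (b , b′ , b≢b′ , Sb , Sb′)
  -- Here `S` lies in the subgroup consisting of `e p` and the reflection at `b`, which does not
  -- contain τ.
  ... | no ∄a | no ∄b = contradiction (Gen⊆ P (inj₁ refl) Ps P· Pinv (conn (ρ 𝟙))) ¬P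
    where
    P : D p → Set
    P g = g ≡ e p ⊎ g ≡ (b , suc zero)
    ¬P : ¬ P (ρ 𝟙)
    ¬P (inj₁ eq) = 𝟙≢𝟘 (cong proj₁ eq)
    ¬P (inj₂ eq) = contradiction (cong proj₂ eq) λ ()
    Ps : ∀ {s} → S s ≡ true → P s
    Ps {x , zero} Ss with x Fin.≟ 𝟘
    ... | yes refl = inj₁ refl
    ... | no x≢𝟘  = contradiction (x , x≢𝟘 , Ss) ∄a
    Ps {x , suc zero} Ss with b Fin.≟ x
    ... | yes refl = inj₂ refl
    ... | no b≢x   = contradiction (x , b≢x , Ss) ∄b
    P· : ∀ {g h} → P g → P h → P (g · h)
    P· (inj₁ refl) (inj₁ refl) = inj₁ (·-identityˡ (e p))
    P· (inj₁ refl) (inj₂ refl) = inj₂ (·-identityˡ (b , suc zero))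
    P· (inj₂ refl) (inj₁ refl) = inj₂ (·-identityʳ (b , suc zero))
    P· (inj₂ refl) (inj₂ refl) = inj₁ (·-inverseʳ (b , suc zero))
    Pinv : ∀ {g} → P g → P (inv p g)
    Pinv (inj₁ refl) = inj₁ (cong ρ ⊖𝟘)
    Pinv (inj₂ refl) = inj₂ refl

-- Totients and sums over divisors

indicator : ∀ {P : Set} → Dec P → ℕ
indicator P? = size (True-finite P?)

size-Sub : ∀ {A} {P : A → Set} (F : Finite A) (P? : ∀ a → Dec (P a)) → size (Sub-finite F P?) ≡ ∑ F (λ a → indicator (P? a))
size-Sub F P? = size-Σ F (λ a → True-finite (P? a))

indicator-yes : ∀ {P : Set} (P? : Dec P) → P → indicator P? ≡ 1
indicator-yes (yes _) _ = refl
indicator-yes (no ¬P) P = contradiction P ¬P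

indicator-no : ∀ {P : Set} (P? : Dec P) → ¬ P → indicator P? ≡ 0
indicator-no (yes P) ¬P = contradiction P ¬P
indicator-no (no _)  _  = refl

length-filter-applyUpTo : ∀ {P : ℕ → Set} (P? : ∀ k → Dec (P k)) (f : ℕ → ℕ) n →
                          length (filter P? (applyUpTo f n)) ≡ sum {n} (λ i → indicator (P? (f (toℕ i))))
length-filter-applyUpTo P? f zero = refl
length-filter-applyUpTo P? f (suc n) with P? (f 0)
... | yes _ = cong suc (length-filter-applyUpTo P? (f ∘ suc) n)
... | no _  = length-filter-applyUpTo P? (f ∘ suc) n

sum-map-filter-applyUpTo : ∀ {P : ℕ → Set} (P? : ∀ k → Dec (P k)) (f h : ℕ → ℕ) n →
                           ListAction.sum (map h (filter P? (applyUpTo f n))) ≡ sum {n} (λ i → indicator (P? (f (toℕ i))) * h (f (toℕ i)))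
sum-map-filter-applyUpTo P? f h zero = refl
sum-map-filter-applyUpTo P? f h (suc n) with P? (f 0)
... | yes _ = cong₂ _+_ (sym (ℕ.+-identityʳ (h (f 0)))) (sum-map-filter-applyUpTo P? (f ∘ suc) h n)
... | no _  = sum-map-filter-applyUpTo P? (f ∘ suc) h n

-- The index `j` stands for j + 1, because `totient d` runs through 1, ..., d.
Coprime-finite : ∀ d → Finite (Sub {Fin d} (λ j → gcd (suc (toℕ j)) d ℕ.≟ 1))
Coprime-finite d = Sub-finite (Fin-finite d) (λ j → gcd (suc (toℕ j)) d ℕ.≟ 1)

totient-size : ∀ d → totient d ≡ size (Coprime-finite d)
totient-size d = trans (cong (λ l → length (filter (λ k → gcd k d ℕ.≟ 1) l)) (List.map-upTo suc d))
  (trans (length-filter-applyUpTo (λ k → gcd k d ℕ.≟ 1) suc d) (sym (size-Sub (Fin-finite d) (λ j → gcd (suc (toℕ j)) d ℕ.≟ 1))))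

divSum-sum : ∀ c n → divSum c n ≡ sum {n} (λ k → indicator (suc (toℕ k) ∣? n) * (totient (suc (toℕ k)) * 2 ^ (c * n ℕ./ suc (toℕ k))))
divSum-sum c n = sum-map-filter-applyUpTo (λ k → suc k ∣? n) id (λ k → totient (suc k) * 2 ^ (c * n ℕ./ suc k)) n

-- Distinct reduced fractions j/d with d ∣ n give distinct multiples of 1/n in (0,1].
totient-sum-≤ : ∀ n .{{_ : NonZero n}} → sum {n} (λ k → indicator (suc (toℕ k) ∣? n) * totient (suc (toℕ k))) ≤ n
totient-sum-≤ n = subst (_≤ n) size≡ (size-injective Fractions-finite (Fin-finite n) numerator numerator-injective)
  where
  Divisor-finite : ∀ k → Finite (True (suc (toℕ k) ∣? n) × Sub {Fin (suc (toℕ k))} (λ j → gcd (suc (toℕ j)) (suc (toℕ k)) ℕ.≟ 1))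
  Divisor-finite k = ×-finite (True-finite (suc (toℕ k) ∣? n)) (Coprime-finite (suc (toℕ k)))

  Fractions : Set
  Fractions = Σ (Fin n) λ k → True (suc (toℕ k) ∣? n) × Sub {Fin (suc (toℕ k))} (λ j → gcd (suc (toℕ j)) (suc (toℕ k)) ℕ.≟ 1)

  Fractions-finite : Finite Fractions
  Fractions-finite = Σ-finite (Fin-finite n) Divisor-finite

  size≡ : size Fractions-finite ≡ sum {n} (λ k → indicator (suc (toℕ k) ∣? n) * totient (suc (toℕ k)))
  size≡ = trans (size-Σ (Fin-finite n) Divisor-finite) (sum-cong-≗ {n} λ k →
    trans (size-× (True-finite (suc (toℕ k) ∣? n)) (Coprime-finite (suc (toℕ k)))) (cong (indicator (suc (toℕ k) ∣? n) *_) (sym (totient-size (suc (toℕ k))))))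

  scaled : Fractions → ℕ
  scaled (k , _ , j , _) = suc (toℕ j) * (n ℕ./ suc (toℕ k))

  scaled*d : ∀ x → scaled x * suc (toℕ (proj₁ x)) ≡ suc (toℕ (proj₁ (proj₂ (proj₂ x)))) * n
  scaled*d (k , k∣n , j , _) = trans (ℕ.*-assoc (suc (toℕ j)) (n ℕ./ suc (toℕ k)) (suc (toℕ k))) (cong (suc (toℕ j) *_) (m/n*n≡m (toWitness k∣n)))

  scaled>0 : ∀ x → scaled x ≢ 0
  scaled>0 x@(k , _ , j , _) eq = ℕ.≢-nonZero⁻¹ n (ℕ.m+n≡0⇒m≡0 n (trans (sym (scaled*d x)) (cong (_* suc (toℕ k)) eq)))

  scaled≤n : ∀ x → scaled x ≤ n
  scaled≤n x@(k , _ , j , _) = ℕ.*-cancelʳ-≤ (scaled x) n (suc (toℕ k))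
    (ℕ.≤-trans (ℕ.≤-reflexive (scaled*d x)) (ℕ.≤-trans (ℕ.*-monoˡ-≤ n (Fin.toℕ<n j)) (ℕ.≤-reflexive (ℕ.*-comm (suc (toℕ k)) n))))

  pred<n : ∀ {m} → m ≢ 0 → m ≤ n → ℕ.pred m < n
  pred<n {zero}  m≢0 _   = contradiction refl m≢0
  pred<n {suc m} _   m≤n = m≤n

  numerator : Fractions → Fin n
  -- The numerators over the common denominator `n` run from 1 to n, hence the predecessor.
  numerator x = fromℕ< (pred<n (scaled>0 x) (scaled≤n x))

  numerator-injective : ∀ {x y} → numerator x ≡ numerator y → x ≡ y
  numerator-injective {x@(k , k∣n , j , j-coprime)} {y@(k′ , k′∣n , j′ , j′-coprime)} eq = same k≡k′
    where
    d d′ a a′ : ℕ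
    d = suc (toℕ k)
    d′ = suc (toℕ k′)
    a = suc (toℕ j)
    a′ = suc (toℕ j′)
    scaled≡ : scaled x ≡ scaled y
    scaled≡ = ℕ.pred-injective {{ℕ.≢-nonZero (scaled>0 x)}} {{ℕ.≢-nonZero (scaled>0 y)}}
      (trans (sym (Fin.toℕ-fromℕ< (pred<n (scaled>0 x) (scaled≤n x)))) (trans (cong toℕ eq) (Fin.toℕ-fromℕ< (pred<n (scaled>0 y) (scaled≤n y)))))
    cross : a * d′ ≡ a′ * d
    cross = ℕ.*-cancelʳ-≡ (a * d′) (a′ * d) n (begin
      a * d′ * n            ≡⟨ trans (cong (_* n) (ℕ.*-comm a d′)) (ℕ.*-assoc d′ a n) ⟩
      d′ * (a * n)          ≡⟨ cong (d′ *_) (scaled*d x) ⟨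
      d′ * (scaled x * d)   ≡⟨ cong (λ s → d′ * (s * d)) scaled≡ ⟩
      d′ * (scaled y * d)   ≡⟨ trans (sym (ℕ.*-assoc d′ (scaled y) d)) (cong (_* d) (ℕ.*-comm d′ (scaled y))) ⟩
      scaled y * d′ * d     ≡⟨ cong (_* d) (scaled*d y) ⟩
      a′ * n * d            ≡⟨ trans (ℕ.*-assoc a′ n d) (trans (cong (a′ *_) (ℕ.*-comm n d)) (sym (ℕ.*-assoc a′ d n))) ⟩
      a′ * d * n            ∎)
      where open ≡-Reasoning
    d∣d′ : d ∣ d′
    -- Both fractions are reduced: `d` divides a·d′ and is prime to `a`, and symmetrically for `d′`.
    -- So the denominators agree, and then the numerators.
    d∣d′ = coprime-divisor (coprime-sym (gcd≡1⇒coprime {a} {d} (toWitness j-coprime))) (divides a′ cross)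
    d′∣d : d′ ∣ d
    d′∣d = coprime-divisor (coprime-sym (gcd≡1⇒coprime {a′} {d′} (toWitness j′-coprime))) (divides a (sym cross))
    k≡k′ : k ≡ k′
    k≡k′ = Fin.toℕ-injective (ℕ.suc-injective (∣-antisym d∣d′ d′∣d))
    a≡a′ : d ≡ d′ → a ≡ a′
    a≡a′ d≡d′ = ℕ.*-cancelʳ-≡ a a′ d′ (trans cross (cong (a′ *_) d≡d′))
    same : k ≡ k′ → x ≡ y
    same refl = cong (k ,_) (cong₂ _,_ (Sub-≡′ k∣n k′∣n) (Sub-≡ _ (Fin.toℕ-injective (ℕ.suc-injective (a≡a′ refl)))))
      where
      Sub-≡′ : ∀ {P : Set} {P? : Dec P} (s t : True P?) → s ≡ t
      Sub-≡′ {P? = yes _} _ _ = refl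

least : ∀ {P : ℕ → Set} (P? : ∀ k → Dec (P k)) n → P n → ∃ λ m → P m × (∀ {k} → k < m → ¬ P k)
least P? n Pn with P? 0
... | yes P0 = 0 , P0 , λ ()
least P? zero    P0 | no ¬P0 = contradiction P0 ¬P0
least {P} P? (suc n) Pn | no ¬P0 = let m , Pm , min = least (P? ∘ suc) n Pn in
  suc m , Pm , λ { {zero} _ → ¬P0 ; {suc k} (s≤s k<m) → min k<m }

-- Orders of units modulo p

module Order (p : ℕ) .{{nz : NonZero p}} (p-prime : Prime p) where
  open Modular p
  open Field p p-prime

  -- Monic polynomials, given by their lower coefficients

  eval : ∀ {d} → Vec (Fin p) d → Fin p → Fin p
  eval []       x = 𝟙
  eval (c ∷ cs) x = c ⊕ x ⊗ eval cs x

  -- Synthetic division by x - r: the coefficients of the quotient are the values at `r` of the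
  -- successive tails, and the leading 1 stays implicit.
  divideBy : ∀ {d} → Fin p → Vec (Fin p) (suc d) → Vec (Fin p) d
  divideBy r (c ∷ [])       = []
  divideBy r (c ∷ cs@(_ ∷ _)) = eval cs r ∷ divideBy r cs

  open SemiringSolver commutativeSemiring using (solve; _:+_; _:*_; _:=_)

  -- Writing x as r ⊕ s avoids subtraction.
  divideBy-eval : ∀ {d} (cs : Vec (Fin p) (suc d)) r s →
                  eval cs (r ⊕ s) ≡ s ⊗ eval (divideBy r cs) (r ⊕ s) ⊕ eval cs r
  divideBy-eval (c ∷ []) r s = trans (cong (c ⊕_) (⊗-identityʳ _)) (trans
    (solve 3 (λ c r s → c :+ (r :+ s) := s :+ (c :+ r)) refl c r s)
    (cong₂ (λ u v → u ⊕ (c ⊕ v)) (sym (⊗-identityʳ s)) (sym (⊗-identityʳ r))))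
  divideBy-eval (c ∷ cs@(_ ∷ _)) r s = trans (cong (λ u → c ⊕ (r ⊕ s) ⊗ u) (divideBy-eval cs r s))
    (solve 5 (λ c r s q g → c :+ (r :+ s) :* (s :* q :+ g) := s :* (g :+ (r :+ s) :* q) :+ (c :+ r :* g)) refl
      c r s (eval (divideBy r cs) (r ⊕ s)) (eval cs r))

  -- By cancellation of the non-zero difference, every other root is also a root of the quotient by
  -- x - r₀. The induction ends at the constant polynomial 1.
  too-many-roots : ∀ {d} (cs : Vec (Fin p) d) (r : Fin (suc d) → Fin p) →
                   (∀ i j → r i ≡ r j → i ≡ j) → ¬ (∀ i → eval cs (r i) ≡ 𝟘)
  too-many-roots []          r inj root = 𝟙≢𝟘 (root zero)
  too-many-roots cs@(_ ∷ _) r inj root = too-many-roots (divideBy (r zero) cs) (r ∘ suc)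
    (λ i j eq → Fin.suc-injective (inj (suc i) (suc j) eq)) root′
    where
    root′ : ∀ i → eval (divideBy (r zero) cs) (r (suc i)) ≡ 𝟘
    root′ i = ⊗-cancelˡ s≢𝟘 (trans (sym (⊕-identityʳ _)) (trans (cong (s ⊗ eval (divideBy (r zero) cs) x ⊕_) (sym (root zero)))
      (trans (trans (cong (λ u → s ⊗ eval (divideBy (r zero) cs) u ⊕ eval cs (r zero)) (sym r⊕s)) (trans (sym (divideBy-eval cs (r zero) s))
        (trans (cong (eval cs) r⊕s) (root (suc i))))) (sym (zeroʳ s)))))
      where
      x = r (suc i)
      s = x ⊕ ⊖ r zero
      r⊕s : r zero ⊕ s ≡ x
      r⊕s = trans (⊕-comm (r zero) s) (cancel-⊖ x (r zero))
      s≢𝟘 : s ≢ 𝟘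
      s≢𝟘 s≡𝟘 = contradiction (inj zero (suc i) (trans (sym (⊕-identityʳ _)) (trans (cong (r zero ⊕_) (sym s≡𝟘)) r⊕s))) λ ()

  infixr 8 _^^_
  _^^_ : Fin p → ℕ → Fin p
  a ^^ zero  = 𝟙
  a ^^ suc k = a ⊗ a ^^ k

  ^^-+ : ∀ a k l → a ^^ (k + l) ≡ a ^^ k ⊗ a ^^ l
  ^^-+ a zero    l = sym (⊗-identityˡ _)
  ^^-+ a (suc k) l = trans (cong (a ⊗_) (^^-+ a k l)) (sym (⊗-assoc a _ _))

  𝟙^^ : ∀ k → 𝟙 ^^ k ≡ 𝟙
  𝟙^^ zero    = refl
  𝟙^^ (suc k) = trans (⊗-identityˡ _) (𝟙^^ k)

  ^^-* : ∀ a k l → a ^^ (k * l) ≡ (a ^^ l) ^^ k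
  ^^-* a zero    l = refl
  ^^-* a (suc k) l = trans (^^-+ a l (k * l)) (cong (a ^^ l ⊗_) (^^-* a k l))

  ^^-≢𝟘 : ∀ {a} → a ≢ 𝟘 → ∀ k → a ^^ k ≢ 𝟘
  ^^-≢𝟘 a≢𝟘 zero    = 𝟙≢𝟘
  ^^-≢𝟘 a≢𝟘 (suc k) = ⊗-≢𝟘 a≢𝟘 (^^-≢𝟘 a≢𝟘 k)

  ^^-cancel : ∀ {a} → a ≢ 𝟘 → ∀ {i j} → i ≤ j → a ^^ i ≡ a ^^ j → a ^^ (j ∸ i) ≡ 𝟙
  ^^-cancel {a} a≢𝟘 {i} {j} i≤j eq = ⊗-cancelˡ (^^-≢𝟘 a≢𝟘 i) (trans (sym (^^-+ a i (j ∸ i)))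
    (trans (cong (a ^^_) (ℕ.m+[n∸m]≡n i≤j)) (trans (sym eq) (sym (⊗-identityʳ _)))))

  -- The degree is d + 1: constant coefficient -1, then `d` zeros, then the implicit leading 1.
  x^^d−1 : ∀ d → Vec (Fin p) (suc d)
  x^^d−1 d = ⊖ 𝟙 ∷ replicate d 𝟘

  eval-x^^d : ∀ d x → eval (replicate d 𝟘) x ≡ x ^^ d
  eval-x^^d zero    x = refl
  eval-x^^d (suc d) x = trans (⊕-identityˡ _) (cong (x ⊗_) (eval-x^^d d x))

  eval-x^^d−1 : ∀ d {x} → x ^^ suc d ≡ 𝟙 → eval (x^^d−1 d) x ≡ 𝟘
  eval-x^^d−1 d {x} eq = trans (cong (λ u → ⊖ 𝟙 ⊕ x ⊗ u) (eval-x^^d d x)) (trans (cong (⊖ 𝟙 ⊕_) eq) (⊕-inverseˡ 𝟙))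

  opaque
    -- The order is recorded as `suc m`, which makes it non-zero by its form.
    has-order : (a : U) → ∃ λ m → proj₁ a ^^ suc m ≡ 𝟙 × (∀ {k} → k < m → proj₁ a ^^ suc k ≢ 𝟙)
    has-order a = least (λ k → (proj₁ a ^^ suc k) Fin.≟ 𝟙) (proj₁ witness) (proj₂ witness)
      where
      witness : ∃ λ k → proj₁ a ^^ suc k ≡ 𝟙
      witness with Fin.pigeonhole (ℕ.n<1+n p) (λ i → proj₁ a ^^ toℕ i)
      -- Two of the p + 1 powers with exponents 0, ..., p coincide, and the smaller power is
      -- cancelled.
      ... | i , j , i<j , eq = ℕ.pred (toℕ j ∸ toℕ i) , trans
        (cong (proj₁ a ^^_) (ℕ.suc-pred (toℕ j ∸ toℕ i) {{ℕ.>-nonZero (ℕ.m<n⇒0<n∸m i<j)}})) (^^-cancel (U-≢𝟘 a) (ℕ.<⇒≤ i<j) eq)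

  ord-1 : U → ℕ
  ord-1 a = proj₁ (has-order a)

  ord : U → ℕ
  ord a = suc (ord-1 a)

  ^^-ord : ∀ a → proj₁ a ^^ ord a ≡ 𝟙
  ^^-ord a = proj₁ (proj₂ (has-order a))

  ord-minimal : ∀ a {k} → k ≢ 0 → proj₁ a ^^ k ≡ 𝟙 → ord a ≤ k
  ord-minimal a {zero}  k≢0 eq = contradiction refl k≢0
  ord-minimal a {suc k} k≢0 eq = ℕ.≮⇒≥ (λ { (s≤s k<m) → proj₂ (proj₂ (has-order a)) k<m eq })

  scale : U → U → U
  scale a x = a ⊗ᵘ x

  iter-scale : ∀ a k x → proj₁ (iter (scale a) k x) ≡ proj₁ a ^^ k ⊗ proj₁ x
  iter-scale a zero    x = sym (⊗-identityˡ _)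
  iter-scale a (suc k) x = trans (cong (proj₁ a ⊗_) (iter-scale a k x)) (sym (⊗-assoc _ _ _))

  scale-period : ∀ a x → iter (scale a) (ord a) x ≡ x
  scale-period a x = U-≡ (trans (iter-scale a (ord a) x) (trans (cong (_⊗ proj₁ x) (^^-ord a)) (⊗-identityˡ _)))

  U-orbits : U → ℕ
  U-orbits a = orbitCount (scale a) (ord a) (scale-period a) U-finite

  toℕ≢0 : ∀ {d} .{{_ : NonZero d}} {k : Fin d} → k ≢ Modular.𝟘 d → toℕ k ≢ 0
  toℕ≢0 {d} k≢𝟘 eq = k≢𝟘 (Fin.toℕ-injective (trans eq (sym (Modular.toℕ-𝟘 d))))

  a^^k≢𝟙 : ∀ a {k : Fin (ord a)} → k ≢ Modular.𝟘 (ord a) → proj₁ a ^^ toℕ k ≢ 𝟙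
  a^^k≢𝟙 a {k} k≢𝟘 eq = ℕ.<⇒≱ (Fin.toℕ<n k) (ord-minimal a (toℕ≢0 k≢𝟘) eq)

  -- A power of `a` with exponent strictly between 0 and `ord a` moves every unit, so in Burnside's
  -- sum only the exponent 0 contributes. In particular the order divides p - 1.
  ord*U-orbits : ∀ a → ord a * U-orbits a ≡ p ∸ 1
  ord*U-orbits a = trans (sym (orbitCount-burnside (scale a) (ord a) (scale-period a) U-finite)) (trans (sym (ℕ.+-identityʳ _)) (trans
    (∑-replace (Fin-finite (ord a)) (λ k → size (Fix-finite k)) (λ _ → 0) 𝟘ᵈ no-fixed)
    (cong₂ _+_ (trans (∑-const (Fin-finite (ord a)) 0) (ℕ.*-zeroʳ (ord a))) (trans all-fixed size-U))))
    where
    open Orbits (Fin-finite (ord a)) U-finite (cyclic (scale a) (ord a) (scale-period a))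
    𝟘ᵈ = Modular.𝟘 (ord a)
    no-fixed : ∀ k → k ≢ 𝟘ᵈ → size (Fix-finite k) ≡ 0
    no-fixed k k≢𝟘 = empty⇒size (Fix-finite k) λ { (x , fixed) → a^^k≢𝟙 a k≢𝟘
      (⊗-cancelˡ (U-≢𝟘 x) (trans (⊗-comm (proj₁ x) _) (trans (sym (iter-scale a (toℕ k) x))
        (trans (cong proj₁ (toWitness fixed)) (sym (⊗-identityʳ (proj₁ x))))))) }
    all-fixed : size (Fix-finite 𝟘ᵈ) ≡ size U-finite
    all-fixed = size-↔ (Fix-finite 𝟘ᵈ) U-finite proj₁ (λ x → x , fromWitness (Action.▷-ε (cyclic (scale a) (ord a) (scale-period a)) x)) (λ _ → refl) (λ _ → Sub-≡ _ refl)

  n : ℕ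
  n = p ∸ 1

  ord∣n : ∀ a → ord a ∣ n
  ord∣n a = divides (U-orbits a) (trans (sym (ord*U-orbits a)) (ℕ.*-comm (ord a) _))

  instance
    n-nonZero : NonZero n
    n-nonZero = ℕ.>-nonZero (ℕ.m<n⇒0<n∸m 1<p)

  OfOrder-finite : ∀ d → Finite (Sub (λ a → ord a ℕ.≟ d))
  OfOrder-finite d = Sub-finite U-finite (λ a → ord a ℕ.≟ d)

  -- The powers of an element a of order d exhaust the roots of x^d − 1.
  of-order-≤-totient : ∀ d → size (OfOrder-finite (suc d)) ≤ totient (suc d)
  of-order-≤-totient d with size (OfOrder-finite (suc d)) ℕ.≟ 0
  ... | yes eq = subst (_≤ totient (suc d)) (sym eq) z≤n
  ... | no ≢0 with size⇒inhabited (OfOrder-finite (suc d)) ≢0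
  ... | a , ord-a = subst (size (OfOrder-finite (suc d)) ≤_) (sym (totient-size (suc d)))
        (size-injective (OfOrder-finite (suc d)) (Coprime-finite (suc d)) exponent exponent-injective)
    where
    a^^d : proj₁ a ^^ suc d ≡ 𝟙
    a^^d = subst (λ m → proj₁ a ^^ m ≡ 𝟙) (toWitness ord-a) (^^-ord a)

    power-injective : ∀ {i j} → i < j → j < suc d → proj₁ a ^^ suc i ≢ proj₁ a ^^ suc j
    power-injective {i} {j} i<j j<d eq = ℕ.<⇒≱ (ℕ.≤-<-trans (ℕ.m∸n≤m j i) j<d)
      (subst (_≤ suc j ∸ suc i) (toWitness ord-a) (ord-minimal a (ℕ.m>n⇒m∸n≢0 (s≤s i<j)) (^^-cancel (U-≢𝟘 a) (ℕ.<⇒≤ (s≤s i<j)) eq)))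

    logarithm : ∀ b → proj₁ b ^^ suc d ≡ 𝟙 → ∃ λ (k : Fin (suc d)) → proj₁ b ≡ proj₁ a ^^ suc (toℕ k)
    logarithm b b^^d with any? (Fin-finite (suc d)) (λ k → proj₁ b Fin.≟ proj₁ a ^^ suc (toℕ k))
    ... | yes found = found
    ... | no ∄      = contradiction root (too-many-roots (x^^d−1 d) r r-injective)
      where
      -- A root `b` outside the d + 1 powers of `a` would make d + 2 roots of a polynomial of degree
      -- d + 1.
      r : Fin (suc (suc d)) → Fin p
      r zero    = proj₁ b
      r (suc k) = proj₁ a ^^ suc (toℕ k)
      r-injective : ∀ i j → r i ≡ r j → i ≡ j
      r-injective zero    zero    _  = refl
      r-injective zero    (suc j) eq = contradiction (j , eq) ∄
      r-injective (suc i) zero    eq = contradiction (i , sym eq) ∄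
      r-injective (suc i) (suc j) eq with ℕ.<-cmp (toℕ i) (toℕ j)
      ... | tri< i<j _ _ = contradiction eq (power-injective i<j (Fin.toℕ<n j))
      ... | tri≈ _ i≡j _ = cong suc (Fin.toℕ-injective i≡j)
      ... | tri> _ _ j<i = contradiction (sym eq) (power-injective j<i (Fin.toℕ<n i))
      root : ∀ i → eval (x^^d−1 d) (r i) ≡ 𝟘
      root zero    = eval-x^^d−1 d b^^d
      root (suc k) = eval-x^^d−1 d (trans (sym (^^-* (proj₁ a) (suc d) (suc (toℕ k)))) (trans (cong (proj₁ a ^^_) (ℕ.*-comm (suc d) (suc (toℕ k))))
        (trans (^^-* (proj₁ a) (suc (toℕ k)) (suc d)) (trans (cong (_^^ suc (toℕ k)) a^^d) (𝟙^^ (suc (toℕ k)))))))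

    -- A common divisor g of k and d gives (a^k)^(d/g) = 1.
    coprime : ∀ b k → ord b ≡ suc d → proj₁ b ≡ proj₁ a ^^ k → gcd k (suc d) ≡ 1
    coprime b k ord-b b≡ with gcd[m,n]∣m k (suc d) | gcd[m,n]∣n k (suc d)
    ... | divides q k≡ | divides r d≡ = g≡1 (gcd k (suc d)) q r k≡ d≡
      where
      g≡1 : ∀ g q r → k ≡ q * g → suc d ≡ r * g → g ≡ 1
      g≡1 zero          q r       k≡ d≡ = contradiction (trans d≡ (ℕ.*-zeroʳ r)) λ ()
      g≡1 (suc zero)    q r       k≡ d≡ = refl
      g≡1 (suc (suc g)) q zero    k≡ d≡ = contradiction d≡ λ ()
      g≡1 (suc (suc g)) q (suc r) k≡ d≡ = contradiction (subst (_≤ suc r) ord-b (ord-minimal b (λ ()) b^^r))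
        (ℕ.<⇒≱ (subst (suc r <_) (sym d≡) (ℕ.m<m*n (suc r) (suc (suc g)) (s≤s (s≤s z≤n)))))
        where
        b^^r : proj₁ b ^^ suc r ≡ 𝟙
        b^^r = begin
          proj₁ b ^^ suc r                      ≡⟨ cong (_^^ suc r) b≡ ⟩
          (proj₁ a ^^ k) ^^ suc r               ≡⟨ ^^-* (proj₁ a) (suc r) k ⟨
          proj₁ a ^^ (suc r * k)                ≡⟨ cong (λ z → proj₁ a ^^ (suc r * z)) (trans k≡ (ℕ.*-comm q _)) ⟩
          proj₁ a ^^ (suc r * (suc (suc g) * q)) ≡⟨ cong (proj₁ a ^^_) (trans (sym (ℕ.*-assoc (suc r) (suc (suc g)) q)) (trans (cong (_* q) (sym d≡)) (ℕ.*-comm (suc d) q))) ⟩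
          proj₁ a ^^ (q * suc d)                ≡⟨ ^^-* (proj₁ a) q (suc d) ⟩
          (proj₁ a ^^ suc d) ^^ q               ≡⟨ cong (_^^ q) a^^d ⟩
          𝟙 ^^ q                                ≡⟨ 𝟙^^ q ⟩
          𝟙                                     ∎
          where open ≡-Reasoning

    log : (b : Sub (λ a → ord a ℕ.≟ suc d)) → ∃ λ (k : Fin (suc d)) → proj₁ (proj₁ b) ≡ proj₁ a ^^ suc (toℕ k)
    log (b , ord-b) = logarithm b (subst (λ m → proj₁ b ^^ m ≡ 𝟙) (toWitness ord-b) (^^-ord b))

    exponent : Sub (λ a → ord a ℕ.≟ suc d) → Sub {Fin (suc d)} (λ j → gcd (suc (toℕ j)) (suc d) ℕ.≟ 1)
    exponent b = proj₁ (log b) , fromWitness (coprime (proj₁ b) (suc (toℕ (proj₁ (log b)))) (toWitness (proj₂ b)) (proj₂ (log b)))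

    exponent-injective : ∀ {b b′} → exponent b ≡ exponent b′ → b ≡ b′
    exponent-injective {b} {b′} eq = Sub-≡ _ (U-≡ (trans (proj₂ (log b)) (trans (cong (λ k → proj₁ a ^^ suc (toℕ k)) (cong proj₁ eq)) (sym (proj₂ (log b′))))))

  sum-by-order : ∀ (h : ℕ → ℕ) → sum {n} (λ k → size (OfOrder-finite (suc (toℕ k))) * h (suc (toℕ k))) ≡ ∑ U-finite (λ a → h (ord a))
  sum-by-order h = begin
    sum {n} (λ k → size (OfOrder-finite (suc (toℕ k))) * h (suc (toℕ k)))
      ≡⟨ sum-cong-≗ {n} (λ k → trans (cong (_* h (suc (toℕ k))) (size-Sub U-finite (λ a → ord a ℕ.≟ suc (toℕ k))))
           (sym (∑-*ʳ U-finite (λ a → indicator (ord a ℕ.≟ suc (toℕ k))) (h (suc (toℕ k)))))) ⟩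
    ∑ (Fin-finite n) (λ k → ∑ U-finite (λ a → term a k))
      ≡⟨ ∑-swap (Fin-finite n) U-finite (λ k a → term a k) ⟩
    ∑ U-finite (λ a → ∑ (Fin-finite n) (term a))
      ≡⟨ ∑-cong U-finite collapse ⟩
    ∑ U-finite (λ a → h (ord a)) ∎
    where
    open ≡-Reasoning
    term : U → Fin n → ℕ
    term a k = indicator (ord a ℕ.≟ suc (toℕ k)) * h (suc (toℕ k))
    collapse : ∀ a → ∑ (Fin-finite n) (term a) ≡ h (ord a)
    collapse a = begin
      ∑ (Fin-finite n) (term a)            ≡⟨ ℕ.+-identityʳ _ ⟨
      ∑ (Fin-finite n) (term a) + 0        ≡⟨ ∑-replace (Fin-finite n) (term a) (λ _ → 0) k other ⟩
      ∑ (Fin-finite n) (λ _ → 0) + term a k ≡⟨ cong (_+ term a k) (trans (∑-const (Fin-finite n) 0) (ℕ.*-zeroʳ n)) ⟩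
      term a k                             ≡⟨ cong (_* h (suc (toℕ k))) (indicator-yes (ord a ℕ.≟ suc (toℕ k)) ord≡) ⟩
      1 * h (suc (toℕ k))                  ≡⟨ ℕ.*-identityˡ _ ⟩
      h (suc (toℕ k))                      ≡⟨ cong h ord≡ ⟨
      h (ord a)                            ∎
      where
      k : Fin n
      k = fromℕ< {ord-1 a} (∣⇒≤ (ord∣n a))
      ord≡ : ord a ≡ suc (toℕ k)
      ord≡ = cong suc (sym (Fin.toℕ-fromℕ< (∣⇒≤ (ord∣n a))))
      other : ∀ j → j ≢ k → term a j ≡ 0
      other j j≢k = cong (_* h (suc (toℕ j))) (indicator-no (ord a ℕ.≟ suc (toℕ j))
        (λ eq → j≢k (Fin.toℕ-injective (ℕ.suc-injective (trans (sym eq) ord≡)))))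

  -- The counts by order add up to exactly `n`, as every unit has an order dividing `n`, while the
  -- totients of the divisors add up to at most `n`. Being termwise bounded by the totients, the
  -- counts must equal them.
  of-order≡totient : ∀ (k : Fin n) → size (OfOrder-finite (suc (toℕ k))) ≡ indicator (suc (toℕ k) ∣? n) * totient (suc (toℕ k))
  of-order≡totient = sum-mono-≡ {n} ψ φ ψ≤φ (ℕ.≤-antisym (sum-mono {n} ψ φ ψ≤φ) (ℕ.≤-trans (totient-sum-≤ n) (ℕ.≤-reflexive (sym ψ-sum))))
    where
    ψ φ : Fin n → ℕ
    ψ k = size (OfOrder-finite (suc (toℕ k)))
    φ k = indicator (suc (toℕ k) ∣? n) * totient (suc (toℕ k))
    ψ≤φ : ∀ k → ψ k ≤ φ k
    ψ≤φ k with suc (toℕ k) ∣? n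
    ... | yes _ = ℕ.≤-trans (of-order-≤-totient (toℕ k)) (ℕ.≤-reflexive (sym (ℕ.*-identityˡ _)))
    ... | no ∤n = ℕ.≤-reflexive (empty⇒size (OfOrder-finite (suc (toℕ k)))
                    λ { (a , ord-a) → ∤n (subst (_∣ n) (toWitness ord-a) (ord∣n a)) })
    ψ-sum : sum ψ ≡ n
    ψ-sum = trans (sum-cong-≗ {n} (λ k → sym (ℕ.*-identityʳ (ψ k)))) (trans (sum-by-order (λ _ → 1))
      (trans (∑-const U-finite 1) (trans (ℕ.*-identityʳ _) size-U)))

  -- This is where the divisor sums of the formula become sums over units: Φ(d) units have order d,
  -- and multiplication by each of them has (p - 1)/d orbits.
  divSum≡ : ∀ c → divSum c n ≡ ∑ U-finite (λ a → 2 ^ (c * U-orbits a))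
  divSum≡ c = begin
    divSum c n ≡⟨ divSum-sum c n ⟩
    sum {n} (λ k → indicator (suc (toℕ k) ∣? n) * (totient (suc (toℕ k)) * h (toℕ k)))
      ≡⟨ sum-cong-≗ {n} (λ k → trans (sym (ℕ.*-assoc (indicator (suc (toℕ k) ∣? n)) (totient (suc (toℕ k))) (h (toℕ k)))) (cong (_* h (toℕ k)) (sym (of-order≡totient k)))) ⟩
    sum {n} (λ k → size (OfOrder-finite (suc (toℕ k))) * h (toℕ k))
      ≡⟨ sum-by-order (λ d → h (ℕ.pred d)) ⟩
    ∑ U-finite (λ a → h (ord-1 a))
      ≡⟨ ∑-cong U-finite (λ a → cong (2 ^_) (exponent≡ a)) ⟩
    ∑ U-finite (λ a → 2 ^ (c * U-orbits a)) ∎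
    where
    open ≡-Reasoning
    h : ℕ → ℕ
    h k = 2 ^ (c * n ℕ./ suc k)
    exponent≡ : ∀ a → c * n ℕ./ ord a ≡ c * U-orbits a
    exponent≡ a = trans (cong (λ m → c * m ℕ./ ord a) (trans (sym (ord*U-orbits a)) (ℕ.*-comm (ord a) _)))
      (trans (cong (ℕ._/ ord a) (sym (ℕ.*-assoc c (U-orbits a) (ord a)))) (m*n/n≡m (c * U-orbits a) (ord a)))

-- Both sides are sizes of Σ-types with fibres `Fin (f (a , b))`, and reassociating the triples is a
-- bijection.
∑-Σ : ∀ {A} {B : A → Set} (F : Finite A) (H : ∀ a → Finite (B a)) (f : Σ A B → ℕ) →
      ∑ (Σ-finite F H) f ≡ ∑ F (λ a → ∑ (H a) (λ b → f (a , b)))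
∑-Σ F H f = trans (sym (size-Σ (Σ-finite F H) (λ x → Fin-finite (f x)))) (trans
  (size-↔ (Σ-finite (Σ-finite F H) (λ x → Fin-finite (f x))) (Σ-finite F inner)
    (λ { ((a , b) , k) → a , b , k }) (λ { (a , b , k) → (a , b) , k }) (λ _ → refl) (λ _ → refl))
  (trans (size-Σ F inner) (∑-cong F (λ a → size-Σ (H a) (λ b → Fin-finite (f (a , b)))))))
  where inner = λ a → Σ-finite (H a) (λ b → Fin-finite (f (a , b)))

size-split : ∀ {A} {P : A → Set} (F : Finite A) (P? : ∀ a → Dec (P a)) →
             size F ≡ size (Sub-finite F P?) + size (Sub-finite F (λ a → ¬? (P? a)))
size-split F P? = sym (trans (cong₂ _+_ (size-Sub F P?) (size-Sub F (λ a → ¬? (P? a)))) (trans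
  (sym (∑-+ F (λ a → indicator (P? a)) (λ a → indicator (¬? (P? a)))))
  (trans (∑-cong F (λ a → complementary (P? a))) (trans (∑-const F 1) (ℕ.*-identityʳ (size F))))))
  where
  complementary : ∀ {P : Set} (P? : Dec P) → indicator P? + indicator (¬? P?) ≡ 1
  complementary (yes _) = refl
  complementary (no _)  = refl

restrict : ∀ {G X} (𝒜 : Action G X) {P : X → Set} (P? : ∀ x → Dec (P x)) →
           (∀ g x → P x → P (Action._▷_ 𝒜 g x)) → Action G (Sub P?)
restrict 𝒜 P? closed = record
  { isGroup = isGroup
  ; _▷_ = λ { g (x , Px) → g ▷ x , fromWitness (closed g x (toWitness Px)) }
  ; ▷-ε = λ { (x , _) → Sub-≡ P? (▷-ε x) }
  ; ▷-∙ = λ { g h (x , _) → Sub-≡ P? (▷-∙ g h x) } }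
  where open Action 𝒜

-- The automorphism group acting on connection sets

module Enumeration (p : ℕ) .{{nz : NonZero p}} (p-prime : Prime p) (p-odd : p % 2 ≡ 1) where
  open Modular p
  open Field p p-prime
  open CayleyIsomorphism p p-prime p-odd using (ρ; α; Equiv)
  open Classification p p-prime p-odd
  open Order p p-prime
  module TU = Tables U-finite
  module TF = Tables (Fin-finite p)

  Aut : Set
  Aut = U × Fin p

  Aut-finite : Finite Aut
  Aut-finite = ×-finite U-finite (Fin-finite p)

  infixl 7 _∙_
  _∙_ : Aut → Aut → Aut
  (c , d) ∙ (c′ , d′) = c ⊗ᵘ c′ , proj₁ c ⊗ d′ ⊕ d

  ι : Aut
  ι = 𝟙ᵘ , 𝟘

  infix 8 _⁻¹
  _⁻¹ : Aut → Aut
  (c , d) ⁻¹ = recip c , inverse-offset c d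

  ∙-isGroup : IsGroup _≡_ _∙_ ι _⁻¹
  ∙-isGroup = record
    { isMonoid = record
      { isSemigroup = record
        { isMagma = record { isEquivalence = isEquivalence ; ∙-cong = cong₂ _∙_ }
        ; assoc = λ { (a , b) (c , d) (f , g) → cong₂ _,_ (U-≡ (⊗-assoc _ _ _))
            (sym (trans (cong (_⊕ b) (trans (⊗-distribˡ-⊕ (proj₁ a) (proj₁ c ⊗ g) d) (cong (_⊕ proj₁ a ⊗ d) (sym (⊗-assoc (proj₁ a) (proj₁ c) g)))))
              (⊕-assoc (proj₁ a ⊗ proj₁ c ⊗ g) (proj₁ a ⊗ d) b))) } }
      ; identity = (λ { (c , d) → cong₂ _,_ (U-≡ (⊗-identityˡ _)) (trans (⊕-identityʳ (𝟙 ⊗ d)) (⊗-identityˡ d)) })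
                 , (λ { (c , d) → cong₂ _,_ (U-≡ (⊗-identityʳ _)) (trans (cong (_⊕ d) (zeroʳ (proj₁ c))) (⊕-identityˡ d)) }) }
    ; inverse = (λ { (c , d) → cong₂ _,_ (recip-inverseˡ c) (⊕-inverseʳ (proj₁ (recip c) ⊗ d)) })
              , (λ { (c , d) → cong₂ _,_ (recip-inverseʳ c) (trans (cong (_⊕ d) (trans (sym (-‿distribʳ-* (proj₁ c) _)) (cong ⊖_ (⊗-cancel-recip c d)))) (⊕-inverseˡ d)) })
    ; ⁻¹-cong = cong _⁻¹ }

  Aut-group : Group _ _
  Aut-group = record { isGroup = ∙-isGroup }

  open GroupProperties Aut-group using (⁻¹-anti-homo-∙; ε⁻¹≈ε)

  apply : Aut → D p → D p
  apply (c , d) = α (proj₁ c) d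

  apply-∙ : ∀ g h x → apply (g ∙ h) x ≡ apply g (apply h x)
  apply-∙ (c , d) (c′ , d′) x = sym (α-∘ (proj₁ c) d (proj₁ c′) d′ x)

  -- Connection sets, as pairs of a set of non-trivial rotations and a set of reflections

  Code : Set
  Code = TU.Table Bool × TF.Table Bool

  Code-finite : Finite Code
  Code-finite = ×-finite (TU.Table-finite Bool-finite) (TF.Table-finite Bool-finite)

  -- The identity always receives `false`. Hence every code decodes to a `CayleySet`, and codes
  -- correspond to connection sets one to one.
  decodeRotation : TU.Table Bool → (i : Fin p) → Dec (i ≡ 𝟘) → Bool
  decodeRotation A i (yes _)  = false
  decodeRotation A i (no i≢𝟘) = A TU.! unit i i≢𝟘

  decode : Code → D p → Bool
  decode (A , B) (i , zero)  = decodeRotation A i (i Fin.≟ 𝟘)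
  decode (A , B) (i , suc _) = B TF.! i

  encode : (D p → Bool) → Code
  encode S = TU.table (λ a → S (ρ (proj₁ a))) , TF.table (λ b → S (b , suc zero))

  decode-e : ∀ x → CayleySet p (decode x)
  decode-e (A , B) with 𝟘 Fin.≟ 𝟘
  ... | yes _  = refl
  ... | no 𝟘≢𝟘 = contradiction refl 𝟘≢𝟘

  decode-ρ : ∀ A B (a : U) → decode (A , B) (ρ (proj₁ a)) ≡ A TU.! a
  decode-ρ A B a with proj₁ a Fin.≟ 𝟘
  ... | yes a≡𝟘 = contradiction a≡𝟘 (U-≢𝟘 a)
  ... | no _     = cong (A TU.!_) (U-≡ refl)

  decode-encode : ∀ S → CayleySet p S → ∀ x → decode (encode S) x ≡ S x
  decode-encode S Se (i , suc zero) = TF.table-! (λ b → S (b , suc zero)) i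
  decode-encode S Se (i , zero) with i Fin.≟ 𝟘
  ... | yes refl = sym Se
  ... | no i≢𝟘  = TU.table-! (λ a → S (ρ (proj₁ a))) (unit i i≢𝟘)

  decode-injective : ∀ x y → (∀ z → decode x z ≡ decode y z) → x ≡ y
  decode-injective (A , B) (A′ , B′) eq = cong₂ _,_
    (TU.!-injective λ a → trans (sym (decode-ρ A B a)) (trans (eq (ρ (proj₁ a))) (decode-ρ A′ B′ a)))
    (TF.!-injective λ b → eq (b , suc zero))

  α-e : ∀ c d → α c d (e p) ≡ e p
  α-e c d = cong ρ (zeroʳ c)

  -- Pulling the indicator function back along `g ⁻¹` gives the image of the set under `g`, which
  -- makes this a left action.
  act : Aut → Code → Code
  act g x = encode (decode x ∘ apply (g ⁻¹))

  decode-act : ∀ g x z → decode (act g x) z ≡ decode x (apply (g ⁻¹) z)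
  decode-act g@(c , d) x = decode-encode (decode x ∘ apply (g ⁻¹)) (trans (cong (decode x) (α-e (proj₁ (recip c)) (inverse-offset c d))) (decode-e x))

  action : Action Aut Code
  action = record
    { isGroup = ∙-isGroup
    ; _▷_ = act
    ; ▷-ε = λ x → decode-injective (act ι x) x λ z → trans (decode-act ι x z)
        (cong (decode x) (trans (cong (λ g → apply g z) ε⁻¹≈ε) (α-identity z)))
    ; ▷-∙ = λ g h x → decode-injective (act (g ∙ h) x) (act g (act h x)) λ z → trans (decode-act (g ∙ h) x z) (trans
        (cong (decode x) (trans (cong (λ k → apply k z) (⁻¹-anti-homo-∙ g h)) (apply-∙ (h ⁻¹) (g ⁻¹) z)))
        (sym (trans (decode-act g (act h x) z) (decode-act h x (apply (g ⁻¹) z))))) }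

  apply-⁻¹ : ∀ g z → apply (g ⁻¹) (apply g z) ≡ z
  apply-⁻¹ (c , d) = α-inverseˡ c d

  opaque
    hasReflection? : ∀ S → Dec (HasReflection S)
    hasReflection? S = any? (Fin-finite p) (λ b → dec≡ Bool-finite (S (b , suc zero)) true)

    generating? : ∀ S → Dec (Generating S)
    generating? S = hasReflection? S ×-dec
      (any? (Fin-finite p) (λ a → ¬? (a Fin.≟ 𝟘) ×-dec dec≡ Bool-finite (S (ρ a)) true) ⊎-dec
       any? (Fin-finite p) (λ b → any? (Fin-finite p) (λ b′ → ¬? (b Fin.≟ b′) ×-dec
         (dec≡ Bool-finite (S (b , suc zero)) true ×-dec dec≡ Bool-finite (S (b′ , suc zero)) true))))

  Generating-cong : ∀ {S T} → (∀ x → S x ≡ T x) → Generating S → Generating T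
  Generating-cong {S} {T} eq ((b , Sb) , second) = (b , trans (sym (eq (b , suc zero))) Sb) , second′ second
    where
    second′ : HasSecondGenerator S → HasSecondGenerator T
    second′ (inj₁ (a , a≢𝟘 , Sa)) = inj₁ (a , a≢𝟘 , trans (sym (eq (ρ a))) Sa)
    second′ (inj₂ (b , b′ , b≢b′ , Sb , Sb′)) =
      inj₂ (b , b′ , b≢b′ , trans (sym (eq (b , suc zero))) Sb , trans (sym (eq (b′ , suc zero))) Sb′)

  Generating-act : ∀ g x → Generating (decode x) → Generating (decode (act g x))
  Generating-act g@(c , d) x ((b , xb) , second) = (proj₁ c ⊗ b ⊕ d , moved (b , suc zero) xb) , second′ second
    where
    moved : ∀ z → decode x z ≡ true → decode (act g x) (apply g z) ≡ true
    moved z xz = trans (decode-act g x (apply g z)) (trans (cong (decode x) (apply-⁻¹ g z)) xz)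
    second′ : HasSecondGenerator (decode x) → HasSecondGenerator (decode (act g x))
    second′ (inj₁ (a , a≢𝟘 , xa)) = inj₁ (proj₁ c ⊗ a , ⊗-≢𝟘 (U-≢𝟘 c) a≢𝟘 , moved (ρ a) xa)
    second′ (inj₂ (b , b′ , b≢b′ , xb , xb′)) = inj₂ (proj₁ c ⊗ b ⊕ d , proj₁ c ⊗ b′ ⊕ d ,
      (λ eq → b≢b′ (⊗-cancelˡ (U-≢𝟘 c) (⊕-cancelʳ d _ _ eq))) , moved (b , suc zero) xb , moved (b′ , suc zero) xb′)

  connected? : ∀ x → Dec (Generating (decode x))
  connected? x = generating? (decode x)

  Conn : Set
  Conn = Sub connected?

  Conn-finite : Finite Conn
  Conn-finite = Sub-finite Code-finite connected?

  conn-action : Action Aut Conn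
  conn-action = restrict action connected? Generating-act

  module Classes = Orbits Aut-finite Conn-finite conn-action
  open Classes using (_~_; Reps; Reps-finite; toRep; ~-rep; Fix-finite)

  classes : ℕ
  classes = size Reps-finite

  ~⇒Equiv : ∀ {x y : Conn} → x ~ y → Equiv (decode (proj₁ x)) (decode (proj₁ y))
  ~⇒Equiv {x} {y} (g , eq) = proj₁ (g ⁻¹) , proj₂ (g ⁻¹) , λ z → trans (cong (λ u → decode (proj₁ u) z) (sym eq)) (decode-act g (proj₁ y) z)

  Equiv⇒~ : ∀ {x y : Conn} → Equiv (decode (proj₁ x)) (decode (proj₁ y)) → y ~ x
  Equiv⇒~ {x} {y} equiv@(c , d , _) = (c , d) , Sub-≡ connected? (decode-injective (act (c , d) (proj₁ x)) (proj₁ y)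
    λ z → trans (decode-act (c , d) (proj₁ x) z) (sym (proj₂ (proj₂ (Equiv-sym {decode (proj₁ x)} {decode (proj₁ y)} equiv)) z)))

  representative : Fin classes → D p → Bool
  representative i = decode (proj₁ (proj₁ (at Reps-finite i)))

  representative-connCay : ∀ i → ConnCay p (representative i)
  representative-connCay i = let (x , gen) , _ = at Reps-finite i in decode-e x , generating⇒connected {decode x} (toWitness gen)

  representative-distinct : ∀ {i j} → i ≢ j → ¬ IsoCay p (representative i) (representative j)
  representative-distinct {i} {j} i≢j iso = i≢j (trans (sym (index-at Reps-finite i)) (trans (cong (index Reps-finite) same) (index-at Reps-finite j)))
    where
    r s : Reps
    r = at Reps-finite i
    s = at Reps-finite j
    reflection : (t : Reps) → HasReflection (decode (proj₁ (proj₁ t)))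
    reflection ((x , gen) , _) = proj₁ (toWitness gen)
    equivalent : proj₁ s ~ proj₁ r
    equivalent = Equiv⇒~ {proj₁ r} {proj₁ s} (iso⇒equiv {representative i} {representative j} (decode-e (proj₁ (proj₁ r))) (decode-e (proj₁ (proj₁ s))) (reflection r) (reflection s) (IsoCay⇒Iso {representative i} {representative j} iso))
    same : r ≡ s
    same = trans (sym (Classes.toRep-rep r)) (trans (Sub-≡ Classes.isRep? (sym (Classes.rep-cong equivalent))) (Classes.toRep-rep s))

  representative-complete : ∀ S → ConnCay p S → ∃ λ i → IsoCay p S (representative i)
  representative-complete S (Se , conn) = index Reps-finite (toRep x) , Equiv⇒IsoCay {S} {representative (index Reps-finite (toRep x))}
    (subst (λ r → Equiv S (decode (proj₁ (proj₁ r)))) (sym (at-index Reps-finite (toRep x)))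
      (let c , d , eq = ~⇒Equiv {x} {Classes.rep x} (~-rep x) in c , d , λ z → trans (sym (decode-encode S Se z)) (eq z)))
    where
    x : Conn
    x = encode S , fromWitness (Generating-cong {S} {decode (encode S)} (λ z → sym (decode-encode S Se z)) (connected⇒generating {S} Se conn))

  numConnIsoClasses : NumConnIsoClasses p classes
  numConnIsoClasses = List.tabulate representative , List.length-tabulate representative ,
    All.tabulate⁺ representative-connCay ,
    AllPairs.tabulate⁺ representative-distinct ,
    λ S S-conn → let i , iso = representative-complete S S-conn in Any.tabulate⁺ i iso

  -- Counting fixed connection sets

  affine : Aut → Fin p → Fin p
  affine (c , d) b = proj₁ c ⊗ b ⊕ d

  -- An automorphism preserves both cosets, so a set fixed by `g` is a pair of independently chosen
  -- invariant sets; on rotations only the unit of `g` matters.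
  Invariants : Aut → Set
  Invariants g = Sub (invariant? U-finite (scale (proj₁ g))) × Sub (invariant? (Fin-finite p) (affine g))

  Invariants-finite : ∀ g → Finite (Invariants g)
  Invariants-finite g = ×-finite (Inv-finite U-finite (scale (proj₁ g))) (Inv-finite (Fin-finite p) (affine g))

  code : ∀ g → Invariants g → Code
  code g ((A , _) , (B , _)) = A , B

  code-injective : ∀ g {v w : Invariants g} → code g v ≡ code g w → v ≡ w
  code-injective g eq = cong₂ _,_ (Sub-≡ (invariant? U-finite (scale (proj₁ g))) (cong proj₁ eq)) (Sub-≡ (invariant? (Fin-finite p) (affine g)) (cong proj₂ eq))

  fixed⇒invariant : ∀ g x → act g x ≡ x → ∀ z → decode x (apply g z) ≡ decode x z
  fixed⇒invariant g x eq z = trans (cong (λ y → decode y (apply g z)) (sym eq)) (trans (decode-act g x (apply g z)) (cong (decode x) (apply-⁻¹ g z)))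

  fixed⇒code : ∀ g x → act g x ≡ x → Σ (Invariants g) λ w → code g w ≡ x
  fixed⇒code g@(c , d) x@(A , B) eq =
    ((A , fromWitness (λ a → trans (sym (decode-ρ A B (c ⊗ᵘ a))) (trans (fixed⇒invariant g x eq (ρ (proj₁ a))) (decode-ρ A B a)))) ,
     (B , fromWitness (λ b → fixed⇒invariant g x eq (b , suc zero)))) , refl

  code⇒fixed : ∀ g (w : Invariants g) → act g (code g w) ≡ code g w
  code⇒fixed g@(c , d) ((A , A-inv) , (B , B-inv)) = decode-injective (act g (A , B)) (A , B) λ z →
    trans (decode-act g (A , B) z) (trans (sym (invariant (apply (g ⁻¹) z))) (cong (decode (A , B)) (α-inverseʳ c d z)))
    where
    invariant : ∀ z → decode (A , B) (apply g z) ≡ decode (A , B) z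
    invariant (i , suc zero) = toWitness B-inv i
    invariant (i , zero) = rotation (i Fin.≟ 𝟘)
      where
      rotation : Dec (i ≡ 𝟘) → decode (A , B) (ρ (proj₁ c ⊗ i)) ≡ decode (A , B) (ρ i)
      rotation (yes refl) = cong (decode (A , B) ∘ ρ) (zeroʳ (proj₁ c))
      rotation (no i≢𝟘)  = trans (decode-ρ A B (c ⊗ᵘ unit i i≢𝟘)) (trans (toWitness A-inv (unit i i≢𝟘)) (sym (decode-ρ A B (unit i i≢𝟘))))

  FixedPoint-finite : ∀ g → Finite (Sub (λ b → affine g b Fin.≟ b))
  FixedPoint-finite g = Sub-finite (Fin-finite p) (λ b → affine g b Fin.≟ b)

  module _ (g : Aut) where

    gen? : (w : Invariants g) → Dec (Generating (decode (code g w)))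
    gen? w = connected? (code g w)

    Rest : Set
    Rest = Sub (λ w → ¬? (gen? w))

    Rest-finite : Finite Rest
    Rest-finite = Sub-finite (Invariants-finite g) (λ w → ¬? (gen? w))

    refl? : (w : Rest) → Dec (HasReflection (decode (code g (proj₁ w))))
    refl? w = hasReflection? (decode (code g (proj₁ w)))

    size-generating : size (Sub-finite (Invariants-finite g) gen?) ≡ size (Fix-finite g)
    size-generating = size-↔ (Sub-finite (Invariants-finite g) gen?) (Fix-finite g) to from to-from from-to
      where
      Fix : Set
      Fix = Sub (λ x → dec≡ Conn-finite (Action._▷_ conn-action g x) x)

      invariants : ((x , _) : Fix) → Σ (Invariants g) λ w → code g w ≡ proj₁ x
      invariants ((x , _) , fixed) = fixed⇒code g x (cong proj₁ (toWitness fixed))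

      to : Sub gen? → Fix
      to (w , gen) = (code g w , gen) , fromWitness (Sub-≡ connected? (code⇒fixed g w))

      from : Fix → Sub gen?
      from x@((_ , gen) , _) = proj₁ (invariants x) , fromWitness (subst (Generating ∘ decode) (sym (proj₂ (invariants x))) (toWitness gen))

      to-from : ∀ x → to (from x) ≡ x
      to-from x = Sub-≡ _ (Sub-≡ connected? (proj₂ (invariants x)))

      from-to : ∀ w → from (to w) ≡ w
      from-to w = Sub-≡ gen? (code-injective g (proj₂ (invariants (to w))))

    -- The set of reflections is empty here, which is invariant under every `g`, and the invariant
    -- set of rotations remains arbitrary.
    size-noReflection : size (Sub-finite Rest-finite (λ w → ¬? (refl? w))) ≡ size (Inv-finite U-finite (scale (proj₁ g)))
    size-noReflection = size-↔ (Sub-finite Rest-finite (λ w → ¬? (refl? w))) (Inv-finite U-finite (scale (proj₁ g)))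
      (λ { (((A , _) , _) , _) → A })
      (λ A → ((A , none) , fromWitness (λ gen → no-none A (proj₁ gen))) , fromWitness (no-none A))
      (λ _ → refl)
      (λ { (((A , (B , _)) , _) , noRefl) → Sub-≡ _ (Sub-≡ _ (code-injective g (cong (proj₁ A ,_)
           (TF.!-injective λ b → trans (TF.table-! (λ _ → false) b) (sym (¬-not (λ Bb → toWitness noRefl (b , Bb)))))))) })
      where
      none : Sub (invariant? (Fin-finite p) (affine g))
      none = TF.table (λ _ → false) , fromWitness (λ b → trans (TF.table-! (λ _ → false) (affine g b)) (sym (TF.table-! (λ _ → false) b)))
      no-none : ∀ A → ¬ HasReflection (decode (proj₁ A , proj₁ none))
      no-none A (b , eq) = contradiction (trans (sym eq) (TF.table-! (λ _ → false) b)) λ ()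

    -- A set that has a reflection but does not generate has no non-trivial rotation and no second
    -- reflection. Invariance under `g` says that the exponent of its reflection is a fixed point of
    -- the affine map.
    size-oneReflection : size (Sub-finite Rest-finite refl?) ≡ size (FixedPoint-finite g)
    size-oneReflection = size-↔ (Sub-finite Rest-finite refl?) (FixedPoint-finite g) to from to-from from-to
      where
      unique : (w : Rest) → ∀ {b b′} → proj₂ (code g (proj₁ w)) TF.! b ≡ true → proj₂ (code g (proj₁ w)) TF.! b′ ≡ true → b ≡ b′
      unique w {b} {b′} Bb Bb′ = decidable-stable (b Fin.≟ b′) λ b≢b′ →
        toWitness (proj₂ w) ((b , Bb) , inj₂ (b , b′ , b≢b′ , Bb , Bb′))

      to : Sub refl? → Sub (λ b → affine g b Fin.≟ b)
      to (w@((_ , (B , B-inv)) , _) , r) = let b , Bb = toWitness r in b , fromWitness (unique w (trans (toWitness B-inv b) Bb) Bb)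

      none : Sub (invariant? U-finite (scale (proj₁ g)))
      none = TU.table (λ _ → false) , fromWitness (λ a → trans (TU.table-! (λ _ → false) (scale (proj₁ g) a)) (sym (TU.table-! (λ _ → false) a)))

      singleton : Fin p → TF.Table Bool
      singleton b = TF.table (λ b′ → does (b′ Fin.≟ b))

      singleton-true : ∀ b → singleton b TF.! b ≡ true
      singleton-true b = trans (TF.table-! (λ b′ → does (b′ Fin.≟ b)) b) (dec-true (b Fin.≟ b) refl)

      singleton-≡ : ∀ b b′ → singleton b TF.! b′ ≡ true → b′ ≡ b
      singleton-≡ b b′ eq with b′ Fin.≟ b | TF.table-! (λ b′ → does (b′ Fin.≟ b)) b′
      ... | yes b′≡b | _   = b′≡b
      ... | no _     | eq′ = contradiction (trans (sym eq) eq′) λ ()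

      affine-injective : ∀ {b b′} → affine g b ≡ affine g b′ → b ≡ b′
      affine-injective eq = ⊗-cancelˡ (U-≢𝟘 (proj₁ g)) (⊕-cancelʳ (proj₂ g) _ _ eq)

      one : Sub (λ b → affine g b Fin.≟ b) → Invariants g
      one (b , fixed) = none , singleton b , fromWitness λ b′ →
        trans (TF.table-! (λ b″ → does (b″ Fin.≟ b)) (affine g b′)) (trans
          (does-⇔ (mk⇔ (λ eq → affine-injective (trans eq (sym (toWitness fixed)))) (λ { refl → toWitness fixed })) (affine g b′ Fin.≟ b) (b′ Fin.≟ b))
          (sym (TF.table-! (λ b″ → does (b″ Fin.≟ b)) b′)))

      one-¬generating : ∀ b → ¬ Generating (decode (code g (one b)))
      one-¬generating (b , _) (_ , inj₁ (a , a≢𝟘 , eq)) = contradiction (trans (sym eq)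
        (trans (decode-ρ (proj₁ none) (singleton b) (unit a a≢𝟘)) (TU.table-! (λ _ → false) (unit a a≢𝟘)))) λ ()
      one-¬generating (b , _) (_ , inj₂ (b′ , b″ , b′≢b″ , eq , eq′)) = b′≢b″ (trans (singleton-≡ b b′ eq) (sym (singleton-≡ b b″ eq′)))

      from : Sub (λ b → affine g b Fin.≟ b) → Sub refl?
      from b = (one b , fromWitness (one-¬generating b)) , fromWitness (proj₁ b , singleton-true (proj₁ b))

      to-from : ∀ b → to (from b) ≡ b
      to-from b = Sub-≡ _ (unique (one b , fromWitness (one-¬generating b))
        (proj₂ (toWitness (proj₂ (from b)))) (singleton-true (proj₁ b)))

      noRotation : (w : Rest) → HasReflection (decode (code g (proj₁ w))) → ∀ a → proj₁ (code g (proj₁ w)) TU.! a ≡ false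
      noRotation w r a = ¬-not (λ Aa → toWitness (proj₂ w) (r , inj₁ (proj₁ a , U-≢𝟘 a , trans (decode-ρ (proj₁ (code g (proj₁ w))) (proj₂ (code g (proj₁ w))) a) Aa)))

      from-to : ∀ w → from (to w) ≡ w
      from-to (w@(((A , _) , (B , _)) , _) , r) = Sub-≡ _ (Sub-≡ _ (code-injective g (cong₂ _,_
        (TU.!-injective λ a → trans (TU.table-! (λ _ → false) a) (sym (noRotation w (toWitness r) a)))
        (TF.!-injective λ b′ → trans (TF.table-! (λ b″ → does (b″ Fin.≟ b)) b′) (same b′ (b′ Fin.≟ b))))))
        where
        b = proj₁ (toWitness r)
        same : ∀ b′ (b′≟b : Dec (b′ ≡ b)) → does b′≟b ≡ B TF.! b′
        same b′ (yes refl) = sym (proj₂ (toWitness r))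
        same b′ (no b′≢b)  = sym (¬-not (λ Bb′ → b′≢b (unique w Bb′ (proj₂ (toWitness r)))))

    -- All invariant pairs are split into the generating ones, those with a single reflection and no
    -- rotation, and those without reflections.
    size-Fix : size (Inv-finite U-finite (scale (proj₁ g))) * size (Inv-finite (Fin-finite p) (affine g)) ≡
               size (Fix-finite g) + (size (FixedPoint-finite g) + size (Inv-finite U-finite (scale (proj₁ g))))
    size-Fix = trans (sym (size-× (Inv-finite U-finite (scale (proj₁ g))) (Inv-finite (Fin-finite p) (affine g))))
      (trans (size-split (Invariants-finite g) gen?) (cong₂ _+_ size-generating
        (trans (size-split Rest-finite refl?) (cong₂ _+_ size-oneReflection size-noReflection))))

-- Evaluation of the Burnside sum

module Counting (p : ℕ) .{{nz : NonZero p}} (p-prime : Prime p) (p-odd : p % 2 ≡ 1) where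
  open Modular p
  open Field p p-prime
  open Order p p-prime
  open Enumeration p p-prime p-odd
  open CayleyIsomorphism p p-prime p-odd using (translation-invariant)

  opaque
    IU : U → ℕ
    IU c = size (Inv-finite U-finite (scale c))

    IF : Aut → ℕ
    IF g = size (Inv-finite (Fin-finite p) (affine g))

    fixes : Aut → ℕ
    fixes g = size (Classes.Fix-finite g)

    fixedPoints : Aut → ℕ
    fixedPoints g = size (FixedPoint-finite g)

    fixes-equation : ∀ g → IU (proj₁ g) * IF g ≡ fixes g + (fixedPoints g + IU (proj₁ g))
    fixes-equation g = size-Fix g

    ∑fixes : ∑ Aut-finite fixes ≡ size Aut-finite * classes
    ∑fixes = Classes.burnside

    IU≡ : ∀ c → IU c ≡ 2 ^ U-orbits c
    IU≡ c = size-Inv-cyclic (scale c) (ord c) (scale-period c) U-finite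

  U-orbits-𝟙 : U-orbits 𝟙ᵘ ≡ n
  U-orbits-𝟙 = trans (sym (ℕ.*-identityˡ _)) (trans (cong (_* U-orbits 𝟙ᵘ) (sym ord-𝟙)) (ord*U-orbits 𝟙ᵘ))
    where
    ord-𝟙 : ord 𝟙ᵘ ≡ 1
    ord-𝟙 = ℕ.≤-antisym (ord-minimal 𝟙ᵘ (λ ()) (⊗-identityʳ 𝟙)) (s≤s z≤n)

  opaque
    unfolding IU IF fixes fixedPoints
    IF-identity : IF (𝟙ᵘ , 𝟘) ≡ 2 ^ p
    IF-identity = trans (size-↔ (Inv-finite (Fin-finite p) (affine (𝟙ᵘ , 𝟘))) (TF.Table-finite Bool-finite) proj₁
      (λ t → t , fromWitness (λ b → cong (t TF.!_) (trans (⊕-identityʳ (𝟙 ⊗ b)) (⊗-identityˡ b)))) (λ _ → refl)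
      (λ _ → Sub-≡ (invariant? (Fin-finite p) (affine (𝟙ᵘ , 𝟘))) refl)) (TF.size-Table Bool-finite)

    -- Such a translation is transitive on the reflections, so only the empty and the full set are
    -- invariant.
    IF-translation : ∀ d → d ≢ 𝟘 → IF (𝟙ᵘ , d) ≡ 2
    IF-translation d d≢𝟘 = size-↔ (Inv-finite (Fin-finite p) (affine (𝟙ᵘ , d))) Bool-finite
      (λ { (t , _) → t TF.! 𝟘 })
      (λ v → TF.table (λ _ → v) , fromWitness (λ b → trans (TF.table-! (λ _ → v) (affine (𝟙ᵘ , d) b)) (sym (TF.table-! (λ _ → v) b))))
      (λ v → TF.table-! (λ _ → v) 𝟘)
      (λ { (t , inv) → Sub-≡ (invariant? (Fin-finite p) (affine (𝟙ᵘ , d))) (TF.!-injective λ b → trans (TF.table-! (λ _ → t TF.! 𝟘) b)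
        (translation-invariant (t TF.!_) d d≢𝟘 (λ x → trans (sym (toWitness inv x)) (cong (λ u → t TF.! (u ⊕ d)) (⊗-identityˡ x))) 𝟘 b)) })

  module _ (c : U) (c≢𝟙 : proj₁ c ≢ 𝟙) (d : Fin p) where

    private
      s : Fin p
      s = 𝟙 ⊕ ⊖ proj₁ c

      s≢𝟘 : s ≢ 𝟘
      s≢𝟘 eq = c≢𝟙 (sym (trans (sym (cancel-⊖ 𝟙 (proj₁ c))) (trans (cong (_⊕ proj₁ c) eq) (⊕-identityˡ _))))

      s⁻¹ = recip′ s s≢𝟘

    -- The fixed point d / (1 - c) of the affine map, around which the map is multiplication by `c`.
    center : Fin p
    center = proj₁ s⁻¹ ⊗ d

    affine-center : affine (c , d) center ≡ center
    affine-center = begin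
      proj₁ c ⊗ center ⊕ d                  ≡⟨ cong (proj₁ c ⊗ center ⊕_) d≡ ⟩
      proj₁ c ⊗ center ⊕ s ⊗ center         ≡⟨ ⊗-distribʳ-⊕ center (proj₁ c) s ⟨
      (proj₁ c ⊕ s) ⊗ center                ≡⟨ cong (_⊗ center) (trans (⊕-comm (proj₁ c) s) (cancel-⊖ 𝟙 (proj₁ c))) ⟩
      𝟙 ⊗ center                            ≡⟨ ⊗-identityˡ center ⟩
      center                                ∎
      where
      open ≡-Reasoning
      d≡ : d ≡ s ⊗ center
      d≡ = sym (trans (sym (⊗-assoc s (proj₁ s⁻¹) d)) (trans (cong (_⊗ d) (trans (⊗-comm s (proj₁ s⁻¹)) (proj₂ s⁻¹))) (⊗-identityˡ d)))

    iter-affine : ∀ k x → iter (affine (c , d)) k x ≡ proj₁ c ^^ k ⊗ (x ⊕ ⊖ center) ⊕ center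
    iter-affine zero    x = sym (trans (cong (_⊕ center) (⊗-identityˡ (x ⊕ ⊖ center))) (cancel-⊖ x center))
    iter-affine (suc k) x = begin
      proj₁ c ⊗ iter (affine (c , d)) k x ⊕ d        ≡⟨ cong (λ y → proj₁ c ⊗ y ⊕ d) (iter-affine k x) ⟩
      proj₁ c ⊗ (v ⊕ center) ⊕ d                     ≡⟨ cong (_⊕ d) (⊗-distribˡ-⊕ (proj₁ c) v center) ⟩
      proj₁ c ⊗ v ⊕ proj₁ c ⊗ center ⊕ d             ≡⟨ ⊕-assoc (proj₁ c ⊗ v) (proj₁ c ⊗ center) d ⟩
      proj₁ c ⊗ v ⊕ (proj₁ c ⊗ center ⊕ d)           ≡⟨ cong₂ _⊕_ (sym (⊗-assoc (proj₁ c) (proj₁ c ^^ k) (x ⊕ ⊖ center))) affine-center ⟩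
      proj₁ c ^^ suc k ⊗ (x ⊕ ⊖ center) ⊕ center     ∎
      where
      open ≡-Reasoning
      v = proj₁ c ^^ k ⊗ (x ⊕ ⊖ center)

    affine-period : ∀ x → iter (affine (c , d)) (ord c) x ≡ x
    affine-period x = trans (iter-affine (ord c) x) (trans (cong (λ u → u ⊗ (x ⊕ ⊖ center) ⊕ center) (^^-ord c))
      (trans (cong (_⊕ center) (⊗-identityˡ (x ⊕ ⊖ center))) (cancel-⊖ x center)))

    F-orbits : ℕ
    F-orbits = orbitCount (affine (c , d)) (ord c) affine-period (Fin-finite p)

    iter-center : ∀ k → iter (affine (c , d)) k center ≡ center
    iter-center zero    = refl
    iter-center (suc k) = trans (cong (affine (c , d)) (iter-center k)) affine-center

    fixed⇒center : ∀ {k : Fin (ord c)} → k ≢ Modular.𝟘 (ord c) → ∀ x → iter (affine (c , d)) (toℕ k) x ≡ x → x ≡ center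
    fixed⇒center {k} k≢𝟘 x eq = decidable-stable (x Fin.≟ center) λ x≢center →
      a^^k≢𝟙 c k≢𝟘 (⊗-cancelˡ {x ⊕ ⊖ center} (u≢𝟘 x≢center) (trans (⊗-comm (x ⊕ ⊖ center) (proj₁ c ^^ toℕ k))
        (trans (⊕-cancelʳ center _ _ (trans (sym (iter-affine (toℕ k) x)) (trans eq (sym (cancel-⊖ x center))))) (sym (⊗-identityʳ (x ⊕ ⊖ center))))))
      where
      u≢𝟘 : x ≢ center → x ⊕ ⊖ center ≢ 𝟘
      u≢𝟘 x≢center u≡𝟘 = x≢center (trans (sym (cancel-⊖ x center)) (trans (cong (_⊕ center) u≡𝟘) (⊕-identityˡ center)))

    -- Each non-zero exponent fixes the centre alone and the exponent 0 fixes all p points, so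
    -- Burnside's sum is (ord c - 1) + p; the 1 is moved across to avoid subtraction.
    ord*F-orbits : ord c * F-orbits + 1 ≡ ord c * 1 + p
    ord*F-orbits = trans (cong (_+ 1) (sym (orbitCount-burnside (affine (c , d)) (ord c) affine-period (Fin-finite p)))) (trans
      (∑-replace (Fin-finite (ord c)) (λ k → size (Fix k)) (λ _ → 1) (Modular.𝟘 (ord c)) one-fixed)
      (cong₂ _+_ (∑-const (Fin-finite (ord c)) 1) all-fixed))
      where
      open Orbits (Fin-finite (ord c)) (Fin-finite p) (cyclic (affine (c , d)) (ord c) affine-period) renaming (Fix-finite to Fix)
      one-fixed : ∀ k → k ≢ Modular.𝟘 (ord c) → size (Fix k) ≡ 1
      one-fixed k k≢𝟘 = size-↔ (Fix k) (Fin-finite 1) (λ _ → zero) (λ _ → center , fromWitness (iter-center (toℕ k)))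
        (λ { zero → refl }) (λ { (x , fixed) → Sub-≡ _ (sym (fixed⇒center k≢𝟘 x (toWitness fixed))) })
      all-fixed : size (Fix (Modular.𝟘 (ord c))) ≡ p
      all-fixed = size-↔ (Fix (Modular.𝟘 (ord c))) (Fin-finite p) proj₁
        (λ x → x , fromWitness (Action.▷-ε (cyclic (affine (c , d)) (ord c) affine-period) x)) (λ _ → refl) (λ _ → Sub-≡ _ refl)

    F-orbits≡ : F-orbits ≡ suc (U-orbits c)
    F-orbits≡ = ℕ.*-cancelˡ-≡ _ _ (ord c) (ℕ.+-cancelʳ-≡ 1 _ _ (begin
      ord c * F-orbits + 1             ≡⟨ ord*F-orbits ⟩
      ord c * 1 + p                    ≡⟨ cong₂ _+_ (ℕ.*-identityʳ (ord c)) (sym (trans (ℕ.+-comm n 1) (ℕ.m+[n∸m]≡n (ℕ.<⇒≤ 1<p)))) ⟩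
      ord c + (n + 1)                  ≡⟨ ℕ.+-assoc (ord c) n 1 ⟨
      ord c + n + 1                    ≡⟨ cong (λ u → ord c + u + 1) (ord*U-orbits c) ⟨
      ord c + ord c * U-orbits c + 1   ≡⟨ cong (_+ 1) (ℕ.*-suc (ord c) (U-orbits c)) ⟨
      ord c * suc (U-orbits c) + 1     ∎))
      where open ≡-Reasoning

    opaque
      unfolding IF
      IF-affine : IF (c , d) ≡ 2 * 2 ^ U-orbits c
      IF-affine = trans (size-Inv-cyclic (affine (c , d)) (ord c) affine-period (Fin-finite p)) (cong (2 ^_) F-orbits≡)

  T₁ T₂ : ℕ
  T₁ = divSum 1 n
  T₂ = divSum 2 n

  suc-n : suc n ≡ p
  suc-n = ℕ.m+[n∸m]≡n (ℕ.<⇒≤ 1<p)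

  ∑IF𝟙 : ∑ (Fin-finite p) (λ d → IF (𝟙ᵘ , d)) ≡ 2 * n + 2 * 2 ^ n
  ∑IF𝟙 = ℕ.+-cancelʳ-≡ 2 _ _ (begin
    ∑ (Fin-finite p) (λ d → IF (𝟙ᵘ , d)) + 2   ≡⟨ ∑-replace (Fin-finite p) (λ d → IF (𝟙ᵘ , d)) (λ _ → 2) 𝟘 IF-translation ⟩
    ∑ (Fin-finite p) (λ _ → 2) + IF (𝟙ᵘ , 𝟘)    ≡⟨ cong₂ _+_ (∑-const (Fin-finite p) 2) IF-identity ⟩
    p * 2 + 2 ^ p                              ≡⟨ cong (λ q → q * 2 + 2 ^ q) suc-n ⟨
    suc n * 2 + 2 * 2 ^ n                      ≡⟨ solve 2 (λ n x → (con 1 :+ n) :* con 2 :+ con 2 :* x := con 2 :* n :+ con 2 :* x :+ con 2) refl n (2 ^ n) ⟩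
    2 * n + 2 * 2 ^ n + 2                      ∎)
    where
    open ≡-Reasoning
    open ℕ-Solver.+-*-Solver

  -- The invariant pairs, generating or not, counted over all automorphisms with unit `c`. The total
  -- over `c` is evaluated twice, in `∑row` and in `∑row≡`.
  row : U → ℕ
  row c = ∑ (Fin-finite p) (λ d → IU c * IF (c , d))

  square : ∀ k → 2 ^ (2 * k) ≡ 2 ^ k * 2 ^ k
  square k = trans (cong (2 ^_) (cong (_+_ k) (ℕ.+-identityʳ k))) (ℕ.^-distribˡ-+-* 2 k k)

  row-generic : ∀ c → c ≢ 𝟙ᵘ → row c ≡ p * (2 * 2 ^ (2 * U-orbits c))
  row-generic c c≢𝟙 = trans (∑-cong (Fin-finite p) (λ d → cong₂ _*_ (IU≡ c) (IF-affine c (c≢𝟙 ∘ U-≡) d)))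
    (trans (∑-const (Fin-finite p) (2 ^ U-orbits c * (2 * 2 ^ U-orbits c))) (cong (p *_)
      (trans (solve 1 (λ x → x :* (con 2 :* x) := con 2 :* (x :* x)) refl (2 ^ U-orbits c)) (cong (2 *_) (sym (square (U-orbits c)))))))
    where open ℕ-Solver.+-*-Solver

  row-𝟙 : row 𝟙ᵘ ≡ 2 ^ n * (2 * n + 2 * 2 ^ n)
  row-𝟙 = trans (∑-*ˡ (Fin-finite p) (λ d → IF (𝟙ᵘ , d)) (IU 𝟙ᵘ)) (cong₂ _*_ (trans (IU≡ 𝟙ᵘ) (cong (2 ^_) U-orbits-𝟙)) ∑IF𝟙)

  -- The generic expression gives `divSum 2 n` only when summed over all units, `𝟙ᵘ` included. The
  -- one row that differs is then exchanged, each value being added on the opposite side.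
  ∑row : ∑ U-finite row + p * (2 * (2 ^ n * 2 ^ n)) ≡ p * (2 * T₂) + 2 ^ n * (2 * n + 2 * 2 ^ n)
  ∑row = begin
    ∑ U-finite row + p * (2 * (2 ^ n * 2 ^ n))                   ≡⟨ cong (λ u → ∑ U-finite row + p * (2 * u)) (trans (sym (square n)) (cong (λ k → 2 ^ (2 * k)) (sym U-orbits-𝟙))) ⟩
    ∑ U-finite row + generic 𝟙ᵘ                                  ≡⟨ ∑-replace U-finite row generic 𝟙ᵘ row-generic ⟩
    ∑ U-finite generic + row 𝟙ᵘ                                  ≡⟨ cong₂ _+_ ∑generic row-𝟙 ⟩
    p * (2 * T₂) + 2 ^ n * (2 * n + 2 * 2 ^ n)                   ∎
    where
    open ≡-Reasoning
    generic : U → ℕ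
    generic c = p * (2 * 2 ^ (2 * U-orbits c))
    ∑generic : ∑ U-finite generic ≡ p * (2 * T₂)
    ∑generic = trans (∑-*ˡ U-finite (λ c → 2 * 2 ^ (2 * U-orbits c)) p) (cong (p *_)
      (trans (∑-*ˡ U-finite (λ c → 2 ^ (2 * U-orbits c)) 2) (cong (2 *_) (sym (divSum≡ 2)))))

  opaque
    unfolding IU IF fixes fixedPoints
    -- For given c and b there is exactly one d with c⊗b⊕d ≡ b.
    ∑fixedPoints : ∀ c → ∑ (Fin-finite p) (λ d → fixedPoints (c , d)) ≡ p
    ∑fixedPoints c = trans (sym (size-Σ (Fin-finite p) (λ d → FixedPoint-finite (c , d)))) (size-↔ (Σ-finite (Fin-finite p) (λ d → FixedPoint-finite (c , d))) (Fin-finite p)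
      (λ { (d , b , _) → b }) (λ b → b ⊕ ⊖ (proj₁ c ⊗ b) , b , fromWitness (trans (⊕-comm (proj₁ c ⊗ b) _) (cancel-⊖ b (proj₁ c ⊗ b)))) (λ _ → refl)
      (λ { (d , b , fixed) → same b (⊕-cancelˡ (proj₁ c ⊗ b) _ _ (trans (trans (⊕-comm (proj₁ c ⊗ b) _) (cancel-⊖ b (proj₁ c ⊗ b))) (sym (toWitness fixed)))) }))
      where
      same : ∀ b {d d′} {s : True (affine (c , d) b Fin.≟ b)} {t : True (affine (c , d′) b Fin.≟ b)} → d ≡ d′ →
             (Σ (Fin p) (λ d → Sub (λ b → affine (c , d) b Fin.≟ b)) ∋ (d , b , s)) ≡ (d′ , b , t)
      same b {d} refl = cong (d ,_) (Sub-≡ (λ b → affine (c , d) b Fin.≟ b) refl)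

  -- The evaluation through `fixes-equation`: Burnside's lemma yields the classes, the single
  -- reflections yield p·n, which becomes the final -1, and the sets without reflections yield p·T₁,
  -- which becomes -`𝒩c`.
  ∑row≡ : ∑ U-finite row ≡ p * n * classes + (p * n + p * T₁)
  ∑row≡ = begin
    ∑ U-finite row
      ≡⟨ ∑-cong U-finite (λ c → ∑-cong (Fin-finite p) (λ d → fixes-equation (c , d))) ⟩
    ∑ U-finite (λ c → ∑ (Fin-finite p) (λ d → fixes (c , d) + (fixedPoints (c , d) + IU c)))
      ≡⟨ ∑-cong U-finite (λ c → trans (∑-+ (Fin-finite p) (λ d → fixes (c , d)) (λ d → fixedPoints (c , d) + IU c)) (cong (∑ (Fin-finite p) (λ d → fixes (c , d)) +_) (trans (∑-+ (Fin-finite p) (λ d → fixedPoints (c , d)) (λ _ → IU c))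
           (cong₂ _+_ (∑fixedPoints c) (∑-const (Fin-finite p) (IU c)))))) ⟩
    ∑ U-finite (λ c → ∑ (Fin-finite p) (λ d → fixes (c , d)) + (p + p * IU c))
      ≡⟨ trans (∑-+ U-finite (λ c → ∑ (Fin-finite p) (λ d → fixes (c , d))) (λ c → p + p * IU c)) (cong₂ _+_ ∑fix
           (trans (∑-+ U-finite (λ _ → p) (λ c → p * IU c)) (cong₂ _+_ (trans (∑-const U-finite p) (trans (cong (_* p) size-U) (ℕ.*-comm n p)))
             (trans (∑-*ˡ U-finite IU p) (cong (p *_) ∑IU))))) ⟩
    p * n * classes + (p * n + p * T₁) ∎
    where
    open ≡-Reasoning
    ∑fix : ∑ U-finite (λ c → ∑ (Fin-finite p) (λ d → fixes (c , d))) ≡ p * n * classes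
    ∑fix = trans (sym (∑-Σ U-finite (λ _ → Fin-finite p) fixes)) (trans ∑fixes
      (cong (_* classes) (trans (size-× U-finite (Fin-finite p)) (trans (cong (_* p) size-U) (ℕ.*-comm n p)))))
    ∑IU : ∑ U-finite IU ≡ T₁
    ∑IU = trans (∑-cong U-finite (λ c → trans (IU≡ c) (cong (2 ^_) (sym (ℕ.*-identityˡ (U-orbits c)))))) (sym (divSum≡ 1))

  -- With p written as n + 1, both evaluations contain the term 2·4^n. Cancelling it leaves the
  -- desired formula multiplied by p·n, with the negative terms moved to the other side.
  class-equation : p * n * classes + p * n + p * T₁ + 2 * n * 2 ^ n * 2 ^ n ≡ p * (2 * T₂) + 2 * n * 2 ^ n
  class-equation = ℕ.+-cancelʳ-≡ (2 * (x * x)) _ _ (begin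
    p * n * N + p * n + p * T₁ + 2 * n * x * x + 2 * (x * x)        ≡⟨ solve 5 (λ pnN pn pT n x → pnN :+ pn :+ pT :+ con 2 :* n :* x :* x :+ con 2 :* (x :* x) := pnN :+ (pn :+ pT) :+ (con 1 :+ n) :* (con 2 :* (x :* x))) refl (p * n * N) (p * n) (p * T₁) n x ⟩
    p * n * N + (p * n + p * T₁) + suc n * (2 * (x * x))            ≡⟨ cong₂ _+_ (sym ∑row≡) (cong (_* (2 * (x * x))) suc-n) ⟩
    ∑ U-finite row + p * (2 * (x * x))                              ≡⟨ ∑row ⟩
    p * (2 * T₂) + x * (2 * n + 2 * x)                              ≡⟨ solve 3 (λ t n x → t :+ x :* (con 2 :* n :+ con 2 :* x) := t :+ con 2 :* n :* x :+ con 2 :* (x :* x)) refl (p * (2 * T₂)) n x ⟩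
    p * (2 * T₂) + 2 * n * x + 2 * (x * x)                          ∎)
    where
    open ≡-Reasoning
    open ℕ-Solver.+-*-Solver
    x N : ℕ
    x = 2 ^ n
    N = classes

-- Passage to rational numbers

open import Data.Integer using (+_)
open import Data.Rational using (_/_)

-- The comparison takes place among unnormalised rationals, where equality is cross-multiplication
-- and thus an identity between integers.
clear-denominators : ∀ m (N T₁ T₂ x : ℕ) → let n = suc m; p = suc n in
  p * n * N + p * n + p * T₁ + 2 * n * x * x ≡ p * (2 * T₂) + 2 * n * x →
  (+ N ℚ./ 1) ≡ ((((+ (2 * x)) ℤ.* (ℤ.1ℤ ℤ.- + x)) ℚ./ p ℚ.+ (+ (2 * T₂)) ℚ./ n) ℚ.- (+ T₁) ℚ./ n) ℚ.- ℚ.1ℚ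
clear-denominators m N T₁ T₂ x E = ℚ.toℚᵘ-injective (begin
  ℚ.toℚᵘ (+ N ℚ./ 1)                         ≈⟨ ℚ.toℚᵘ-fromℚᵘ (ℚᵘ.mkℚᵘ (+ N) 0) ⟩
  ℚᵘ.mkℚᵘ (+ N) 0                            ≈⟨ ℚᵘ.*≡* cross ⟩
  ((a ℚᵘ.+ b) ℚᵘ.+ ℚᵘ.- c) ℚᵘ.+ ℚᵘ.- ℚᵘ.1ℚᵘ   ≈⟨ ℚᵘ.+-cong (ℚᵘ.+-cong (ℚᵘ.+-cong (ℚ.toℚᵘ-fromℚᵘ a) (ℚ.toℚᵘ-fromℚᵘ b)) (ℚᵘ.-‿cong (ℚ.toℚᵘ-fromℚᵘ c))) ℚᵘ.≃-refl ⟨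
  ((ℚ.toℚᵘ a′ ℚᵘ.+ ℚ.toℚᵘ b′) ℚᵘ.+ ℚᵘ.- ℚ.toℚᵘ c′) ℚᵘ.+ ℚᵘ.- ℚ.toℚᵘ ℚ.1ℚ
    ≈⟨ ℚᵘ.+-cong (ℚᵘ.+-cong (ℚ.toℚᵘ-homo-+ a′ b′) (ℚ.toℚᵘ-homo‿- c′)) (ℚ.toℚᵘ-homo‿- ℚ.1ℚ) ⟨
  (ℚ.toℚᵘ (a′ ℚ.+ b′) ℚᵘ.+ ℚ.toℚᵘ (ℚ.- c′)) ℚᵘ.+ ℚ.toℚᵘ (ℚ.- ℚ.1ℚ)
    ≈⟨ ℚᵘ.+-cong (ℚ.toℚᵘ-homo-+ (a′ ℚ.+ b′) (ℚ.- c′)) ℚᵘ.≃-refl ⟨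
  ℚ.toℚᵘ ((a′ ℚ.+ b′) ℚ.- c′) ℚᵘ.+ ℚ.toℚᵘ (ℚ.- ℚ.1ℚ)
    ≈⟨ ℚ.toℚᵘ-homo-+ ((a′ ℚ.+ b′) ℚ.- c′) (ℚ.- ℚ.1ℚ) ⟨
  ℚ.toℚᵘ (((a′ ℚ.+ b′) ℚ.- c′) ℚ.- ℚ.1ℚ) ∎)
  where
  open ℚᵘ.≃-Reasoning
  n = suc m
  p = suc n
  num = (+ (2 * x)) ℤ.* (ℤ.1ℤ ℤ.- + x)
  a = ℚᵘ.mkℚᵘ num n
  b = ℚᵘ.mkℚᵘ (+ (2 * T₂)) m
  c = ℚᵘ.mkℚᵘ (+ T₁) m
  a′ = num ℚ./ p
  b′ = (+ (2 * T₂)) ℚ./ n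
  c′ = (+ T₁) ℚ./ n

  -- Adding the fractions without normalising gives the denominator p·n·n, one factor n more than in
  -- the hypothesis. The difference of its two sides, which is zero, therefore enters multiplied by
  -- n.
  identity : ∀ p n N T x t → n ℤ.* ((p ℤ.* t ℤ.+ + 2 ℤ.* n ℤ.* x) ℤ.- (p ℤ.* n ℤ.* N ℤ.+ p ℤ.* n ℤ.+ p ℤ.* T ℤ.+ + 2 ℤ.* n ℤ.* x ℤ.* x)) ℤ.+ N ℤ.* (p ℤ.* n ℤ.* n) ≡
    (((+ 2 ℤ.* x ℤ.* (ℤ.1ℤ ℤ.- x)) ℤ.* n ℤ.+ t ℤ.* p) ℤ.* n ℤ.+ (ℤ.- T) ℤ.* (p ℤ.* n)) ℤ.* ℤ.1ℤ ℤ.+ (ℤ.- ℤ.1ℤ) ℤ.* (p ℤ.* n ℤ.* n)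
  identity = solve 6 (λ p n N T x t → n :* ((p :* t :+ con (+ 2) :* n :* x) :- (p :* n :* N :+ p :* n :+ p :* T :+ con (+ 2) :* n :* x :* x)) :+ N :* (p :* n :* n) :=
    (((con (+ 2) :* x :* (con ℤ.1ℤ :- x)) :* n :+ t :* p) :* n :+ (:- T) :* (p :* n)) :* con ℤ.1ℤ :+ (:- con ℤ.1ℤ) :* (p :* n :* n)) refl
    where open ℤ-Solver.+-*-Solver

  Eℤ : + p ℤ.* + n ℤ.* + N ℤ.+ + p ℤ.* + n ℤ.+ + p ℤ.* + T₁ ℤ.+ + 2 ℤ.* + n ℤ.* + x ℤ.* + x ≡ + p ℤ.* + (2 * T₂) ℤ.+ + 2 ℤ.* + n ℤ.* + x
  Eℤ = trans (sym (cong₂ ℤ._+_ (cong₂ ℤ._+_ (cong₂ ℤ._+_ (trans (ℤ.pos-* (p * n) N) (cong (ℤ._* + N) (ℤ.pos-* p n))) (ℤ.pos-* p n)) (ℤ.pos-* p T₁)) (trans (ℤ.pos-* (2 * n * x) x) (cong (ℤ._* + x) 2nx))))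
    (trans (cong +_ E) (cong₂ ℤ._+_ (ℤ.pos-* p (2 * T₂)) 2nx))
    where
    2nx : + (2 * n * x) ≡ + 2 ℤ.* + n ℤ.* + x
    2nx = trans (ℤ.pos-* (2 * n) x) (cong (ℤ._* + x) (ℤ.pos-* 2 n))

  pnn : + (p * n * n) ≡ + p ℤ.* + n ℤ.* + n
  pnn = trans (ℤ.pos-* (p * n) n) (cong (ℤ._* + n) (ℤ.pos-* p n))

  cross : + N ℤ.* ℚᵘ.↧ (((a ℚᵘ.+ b) ℚᵘ.+ ℚᵘ.- c) ℚᵘ.+ ℚᵘ.- ℚᵘ.1ℚᵘ) ≡ ℚᵘ.↥ (((a ℚᵘ.+ b) ℚᵘ.+ ℚᵘ.- c) ℚᵘ.+ ℚᵘ.- ℚᵘ.1ℚᵘ) ℤ.* ℤ.1ℤ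
  cross = E-R.begin
    + N ℤ.* + (p * n * n * 1)                          E-R.≡⟨ cong (+ N ℤ.*_) (trans (cong +_ (ℕ.*-identityʳ (p * n * n))) pnn) ⟩
    + N ℤ.* (+ p ℤ.* + n ℤ.* + n)                       E-R.≡⟨ ℤ.+-identityˡ _ ⟨
    ℤ.0ℤ ℤ.+ + N ℤ.* (+ p ℤ.* + n ℤ.* + n)               E-R.≡⟨ cong (ℤ._+ + N ℤ.* (+ p ℤ.* + n ℤ.* + n)) (trans (sym (ℤ.*-zeroʳ (+ n))) (cong (+ n ℤ.*_) (sym (ℤ.i≡j⇒i-j≡0 (sym Eℤ))))) ⟩
    _                                                  E-R.≡⟨ identity (+ p) (+ n) (+ N) (+ T₁) (+ x) (+ (2 * T₂)) ⟩
    (((+ 2 ℤ.* + x ℤ.* (ℤ.1ℤ ℤ.- + x)) ℤ.* + n ℤ.+ + (2 * T₂) ℤ.* + p) ℤ.* + n ℤ.+ (ℤ.- + T₁) ℤ.* (+ p ℤ.* + n)) ℤ.* ℤ.1ℤ ℤ.+ (ℤ.- ℤ.1ℤ) ℤ.* (+ p ℤ.* + n ℤ.* + n)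
      E-R.≡⟨ cong₂ ℤ._+_ (cong (ℤ._* ℤ.1ℤ) (cong₂ ℤ._+_ (cong (λ u → (u ℤ.* (ℤ.1ℤ ℤ.- + x) ℤ.* + n ℤ.+ + (2 * T₂) ℤ.* + p) ℤ.* + n) (sym (ℤ.pos-* 2 x))) (cong ((ℤ.- + T₁) ℤ.*_) (sym (ℤ.pos-* p n))))) (cong ((ℤ.- ℤ.1ℤ) ℤ.*_) (sym pnn)) ⟩
    ((num ℤ.* + n ℤ.+ + (2 * T₂) ℤ.* + p) ℤ.* + n ℤ.+ (ℤ.- + T₁) ℤ.* + (p * n)) ℤ.* ℤ.1ℤ ℤ.+ (ℤ.- ℤ.1ℤ) ℤ.* + (p * n * n)
      E-R.≡⟨ ℤ.*-identityʳ _ ⟨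
    _ E-R.∎
    where module E-R = ≡-Reasoning

theorem3p5 : (p : ℕ) .{{_ : NonZero p}} → Prime p → p % 2 ≡ 1 →
    Σ ℕ (λ N → NumConnIsoClasses p N × (+ N / 1) ≡ 𝒩₁ p)
theorem3p5 zero          p-prime = contradiction p-prime ¬prime[0]
theorem3p5 (suc zero)    p-prime = contradiction p-prime ¬prime[1]
theorem3p5 p@(suc (suc m)) p-prime p-odd = classes , numConnIsoClasses ,
  -- For p = suc (suc m) the calls of `frac` reduce to fractions and 2 ^ p to 2 * 2 ^ suc m, so the
  -- right-hand side obtained is `𝒩₁ p` by computation.
  clear-denominators m classes T₁ T₂ (2 ^ suc m) class-equation
  where
  open Enumeration p p-prime p-odd
  open Counting p p-prime p-odd
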